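{- Let $m\ge3$ be an integer and let $E(w)\in\mathbb Q[w]$ be the polynomial with $D(w)=E(w)^3$ if $3\nmid m$ and $D(w)=(w^2-\tfrac{27}{4})E(w)^3$ if $3\mid m$. Let $\mathcal E_m$ be the set of all distinct roots of $E$, each root $a$ having multiplicity $\mu(a)$. Then for every integer $n\ge1$, $$V_n(m)=\mathbf 1_{3\mid m}\cdot2\Big(\frac m3\Big)^{2n}+3\sum_{a\in\mathcal E_m}\mu(a)\left(\frac{3m^2}{4a^2}\right)^{n}.$$
   Context: For integers $n\ge1$, $m\ge3$, the $\mathrm{SU}(3)$ Verlinde sum is $$V_n(m)=3^nm^{2n}\sum_{\substack{(j,\ell,k)\in(\mathbb Z/m\mathbb Z\setminus\{0\})^3\\ j+\ell+k\equiv 0 \bmod m}}\Big(8\sin\frac{\pi j}{m}\sin\frac{\pi\ell}{m}\sin\frac{\pi k}{m}\Big)^{ -2n}.$$ With $Q(u):=u^m-i^m$ and $W(u,v,w):=iu^2v^2+u^2v+uv^2-2wuv+u+v-i$ ($i=\sqrt{ -1}$), $$D(w)=\frac{1}{2^{m^2}w^{3m-2}}\operatorname{Res}_u\Big(Q(u),\ \operatorname{Res}_v\big(Q(v),\,W(u,v,w)\big)\Big),$$ where $\operatorname{Res}_x$ is the resultant (Sylvester determinant) with respect to $x$. Equivalently, $D(w)=\prod(w-r_{a,b})$ over all $(a,b)\in(\mathbb Z/m\mathbb Z)^2$ with $a\ne0$, $b\ne0$, $a+b\not\equiv0 \bmod m$, where $r_{a,b}=-\sin\frac{2\pi a}{m}-\sin\frac{2\pi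 b}{m}+\sin\frac{2\pi(a+b)}{m}$. A polynomial $E$ as in the claim exists for every $m\geq 3$. $\mathbf 1_{3\mid m}$ equals $1$ if $3$ divides $m$ and $0$ otherwise. -}

module Defs where

open import Level using (Level; 0ℓ)
open import Algebra.Bundles using (CommutativeRing)
open import Algebra.Bundles.Raw using (RawRing)
import Algebra.Definitions.RawSemiring as RawSemiringDefinitions
open import Data.Bool.Base using (if_then_else_; _∧_)
open import Data.Fin.Base using (Fin; zero; suc; toℕ; punchIn; splitAt)
open import Data.Integer.Base using (ℤ; +_; -[1+_])
open import Data.List.Base
  using (List; []; _∷_; map; foldr; filter; allFin; cartesianProduct)
open import Data.List.Relation.Unary.All using (All)
open import Data.List.Relation.Unary.AllPairs using (AllPairs)
open import Data.List.Relation.Unary.Any using (Any)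
open import Data.Nat.Base as ℕ using (ℕ; zero; suc; _∸_; _≤ᵇ_; _!)
import Data.Nat.Properties as ℕ
open import Data.Nat.Divisibility using (_∣_; _∤_; _∣?_)
open import Data.Product.Base using (Σ; ∃; _×_; _,_; proj₁; proj₂)
open import Data.Rational.Base as ℚ using (ℚ; ↥_; ↧ₙ_)
open import Data.Sum.Base using ([_,_]′)
open import Function.Base using (_∘_)
open import Function.Bundles using (_⇔_)
open import Relation.Binary.Core using (Rel)
open import Relation.Binary.Structures using (IsStrictTotalOrder)
import Relation.Binary.Construct.StrictToNonStrict as StrictToNonStrict
open import Relation.Binary.PropositionalEquality.Core using (_≡_; _≢_)
open import Relation.Nullary.Decidable.Core using (does; ¬?; _×-dec_)
open import Relation.Nullary.Negation.Core using (¬_)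
open import Relation.Unary using (Decidable)

private
  variable
    a b c ℓ : Level

module RingNotation (R : RawRing c ℓ) where
  open RawRing R
  open RawSemiringDefinitions rawSemiring public
    using (_^_; sum) renaming (_×_ to _·_; _∣_ to _divides_)

  infixl 6 _-_

  _-_ : Carrier → Carrier → Carrier
  x - y = x + (- y)

  fromℕ : ℕ → Carrier
  fromℕ n = n · 1#

  fromℤ : ℤ → Carrier
  fromℤ (+ n)    = fromℕ n
  fromℤ -[1+ n ] = - fromℕ (suc n)

  ∑ : {A : Set a} → List A → (A → Carrier) → Carrier
  ∑ xs f = foldr _+_ 0# (map f xs)

-- ℝ is treated axiomatically, as a Dedekind-complete ordered field. This
-- determines it up to isomorphism (classically).
record Reals : Set₁ where
  infix 4 _<_
  infix 9 _⁻¹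
  field
    commutativeRing : CommutativeRing 0ℓ 0ℓ

  open CommutativeRing commutativeRing public

  field
    _<_                : Rel Carrier 0ℓ
    isStrictTotalOrder : IsStrictTotalOrder _≈_ _<_
    +-monoʳ-<          : ∀ z {x y} → x < y → (z + x) < (z + y)
    *-pos              : ∀ {x y} → 0# < x → 0# < y → 0# < (x * y)
    1≉0                : 1# ≉ 0#
    -- The value at 0 is left unspecified.
    _⁻¹                : Carrier → Carrier
    ⁻¹-cong            : ∀ {x y} → x ≈ y → x ⁻¹ ≈ y ⁻¹
    ⁻¹-inverseʳ        : ∀ {x} → x ≉ 0# → x * x ⁻¹ ≈ 1#

  open StrictToNonStrict _≈_ _<_ public using (_≤_)

  IsUpperBound : (Carrier → Set) → Carrier → Set
  IsUpperBound P u = ∀ x → P x → x ≤ u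

  field
    complete : (P : Carrier → Set) → ∃ P → ∃ (IsUpperBound P) →
               Σ Carrier λ s →
                 IsUpperBound P s × (∀ u → IsUpperBound P u → s ≤ u)

module Sine (ℝ : Reals) where
  open Reals ℝ hiding (_-_)
  open RingNotation rawRing

  HasSum : (ℕ → Carrier) → Carrier → Set
  HasSum f s = ∀ ε → 0# < ε → ∃ λ N → ∀ n → N ℕ.≤ n →
    let d = sum {n} (f ∘ toℕ) - s in (- ε < d) × (d < ε)

  sineTerm : Carrier → ℕ → Carrier
  sineTerm x k =
    (- 1#) ^ k * x ^ (2 ℕ.* k ℕ.+ 1) * (fromℕ ((2 ℕ.* k ℕ.+ 1) !)) ⁻¹

  IsSine : (Carrier → Carrier) → Set
  IsSine sin = ∀ x → HasSum (sineTerm x) (sin x)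

  -- π is the least positive zero of the sine.
  IsPi : (Carrier → Carrier) → Carrier → Set
  IsPi sin π = 0# < π × sin π ≈ 0# × (∀ x → 0# < x → x < π → sin x ≉ 0#)

module Verlinde (ℝ : Reals) (sin : Reals.Carrier ℝ → Reals.Carrier ℝ)
                (π : Reals.Carrier ℝ) where
  open Reals ℝ hiding (_-_)
  open RingNotation rawRing

  -- ℤ/mℤ is represented by Fin m. The choice of representatives affects
  -- the sines in the sum only by a sign, which the even power removes.
  Admissible : (m : ℕ) → Fin m × Fin m × Fin m → Set
  Admissible m (j , l , k) =
    toℕ j ≢ 0 × toℕ l ≢ 0 × toℕ k ≢ 0 × m ∣ toℕ j ℕ.+ toℕ l ℕ.+ toℕ k

  admissible? : (m : ℕ) → Decidable (Admissible m)
  admissible? m (j , l , k) =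
    ¬? (toℕ j ℕ.≟ 0) ×-dec ¬? (toℕ l ℕ.≟ 0) ×-dec ¬? (toℕ k ℕ.≟ 0) ×-dec
    m ∣? (toℕ j ℕ.+ toℕ l ℕ.+ toℕ k)

  triples : (m : ℕ) → List (Fin m × Fin m × Fin m)
  triples m = filter (admissible? m)
    (cartesianProduct (allFin m) (cartesianProduct (allFin m) (allFin m)))

  s : (m : ℕ) → Fin m → Carrier
  s m j = sin (π * fromℕ (toℕ j) * (fromℕ m) ⁻¹)

  V : (n m : ℕ) → Carrier
  V n m = fromℕ 3 ^ n * fromℕ m ^ (2 ℕ.* n) *
    ∑ (triples m) λ (j , l , k) →
      (fromℕ 8 * s m j * s m l * s m k) ⁻¹ ^ (2 ℕ.* n)

module Complex (ℝ : Reals) where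
  open Reals ℝ hiding (_-_)
  open RingNotation rawRing using (_-_; fromℕ; fromℤ)

  ℂ : RawRing 0ℓ 0ℓ
  ℂ = record
    { Carrier = Carrier × Carrier
    ; _≈_     = λ (x , y) (x′ , y′) → x ≈ x′ × y ≈ y′
    ; _+_     = λ (x , y) (x′ , y′) → x + x′ , y + y′
    ; _*_     = λ (x , y) (x′ , y′) → x * x′ - y * y′ , x * y′ + y * x′
    ; -_      = λ (x , y) → - x , - y
    ; 0#      = 0# , 0#
    ; 1#      = 1# , 0#
    }

  𝕚 : RawRing.Carrier ℂ
  𝕚 = 0# , 1#

  fromℝ : Carrier → RawRing.Carrier ℂ
  fromℝ x = x , 0#

  infix 9 _⁻¹ᶜ

  _⁻¹ᶜ : RawRing.Carrier ℂ → RawRing.Carrier ℂ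
  (x , y) ⁻¹ᶜ = x * N ⁻¹ , (- y) * N ⁻¹
    where N = x * x + y * y

  fromℚ : ℚ → RawRing.Carrier ℂ
  fromℚ q = fromℝ (fromℤ (↥ q) * (fromℕ (↧ₙ q)) ⁻¹)

-- Coefficient lists, constant term first; trailing zeros are allowed, so
-- equality is equality of all coefficients.
module Polynomial (R : RawRing c ℓ) where
  open RawRing R

  coeff : List Carrier → ℕ → Carrier
  coeff []      _       = 0#
  coeff (x ∷ p) zero    = x
  coeff (x ∷ p) (suc k) = coeff p k

  add : List Carrier → List Carrier → List Carrier
  add []      q       = q
  add (x ∷ p) []      = x ∷ p
  add (x ∷ p) (y ∷ q) = (x + y) ∷ add p q

  mul : List Carrier → List Carrier → List Carrier
  mul []      q = []
  mul (x ∷ p) q = add (map (x *_) q) (0# ∷ mul p q)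

  Poly : RawRing c ℓ
  Poly = record
    { Carrier = List Carrier
    ; _≈_     = λ p q → ∀ k → coeff p k ≈ coeff q k
    ; _+_     = add
    ; _*_     = mul
    ; -_      = map -_
    ; 0#      = []
    ; 1#      = 1# ∷ []
    }

  C : Carrier → List Carrier
  C x = x ∷ []

  X : List Carrier
  X = 0# ∷ 1# ∷ []

  eval : List Carrier → Carrier → Carrier
  eval p x = foldr (λ y v → y + x * v) 0# p

open Polynomial public using (Poly)

module Resultant (R : RawRing c ℓ) where
  open RawRing R
  open RingNotation R
  open Polynomial R using (coeff)

  -- Laplace expansion along the first row.
  det : ∀ {n} → (Fin n → Fin n → Carrier) → Carrier
  det {zero}  M = 1#
  det {suc n} M = sum λ j →
    (- 1#) ^ toℕ j * M zero j * det (λ i k → M (suc i) (punchIn j k))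

  -- Entry j of the row listing the coefficients of p, of degree d, from the
  -- leading one down, shifted right by i places.
  shiftedRow : ℕ → List Carrier → ℕ → ℕ → Carrier
  shiftedRow d p i j =
    if (i ≤ᵇ j) ∧ ((j ∸ i) ≤ᵇ d) then coeff p (d ∸ (j ∸ i)) else 0#

  sylvester : (d e : ℕ) → List Carrier → List Carrier →
              Fin (e ℕ.+ d) → Fin (e ℕ.+ d) → Carrier
  sylvester d e p q r j =
    [ (λ i → shiftedRow d p (toℕ i) (toℕ j))
    , (λ i → shiftedRow e q (toℕ i) (toℕ j)) ]′ (splitAt e r)

  -- The resultant of p, of degree d, and q, of degree e.
  Res : (d e : ℕ) → List Carrier → List Carrier → Carrier
  Res d e p q = det (sylvester d e p q)

module DPolynomial (ℝ : Reals) where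
  open Complex ℝ

  ℂ[w] ℂ[w,u] ℂ[w,u,v] : RawRing 0ℓ 0ℓ
  ℂ[w]     = Poly ℂ
  ℂ[w,u]   = Poly ℂ[w]
  ℂ[w,u,v] = Poly ℂ[w,u]

  -- xᵐ - ιᵐ in R[x], for the element ι of R.
  Q : (R : RawRing c ℓ) → RawRing.Carrier R → ℕ → RawRing.Carrier (Poly R)
  Q R ι m = X ^ m - C (RingNotation._^_ R ι m)
    where
    open Polynomial R using (X; C)
    open RingNotation (Poly R)

  private
    module Pw = Polynomial ℂ
    module Pu = Polynomial ℂ[w]
    module Pv = Polynomial ℂ[w,u]

  W : RawRing.Carrier ℂ[w,u,v]
  W = i * u ^ 2 * v ^ 2 + u ^ 2 * v + u * v ^ 2 - fromℕ 2 * w * u * v + u + v - i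
    where
    open RawRing ℂ[w,u,v] using (Carrier; _+_; _*_)
    open RingNotation ℂ[w,u,v]
    i w u v : Carrier
    i = Pv.C (Pu.C (Pw.C 𝕚))
    w = Pv.C (Pu.C Pw.X)
    u = Pv.C Pu.X
    v = Pv.X

  resᵥ : ℕ → RawRing.Carrier ℂ[w,u]
  resᵥ m = Resultant.Res ℂ[w,u] m 2 (Q ℂ[w,u] (Pu.C (Pw.C 𝕚)) m) W

  -- resᵥ m is the product of W(u,β,w) over the roots β of Q. It has degree
  -- 2m-1 in u, not 2m, because i is a root of Q and W(u,i,w) = -2iwu.
  resᵤ : ℕ → RawRing.Carrier ℂ[w]
  resᵤ m = Resultant.Res ℂ[w] m (2 ℕ.* m ∸ 1) (Q ℂ[w] (Pw.C 𝕚) m) (resᵥ m)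

  open RawRing ℂ[w] using (Carrier; _≈_; _*_)
  open RingNotation ℂ[w]

  -- D = resᵤ m / (2^(m²) w^(3m-2)), an exact division in ℂ[w].
  IsD : ℕ → Carrier → Set
  IsD m D = fromℕ (2 ℕ.^ (m ℕ.^ 2)) * Pw.X ^ (3 ℕ.* m ∸ 2) * D ≈ resᵤ m

  ℚ[w] : RawRing 0ℓ 0ℓ
  ℚ[w] = Poly ℚ.+-*-rawRing

  toℂ[w] : RawRing.Carrier ℚ[w] → Carrier
  toℂ[w] = map fromℚ

  IsE : ℕ → Carrier → RawRing.Carrier ℚ[w] → Set
  IsE m D E =
    (3 ∤ m → D ≈ toℂ[w] E ^ 3) ×
    (3 ∣ m → D ≈ (Pw.X ^ 2 - Pw.C (fromℚ (+ 27 ℚ./ 4))) * toℂ[w] E ^ 3)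

  record DistinctRoots (p : Carrier) : Set where
    private module ℂ = RawRing ℂ
    field
      roots        : List ℂ.Carrier
      distinct     : AllPairs ℂ._≉_ roots
      complete     : ∀ a → Any (a ℂ.≈_) roots ⇔ Pw.eval p a ℂ.≈ ℂ.0#
      μ            : ℂ.Carrier → ℕ
      multiplicity : All (λ a → (Pw.X - Pw.C a) ^ μ a divides p ×
                           ¬ ((Pw.X - Pw.C a) ^ suc (μ a) divides p)) roots

𝟙[3∣_] : ℕ → ℕ
𝟙[3∣ m ] = if does (3 ∣? m) then 1 else 0

module RootSum (ℝ : Reals) where
  open Complex ℝ
  open DPolynomial ℝ
  open RawRing ℂ
  open RingNotation ℂ

  rootSum : (n m : ℕ) {p : RawRing.Carrier ℂ[w]} → DistinctRoots p → Carrier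
  rootSum n m 𝓔 =
    fromℕ 𝟙[3∣ m ] * (fromℕ 2 * (fromℕ m * fromℕ 3 ⁻¹ᶜ) ^ (2 ℕ.* n)) +
    fromℕ 3 * ∑ roots λ a →
      fromℕ (μ a) * (fromℕ 3 * fromℕ m ^ 2 * (fromℕ 4 * a ^ 2) ⁻¹ᶜ) ^ n
    where open DistinctRoots 𝓔

{-# OPTIONS --safe #-}
module Submission where

-- Put η = e^{iπ/m} and ζ = η². The roots of Q are the iζᵃ, and
-- W(iζᵃ, iζᵇ, w) = 2 ζᵃ⁺ᵇ (w - r_{a,b}). Since Res (∏ (x - βₖ), q) = ∏ q(βₖ),
-- the double resultant is the product of these over all a and b. Exactly
-- 3m - 2 of the r_{a,b} vanish identically (a = 0, b = 0 or a + b = 0), so D is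
-- the product of the w - r_{a,b} over the admissible triples. As
-- sin 2x + sin 2y + sin 2z = ± 4 sin x sin y sin z whenever x + y + z ∈ πℤ,
-- 4 r² = (8 sin x sin y sin z)², which makes V_n(m) the sum of (3m²/4r²)ⁿ over
-- the roots r of D with multiplicity. These are the roots of E, each counted
-- 3μ times, and for 3 ∣ m also ±√27/2, contributing (m/3)²ⁿ each.
--
-- The resultant formula comes from rewriting the Sylvester matrix in a Newton
-- basis with nodes βₖ, where it is triangular up to unitriangular factors. Only
-- the sine is given, so η is built from the partial sums of e^{ix}, which are
-- multiplicative up to a null sequence.

open import Defs
open import Level using (Level; 0ℓ)
open import Algebra.Bundles using (CommutativeRing; CommutativeMonoid)
open import Algebra.Bundles.Raw using (RawRing)
import Algebra.Properties.CommutativeSemigroup as CommutativeSemigroupProperties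
import Algebra.Properties.CommutativeSemiring.Exp as CommutativeExp
import Algebra.Properties.Monoid.Mult as MultProperties
import Algebra.Properties.Ring as RingProperties
import Algebra.Properties.Semiring.Exp as Exp
import Algebra.Properties.Semiring.Mult as SemiringMultProperties
import Algebra.Solver.Ring as RingSolver
open import Algebra.Solver.Ring.AlmostCommutativeRing
  using (fromCommutativeRing; _-Raw-AlmostCommutative⟶_)
open import Algebra.Structures using (IsCommutativeRing)
open import Data.Bool.Base using (true; false; if_then_else_; T)
open import Data.Fin.Base using (Fin; zero; suc; toℕ; splitAt; punchIn)
import Data.Fin.Properties as Fin
open import Data.List.Base
  using (List; []; _∷_; _++_; map; foldr; filter; length; tabulate; allFin; cartesianProduct)
open import Data.List.Relation.Unary.All as All using (All; []; _∷_)
import Data.List.Relation.Unary.All.Properties as All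
open import Data.List.Relation.Unary.AllPairs using (AllPairs; []; _∷_)
open import Data.List.Relation.Unary.Any using (Any; here; there)
open import Data.Maybe.Base using (Maybe; just; nothing)
open import Data.Nat.Base as ℕ using (ℕ; zero; suc; _∸_; z≤n; s≤s; _!)
open import Data.Nat.Divisibility as ℕ using (_∣_; _∣?_; divides)
import Data.Nat.Properties as ℕ
import Data.Nat.Solver as ℕSolver
open import Data.Product.Base using (Σ; ∃; _×_; _,_; proj₁; proj₂)
import Data.Rational.Base as ℚ
open import Data.Sum.Base using (_⊎_; inj₁; inj₂; [_,_]′)
open import Data.Unit.Base using (tt)
open import Function.Base using (_∘_; id)
open import Function.Bundles using (Equivalence)
import Relation.Binary.Construct.StrictToNonStrict as StrictToNonStrict
open import Relation.Binary.Definitions using (tri<; tri≈; tri>)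
open import Relation.Binary.PropositionalEquality.Core as ≡ using (_≡_; _≢_)
import Relation.Binary.Reasoning.Setoid as SetoidReasoning
open import Relation.Binary.Structures using (IsStrictTotalOrder; IsTotalOrder)
open import Relation.Nullary.Decidable
  using (Dec; yes; no; ¬?; _×-dec_; dec-true; dec-false)
open import Relation.Nullary.Negation.Core using (¬_; contradiction)
open import Relation.Unary using (Pred; Decidable)

-- The inner resultant is taken over polynomials in w and u, where no division is at hand. The usual
-- Vandermonde argument would have to cancel a determinant there; Newton coefficients are given by a
-- recursion without division, so every matrix involved is triangular for formal reasons. What has
-- to be known of the nodes is only that xᵐ - iᵐ is the product of the x - βₖ. This holds because
-- their differences are nonzero complex constants, and these remain units in every polynomial ring
-- over ℂ.
--
-- That `D` is a cube, up to a quadratic factor, is given with `E`. So the orbits of the roots under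
-- permutations of the triples need not be analysed: it suffices to compare, root by root, the order
-- of vanishing of the product of the w - r with that of E³.
--
-- Completeness of ℝ is available only through suprema of sets known to be bounded, so the
-- Archimedean property is proved by contradiction. Doubly negated limits are nevertheless enough,
-- since trichotomy makes equality decidable and hence stable.

private
  variable
    c ℓ ℓ₁ ℓ₂ ℓ₃ : Level

-- Integer coefficients make the solver complete for ring identities. An integer
-- is a pair (a , b) standing for a - b, with a or b zero.
module Solver (R : CommutativeRing c ℓ) where
  open CommutativeRing R hiding (_-_; zero)
  open RingNotation rawRing
  open RingProperties ring using (-‿distribˡ-*; -‿distribʳ-*; -0#≈0#; -‿involutive; -‿+-comm)
  open SetoidReasoning setoid

  private
    -- The recursion stops at `1#` rather than at `1# + 0#`, so that the coefficients 0 and 1 denote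
    -- `0#` and `1#` on the nose.
    nat : ℕ → Carrier
    nat zero          = 0#
    nat (suc zero)    = 1#
    nat (suc (suc n)) = 1# + nat (suc n)

    ⟦_⟧ : ℕ × ℕ → Carrier
    ⟦ a , zero  ⟧ = nat a
    ⟦ a , suc b ⟧ = nat a - nat (suc b)

    nat≈ : ∀ n → nat n ≈ fromℕ n
    nat≈ zero          = refl
    nat≈ (suc zero)    = sym (+-identityʳ 1#)
    nat≈ (suc (suc n)) = +-congˡ (nat≈ (suc n))

    ⟦⟧≈ : ∀ a b → ⟦ a , b ⟧ ≈ fromℕ a - fromℕ b
    ⟦⟧≈ a zero    = trans (nat≈ a) (trans (sym (+-identityʳ _)) (+-congˡ (sym -0#≈0#)))
    ⟦⟧≈ a (suc b) = +-cong (nat≈ a) (-‿cong (nat≈ (suc b)))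

    +-interchange : ∀ w x y z → (w + x) + (y + z) ≈ (w + y) + (x + z)
    +-interchange = CommutativeSemigroupProperties.interchange +-commutativeSemigroup

    difference-suc : ∀ x y → (1# + x) - (1# + y) ≈ x - y
    difference-suc x y = begin
      (1# + x) + (- (1# + y)) ≈⟨ +-congˡ (-‿+-comm 1# y) ⟨
      (1# + x) + (- 1# + - y) ≈⟨ +-interchange 1# x (- 1#) (- y) ⟩
      (1# + - 1#) + (x + - y) ≈⟨ +-congʳ (-‿inverseʳ 1#) ⟩
      0# + (x - y) ≈⟨ +-identityˡ _ ⟩
      x - y ∎

    -- Truncated subtraction in both directions leaves one component zero. Equal integers then have
    -- identical pairs, which is what `_≟_` compares.
    normalise : ℕ × ℕ → ℕ × ℕ
    normalise (a , b) = a ∸ b , b ∸ a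

    normalise≈ : ∀ a b → ⟦ normalise (a , b) ⟧ ≈ fromℕ a - fromℕ b
    normalise≈ zero    zero    = ⟦⟧≈ 0 0
    normalise≈ zero    (suc b) = ⟦⟧≈ 0 (suc b)
    normalise≈ (suc a) zero    = ⟦⟧≈ (suc a) 0
    normalise≈ (suc a) (suc b) = trans (normalise≈ a b) (sym (difference-suc _ _))

    coefficients : RawRing 0ℓ 0ℓ
    coefficients = record
      { Carrier = ℕ × ℕ
      ; _≈_     = _≡_
      ; _+_     = λ (a , b) (a′ , b′) → normalise (a ℕ.+ a′ , b ℕ.+ b′)
      ; _*_     = λ (a , b) (a′ , b′) →
                    normalise (a ℕ.* a′ ℕ.+ b ℕ.* b′ , a ℕ.* b′ ℕ.+ b ℕ.* a′)
      ; -_      = λ (a , b) → b , a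
      ; 0#      = 0 , 0
      ; 1#      = 1 , 0
      }

    fromℕ-+ : ∀ m n → fromℕ (m ℕ.+ n) ≈ fromℕ m + fromℕ n
    fromℕ-+ = MultProperties.×-homo-+ +-monoid 1#

    fromℕ-* : ∀ m n → fromℕ (m ℕ.* n) ≈ fromℕ m * fromℕ n
    fromℕ-* = SemiringMultProperties.×1-homo-* semiring

    -‿+-interchange : ∀ w x y z → (w + y) - (x + z) ≈ (w - x) + (y - z)
    -‿+-interchange w x y z =
      trans (+-congˡ (sym (-‿+-comm x z))) (+-interchange w y (- x) (- z))

    +-homo : ∀ p q → ⟦ RawRing._+_ coefficients p q ⟧ ≈ ⟦ p ⟧ + ⟦ q ⟧
    +-homo (a , b) (a′ , b′) = begin
      ⟦ normalise (a ℕ.+ a′ , b ℕ.+ b′) ⟧ ≈⟨ normalise≈ (a ℕ.+ a′) (b ℕ.+ b′) ⟩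
      fromℕ (a ℕ.+ a′) - fromℕ (b ℕ.+ b′) ≈⟨ +-cong (fromℕ-+ a a′) (-‿cong (fromℕ-+ b b′)) ⟩
      (fromℕ a + fromℕ a′) - (fromℕ b + fromℕ b′) ≈⟨ -‿+-interchange _ _ _ _ ⟩
      (fromℕ a - fromℕ b) + (fromℕ a′ - fromℕ b′) ≈⟨ +-cong (⟦⟧≈ a b) (⟦⟧≈ a′ b′) ⟨
      ⟦ a , b ⟧ + ⟦ a′ , b′ ⟧ ∎

    *-difference : ∀ w x y z → (w - x) * (y - z) ≈ (w * y + x * z) - (w * z + x * y)
    *-difference w x y z = begin
      (w + - x) * (y + - z) ≈⟨ distribʳ _ _ _ ⟩
      w * (y + - z) + - x * (y + - z) ≈⟨ +-cong (distribˡ _ _ _) (distribˡ _ _ _) ⟩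
      (w * y + w * - z) + (- x * y + - x * - z) ≈⟨ +-cong (+-congˡ (sym (-‿distribʳ-* w z))) (+-cong (sym (-‿distribˡ-* x y)) xz) ⟩
      (w * y + - (w * z)) + (- (x * y) + x * z) ≈⟨ +-congˡ (+-comm _ _) ⟩
      (w * y + - (w * z)) + (x * z + - (x * y)) ≈⟨ +-interchange _ _ _ _ ⟩
      (w * y + x * z) + (- (w * z) + - (x * y)) ≈⟨ +-congˡ (-‿+-comm _ _) ⟩
      (w * y + x * z) + - (w * z + x * y) ∎
      where
      xz : - x * - z ≈ x * z
      xz = trans (sym (-‿distribˡ-* x (- z)))
                 (trans (-‿cong (sym (-‿distribʳ-* x z))) (-‿involutive _))

    *-homo : ∀ p q → ⟦ RawRing._*_ coefficients p q ⟧ ≈ ⟦ p ⟧ * ⟦ q ⟧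
    *-homo (a , b) (a′ , b′) = begin
      ⟦ normalise (a ℕ.* a′ ℕ.+ b ℕ.* b′ , a ℕ.* b′ ℕ.+ b ℕ.* a′) ⟧
        ≈⟨ normalise≈ (a ℕ.* a′ ℕ.+ b ℕ.* b′) (a ℕ.* b′ ℕ.+ b ℕ.* a′) ⟩
      fromℕ (a ℕ.* a′ ℕ.+ b ℕ.* b′) - fromℕ (a ℕ.* b′ ℕ.+ b ℕ.* a′)
        ≈⟨ +-cong (sum-of-products a a′ b b′) (-‿cong (sum-of-products a b′ b a′)) ⟩
      (fromℕ a * fromℕ a′ + fromℕ b * fromℕ b′) - (fromℕ a * fromℕ b′ + fromℕ b * fromℕ a′)
        ≈⟨ *-difference _ _ _ _ ⟨
      (fromℕ a - fromℕ b) * (fromℕ a′ - fromℕ b′)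
        ≈⟨ *-cong (⟦⟧≈ a b) (⟦⟧≈ a′ b′) ⟨
      ⟦ a , b ⟧ * ⟦ a′ , b′ ⟧ ∎
      where
      sum-of-products : ∀ p q r s →
        fromℕ (p ℕ.* q ℕ.+ r ℕ.* s) ≈ fromℕ p * fromℕ q + fromℕ r * fromℕ s
      sum-of-products p q r s =
        trans (fromℕ-+ (p ℕ.* q) (r ℕ.* s)) (+-cong (fromℕ-* p q) (fromℕ-* r s))

    -‿homo : ∀ p → ⟦ RawRing.-_ coefficients p ⟧ ≈ - ⟦ p ⟧
    -‿homo (a , b) = begin
      ⟦ b , a ⟧ ≈⟨ ⟦⟧≈ b a ⟩
      fromℕ b - fromℕ a ≈⟨ +-comm _ _ ⟩
      - fromℕ a + fromℕ b ≈⟨ +-congˡ (-‿involutive _) ⟨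
      - fromℕ a + - - fromℕ b ≈⟨ -‿+-comm _ _ ⟩
      - (fromℕ a - fromℕ b) ≈⟨ -‿cong (⟦⟧≈ a b) ⟨
      - ⟦ a , b ⟧ ∎

    morphism : coefficients -Raw-AlmostCommutative⟶ fromCommutativeRing R
    morphism = record
      { ⟦_⟧    = ⟦_⟧
      ; +-homo = +-homo
      ; *-homo = *-homo
      ; -‿homo = -‿homo
      ; 0-homo = refl
      ; 1-homo = refl
      }

    _≟_ : ∀ p q → Maybe (⟦ p ⟧ ≈ ⟦ q ⟧)
    (a , b) ≟ (a′ , b′) with a ℕ.≟ a′ | b ℕ.≟ b′
    ... | yes ≡.refl | yes ≡.refl = just refl
    ... | _          | _          = nothing

  open RingSolver coefficients (fromCommutativeRing R) morphism _≟_ public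
    using (Polynomial; solve; con; _:=_; _:+_; _:*_; _:-_; :-_)

  :0 :1 : ∀ {n} → Polynomial n
  :0 = con (0 , 0)
  :1 = con (1 , 0)

  -- A sum of ones instead of a single coefficient: it evaluates definitionally to `fromℕ k`,
  -- whereas `nat k` has a different normal form.
  :fromℕ : ∀ {n} → ℕ → Polynomial n
  :fromℕ zero    = :0
  :fromℕ (suc k) = :1 :+ :fromℕ k

-- Iterated operations over initial segments of ℕ

module Range (M : CommutativeMonoid c ℓ) where
  open CommutativeMonoid M
  open SetoidReasoning setoid
  open CommutativeSemigroupProperties commutativeSemigroup using (interchange)
  open MultProperties monoid using () renaming (_×_ to _times_)

  -- Opaque, so that the summand can be inferred even if the range is a successor.
  opaque
    ⨁ : ℕ → (ℕ → Carrier) → Carrier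
    ⨁ zero    f = ε
    ⨁ (suc n) f = f 0 ∙ ⨁ n (f ∘ suc)

  opaque
    unfolding ⨁

    ⨁-zero : ∀ f → ⨁ 0 f ≈ ε
    ⨁-zero f = refl

    ⨁-suc : ∀ n f → ⨁ (suc n) f ≈ f 0 ∙ ⨁ n (f ∘ suc)
    ⨁-suc n f = refl

    ⨁-cong : ∀ n {f g} → (∀ k → k ℕ.< n → f k ≈ g k) → ⨁ n f ≈ ⨁ n g
    ⨁-cong zero    f≈g = refl
    ⨁-cong (suc n) f≈g = ∙-cong (f≈g 0 (s≤s z≤n)) (⨁-cong n λ k k<n → f≈g (suc k) (s≤s k<n))

    ⨁-ε : ∀ n {f} → (∀ k → k ℕ.< n → f k ≈ ε) → ⨁ n f ≈ ε
    ⨁-ε zero    f≈ε = refl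
    ⨁-ε (suc n) f≈ε =
      trans (∙-cong (f≈ε 0 (s≤s z≤n)) (⨁-ε n λ k k<n → f≈ε (suc k) (s≤s k<n))) (identityˡ ε)

    ⨁-last : ∀ n f → ⨁ (suc n) f ≈ ⨁ n f ∙ f n
    ⨁-last zero    f = comm _ _
    ⨁-last (suc n) f = trans (∙-congˡ (⨁-last n (f ∘ suc))) (sym (assoc _ _ _))

    ⨁-∙ : ∀ n f g → ⨁ n (λ k → f k ∙ g k) ≈ ⨁ n f ∙ ⨁ n g
    ⨁-∙ zero    f g = sym (identityˡ ε)
    ⨁-∙ (suc n) f g = trans (∙-congˡ (⨁-∙ n (f ∘ suc) (g ∘ suc))) (interchange _ _ _ _)

    ⨁-const : ∀ n x → ⨁ n (λ _ → x) ≈ n times x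
    ⨁-const zero    x = refl
    ⨁-const (suc n) x = ∙-congˡ (⨁-const n x)

    ⨁-pick : ∀ n a f → a ℕ.< n → (∀ k → k ℕ.< n → k ≢ a → f k ≈ ε) → ⨁ n f ≈ f a
    ⨁-pick (suc n) zero    f _         f≈ε =
      trans (∙-congˡ (⨁-ε n λ k k<n → f≈ε (suc k) (s≤s k<n) λ ())) (identityʳ _)
    ⨁-pick (suc n) (suc a) f (s≤s a<n) f≈ε =
      trans (∙-cong (f≈ε 0 (s≤s z≤n) λ ())
                    (⨁-pick n a (f ∘ suc) a<n λ k k<n k≢a →
                      f≈ε (suc k) (s≤s k<n) (k≢a ∘ ℕ.suc-injective)))
            (identityˡ _)

    ⨁-pick₂ : ∀ n a f → suc a ℕ.< n →
              (∀ k → k ℕ.< n → k ≢ a → k ≢ suc a → f k ≈ ε) → ⨁ n f ≈ f a ∙ f (suc a)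
    ⨁-pick₂ (suc n) zero    f (s≤s 0<n) f≈ε =
      ∙-congˡ (⨁-pick n 0 (f ∘ suc) 0<n λ k k<n k≢0 →
        f≈ε (suc k) (s≤s k<n) (λ ()) (k≢0 ∘ ℕ.suc-injective))
    ⨁-pick₂ (suc n) (suc a) f (s≤s a<n) f≈ε =
      trans (∙-cong (f≈ε 0 (s≤s z≤n) (λ ()) (λ ()))
                    (⨁-pick₂ n a (f ∘ suc) a<n λ k k<n k≢a k≢sa →
                      f≈ε (suc k) (s≤s k<n) (k≢a ∘ ℕ.suc-injective) (k≢sa ∘ ℕ.suc-injective)))
            (identityˡ _)

    ⨁-swap : ∀ m n (f : ℕ → ℕ → Carrier) →
             ⨁ m (λ j → ⨁ n (f j)) ≈ ⨁ n (λ k → ⨁ m (λ j → f j k))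
    ⨁-swap zero    n f = sym (⨁-ε n λ _ _ → refl)
    ⨁-swap (suc m) n f = begin
      ⨁ n (f 0) ∙ ⨁ m (λ j → ⨁ n (f (suc j))) ≈⟨ ∙-congˡ (⨁-swap m n (f ∘ suc)) ⟩
      ⨁ n (f 0) ∙ ⨁ n (λ k → ⨁ m (λ j → f (suc j) k)) ≈⟨ ⨁-∙ n _ _ ⟨
      ⨁ n (λ k → f 0 k ∙ ⨁ m (λ j → f (suc j) k)) ∎

    ⨁-reverse : ∀ n f → ⨁ n (λ k → f (n ∸ suc k)) ≈ ⨁ n f
    ⨁-reverse zero    f = refl
    ⨁-reverse (suc n) f = begin
      f n ∙ ⨁ n (λ k → f (n ∸ suc k)) ≈⟨ ∙-congˡ (⨁-reverse n f) ⟩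
      f n ∙ ⨁ n f ≈⟨ comm _ _ ⟩
      ⨁ n f ∙ f n ≈⟨ ⨁-last n f ⟨
      ⨁ (suc n) f ∎

    ⨁-++ : ∀ m n f → ⨁ (m ℕ.+ n) f ≈ ⨁ m f ∙ ⨁ n (λ k → f (m ℕ.+ k))
    ⨁-++ zero    n f = sym (identityˡ _)
    ⨁-++ (suc m) n f = trans (∙-congˡ (⨁-++ m n (f ∘ suc))) (sym (assoc _ _ _))

-- Determinants

module FiniteSums (R : CommutativeRing c ℓ) where
  open CommutativeRing R hiding (_-_; zero)
  open RingNotation rawRing
  open SetoidReasoning setoid

  open Range +-commutativeMonoid public
    using ()
    renaming ( ⨁ to ∑<; ⨁-zero to ∑-zero; ⨁-suc to ∑-suc; ⨁-cong to ∑-cong; ⨁-ε to ∑-0; ⨁-last to ∑-last; ⨁-∙ to ∑-+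
             ; ⨁-pick to ∑-pick; ⨁-pick₂ to ∑-pick₂; ⨁-reverse to ∑-reverse
            ; ⨁-++ to ∑-++ )
  open Range *-commutativeMonoid public
    using ()
    renaming ( ⨁ to ∏<; ⨁-zero to ∏-zero; ⨁-suc to ∏-suc; ⨁-cong to ∏-cong; ⨁-ε to ∏-1; ⨁-last to ∏-last; ⨁-∙ to ∏-*
             ; ⨁-const to ∏-const; ⨁-pick to ∏-pick; ⨁-swap to ∏-swap
             ; ⨁-reverse to ∏-reverse )

  ∑-*ˡ : ∀ n x f → ∑< n (λ k → x * f k) ≈ x * ∑< n f
  ∑-*ˡ zero    x f = trans (∑-zero _) (sym (trans (*-congˡ (∑-zero f)) (zeroʳ x)))
  ∑-*ˡ (suc n) x f = begin
    ∑< (suc n) (λ k → x * f k) ≈⟨ ∑-suc n _ ⟩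
    x * f 0 + ∑< n (λ k → x * f (suc k)) ≈⟨ +-congˡ (∑-*ˡ n x (f ∘ suc)) ⟩
    x * f 0 + x * ∑< n (f ∘ suc) ≈⟨ distribˡ _ _ _ ⟨
    x * (f 0 + ∑< n (f ∘ suc)) ≈⟨ *-congˡ (∑-suc n f) ⟨
    x * ∑< (suc n) f ∎

  ∑-*ʳ : ∀ n f x → ∑< n (λ k → f k * x) ≈ ∑< n f * x
  ∑-*ʳ n f x = trans (∑-cong n λ _ _ → *-comm _ _) (trans (∑-*ˡ n x f) (*-comm _ _))

  sum≈∑ : ∀ n f → sum {n} (f ∘ toℕ) ≈ ∑< n f
  sum≈∑ zero    f = sym (∑-zero f)
  sum≈∑ (suc n) f = trans (+-congˡ (sum≈∑ n (f ∘ suc))) (sym (∑-suc n f))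

-- Unlike if does p then x else y, this reduces when a with-abstraction decides p.
choose : {P : Set ℓ₃} {A : Set ℓ₁} → Dec P → A → A → A
choose (yes _) x y = x
choose (no  _) x y = y

-- Fin.punchIn on ℕ.
skip : ℕ → ℕ → ℕ
skip zero    k       = suc k
skip (suc j) zero    = zero
skip (suc j) (suc k) = suc (skip j k)

toℕ-punchIn : ∀ {n} (j : Fin (suc n)) (k : Fin n) → toℕ (punchIn j k) ≡ skip (toℕ j) (toℕ k)
toℕ-punchIn zero    k       = ≡.refl
toℕ-punchIn (suc j) zero    = ≡.refl
toℕ-punchIn (suc j) (suc k) = ≡.cong suc (toℕ-punchIn j k)

skip-injective : ∀ j {k l} → skip j k ≡ skip j l → k ≡ l
skip-injective zero                        eq = ℕ.suc-injective eq
skip-injective (suc j) {zero}  {zero}      eq = ≡.refl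
skip-injective (suc j) {suc k} {suc l}     eq =
  ≡.cong suc (skip-injective j (ℕ.suc-injective eq))

skip-≢ : ∀ j k → skip j k ≢ j
skip-≢ (suc j) (suc k) eq = skip-≢ j k (ℕ.suc-injective eq)

skip-surjective : ∀ {j k} → k ≢ j → ∃ λ k′ → skip j k′ ≡ k
skip-surjective {zero}  {zero}  k≢j = contradiction ≡.refl k≢j
skip-surjective {zero}  {suc k} k≢j = k , ≡.refl
skip-surjective {suc j} {zero}  k≢j = zero , ≡.refl
skip-surjective {suc j} {suc k} k≢j with skip-surjective (k≢j ∘ ≡.cong suc)
... | k′ , eq = suc k′ , ≡.cong suc eq

-- Neighbouring columns remain neighbours when a third one is deleted, which lets `detℕ-adjacent`
-- recurse into the minors.
skip-surjective₂ : ∀ {j k} → j ≢ k → j ≢ suc k →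
                   ∃ λ k′ → skip j k′ ≡ k × skip j (suc k′) ≡ suc k
skip-surjective₂ {zero}        {zero}  j≢k j≢sk = contradiction ≡.refl j≢k
skip-surjective₂ {zero}        {suc k} j≢k j≢sk = k , ≡.refl , ≡.refl
skip-surjective₂ {suc zero}    {zero}  j≢k j≢sk = contradiction ≡.refl j≢sk
skip-surjective₂ {suc (suc j)} {zero}  j≢k j≢sk = zero , ≡.refl , ≡.refl
skip-surjective₂ {suc j}       {suc k} j≢k j≢sk
  with skip-surjective₂ (j≢k ∘ ≡.cong suc) (j≢sk ∘ ≡.cong suc)
... | k′ , eq , eq′ = suc k′ , ≡.cong suc eq , ≡.cong suc eq′

skip-< : ∀ j {k n} → k ℕ.< n → skip j k ℕ.< suc n
skip-< zero            k<n       = s≤s k<n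
skip-< (suc j) {zero}  k<n       = s≤s z≤n
skip-< (suc j) {suc k} (s≤s k<n) = s≤s (skip-< j k<n)

skip-<⁻¹ : ∀ {j k n} → j ℕ.≤ n → skip j k ℕ.< suc n → k ℕ.< n
skip-<⁻¹ {zero}                  _         (s≤s k<n) = k<n
skip-<⁻¹ {suc j} {zero}  {suc n} _         _         = s≤s z≤n
skip-<⁻¹ {suc j} {suc k} {suc n} (s≤s j≤n) (s≤s lt)  = s≤s (skip-<⁻¹ j≤n lt)

skip-self : ∀ k → skip k k ≡ suc k
skip-self zero    = ≡.refl
skip-self (suc k) = ≡.cong suc (skip-self k)

skip-suc-self : ∀ k → skip (suc k) k ≡ k
skip-suc-self zero    = ≡.refl
skip-suc-self (suc k) = ≡.cong suc (skip-suc-self k)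

-- The minors that omit column c and column c + 1 differ at most in position c, where each holds the
-- column omitted by the other.
skip-≡ : ∀ {c k} → k ≢ c → skip c k ≡ skip (suc c) k
skip-≡ {zero}  {zero}  k≢c = contradiction ≡.refl k≢c
skip-≡ {zero}  {suc k} k≢c = ≡.refl
skip-≡ {suc c} {zero}  k≢c = ≡.refl
skip-≡ {suc c} {suc k} k≢c = ≡.cong suc (skip-≡ (k≢c ∘ ≡.cong suc))

module Determinant (R : CommutativeRing c ℓ) where
  open CommutativeRing R hiding (_-_; zero)
  open RingNotation rawRing
  open FiniteSums R
  open Solver R
  open Resultant rawRing using (det)
  open SetoidReasoning setoid

  -- Entries are given for all indices and only a corner is ever used. Columns and blocks can thus
  -- be moved around without arithmetic in the types.
  Matrix : Set _
  Matrix = ℕ → ℕ → Carrier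

  minor : ℕ → Matrix → Matrix
  minor j M i k = M (suc i) (skip j k)

  opaque
    -- The determinant of the upper left n × n corner.
    detℕ : ℕ → Matrix → Carrier
    detℕ zero    M = 1#
    detℕ (suc n) M = ∑< (suc n) λ j → (- 1#) ^ j * M 0 j * detℕ n (minor j M)

    detℕ-zero : ∀ M → detℕ 0 M ≈ 1#
    detℕ-zero M = refl

    detℕ-suc : ∀ n M →
      detℕ (suc n) M ≈ ∑< (suc n) λ j → (- 1#) ^ j * M 0 j * detℕ n (minor j M)
    detℕ-suc n M = refl

  detℕ-cong : ∀ n {M M′} → (∀ i j → i ℕ.< n → j ℕ.< n → M i j ≈ M′ i j) →
              detℕ n M ≈ detℕ n M′
  detℕ-cong zero    M≈M′ = trans (detℕ-zero _) (sym (detℕ-zero _))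
  detℕ-cong (suc n) {M} {M′} M≈M′ = begin
    detℕ (suc n) M ≈⟨ detℕ-suc n M ⟩
    ∑< (suc n) (λ j → (- 1#) ^ j * M 0 j * detℕ n (minor j M))
      ≈⟨ ∑-cong (suc n) (λ j j<n →
           *-cong (*-congˡ (M≈M′ 0 j (s≤s z≤n) j<n))
                  (detℕ-cong n λ i k i<n k<n → M≈M′ (suc i) (skip j k) (s≤s i<n) (skip-< j k<n))) ⟩
    ∑< (suc n) (λ j → (- 1#) ^ j * M′ 0 j * detℕ n (minor j M′)) ≈⟨ detℕ-suc n M′ ⟨
    detℕ (suc n) M′ ∎

  det≈detℕ : ∀ n (M : Fin n → Fin n → Carrier) M′ →
             (∀ i j → M i j ≈ M′ (toℕ i) (toℕ j)) → det M ≈ detℕ n M′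
  det≈detℕ zero    M M′ M≈M′ = sym (detℕ-zero M′)
  det≈detℕ (suc n) M M′ M≈M′ =
    trans (sum-cong (suc n) λ j →
             *-cong (*-congˡ {(- 1#) ^ toℕ j} (M≈M′ zero j))
                    (det≈detℕ n _ (minor (toℕ j) M′) λ i k →
                      trans (M≈M′ (suc i) (punchIn j k))
                            (reflexive (≡.cong (M′ (suc (toℕ i))) (toℕ-punchIn j k)))))
          (trans (sum≈∑ (suc n) λ j → (- 1#) ^ j * M′ 0 j * detℕ n (minor j M′))
                 (sym (detℕ-suc n M′)))
    where
    sum-cong : ∀ m {f g : Fin m → Carrier} → (∀ i → f i ≈ g i) → sum f ≈ sum g
    sum-cong zero    f≈g = refl
    sum-cong (suc m) f≈g = +-cong (f≈g zero) (sum-cong m (f≈g ∘ suc))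

  -- Expansion along row 0. In the term of column c the combination sits in the entry, and the three
  -- minors agree; in every other term column c survives in the minor, at position c′, and induction
  -- applies.
  detℕ-linear : ∀ n c {s t M M₁ M₂} → c ℕ.< n →
                (∀ i j → j ≢ c → M i j ≈ M₁ i j) → (∀ i j → j ≢ c → M i j ≈ M₂ i j) →
                (∀ i → M i c ≈ s * M₁ i c + t * M₂ i c) →
                detℕ n M ≈ s * detℕ n M₁ + t * detℕ n M₂
  detℕ-linear (suc n) c {s} {t} {M} {M₁} {M₂} c<n M≈M₁ M≈M₂ M≈ = begin
    detℕ (suc n) M ≈⟨ detℕ-suc n M ⟩
    ∑< (suc n) (term M) ≈⟨ ∑-cong (suc n) step ⟩
    ∑< (suc n) (λ j → s * term M₁ j + t * term M₂ j) ≈⟨ ∑-+ (suc n) _ _ ⟩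
    ∑< (suc n) (λ j → s * term M₁ j) + ∑< (suc n) (λ j → t * term M₂ j)
      ≈⟨ +-cong (∑-*ˡ (suc n) s _) (∑-*ˡ (suc n) t _) ⟩
    s * ∑< (suc n) (term M₁) + t * ∑< (suc n) (term M₂)
      ≈⟨ +-cong (*-congˡ (detℕ-suc n M₁)) (*-congˡ (detℕ-suc n M₂)) ⟨
    s * detℕ (suc n) M₁ + t * detℕ (suc n) M₂ ∎
    where
    term : Matrix → ℕ → Carrier
    term A j = (- 1#) ^ j * A 0 j * detℕ n (minor j A)

    step : ∀ j → j ℕ.< suc n → term M j ≈ s * term M₁ j + t * term M₂ j
    step j (s≤s j≤n) with j ℕ.≟ c
    ... | yes ≡.refl = begin
      (- 1#) ^ j * M 0 j * d ≈⟨ *-congʳ (*-congˡ (M≈ 0)) ⟩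
      (- 1#) ^ j * (s * M₁ 0 j + t * M₂ 0 j) * d
        ≈⟨ solve 6 (λ e s t x y d → e :* (s :* x :+ t :* y) :* d
                                    := s :* (e :* x :* d) :+ t :* (e :* y :* d))
                 refl _ s t (M₁ 0 j) (M₂ 0 j) d ⟩
      s * ((- 1#) ^ j * M₁ 0 j * d) + t * ((- 1#) ^ j * M₂ 0 j * d)
        ≈⟨ +-cong (*-congˡ (*-congˡ (minors M≈M₁))) (*-congˡ (*-congˡ (minors M≈M₂))) ⟩
      s * term M₁ j + t * term M₂ j ∎
      where
      d : Carrier
      d = detℕ n (minor j M)

      minors : ∀ {A} → (∀ i k → k ≢ j → M i k ≈ A i k) → d ≈ detℕ n (minor j A)
      minors M≈A = detℕ-cong n λ i k _ _ → M≈A (suc i) (skip j k) (skip-≢ j k)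
    ... | no j≢c with skip-surjective {j} {c} (j≢c ∘ ≡.sym)
    ...   | c′ , ≡.refl = begin
      (- 1#) ^ j * M 0 j * detℕ n (minor j M)
        ≈⟨ *-congˡ (detℕ-linear n c′ (skip-<⁻¹ j≤n c<n)
             (λ i k k≢ → M≈M₁ (suc i) (skip j k) (k≢ ∘ skip-injective j))
             (λ i k k≢ → M≈M₂ (suc i) (skip j k) (k≢ ∘ skip-injective j))
             (λ i → M≈ (suc i))) ⟩
      (- 1#) ^ j * M 0 j * (s * d₁ + t * d₂)
        ≈⟨ solve 6 (λ e x s t d₁ d₂ → e :* x :* (s :* d₁ :+ t :* d₂)
                                      := s :* (e :* x :* d₁) :+ t :* (e :* x :* d₂))
                 refl _ (M 0 j) s t d₁ d₂ ⟩
      s * ((- 1#) ^ j * M 0 j * d₁) + t * ((- 1#) ^ j * M 0 j * d₂)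
        ≈⟨ +-cong (*-congˡ (*-congʳ (*-congˡ (M≈M₁ 0 j j≢c))))
                  (*-congˡ (*-congʳ (*-congˡ (M≈M₂ 0 j j≢c)))) ⟩
      s * term M₁ j + t * term M₂ j ∎
      where
      d₁ d₂ : Carrier
      d₁ = detℕ n (minor j M₁)
      d₂ = detℕ n (minor j M₂)

  -- In the expansion along row 0 the terms of the two equal columns differ only in sign. Every
  -- other minor still contains both columns side by side and vanishes by induction.
  detℕ-adjacent : ∀ n c {M} → suc c ℕ.< n → (∀ i → M i c ≈ M i (suc c)) → detℕ n M ≈ 0#
  detℕ-adjacent (suc n) c {M} (s≤s c<n) eq = begin
    detℕ (suc n) M ≈⟨ detℕ-suc n M ⟩
    ∑< (suc n) term ≈⟨ ∑-pick₂ (suc n) c term (s≤s c<n) others ⟩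
    term c + term (suc c)
      ≈⟨ +-cong (*-congʳ (*-congˡ (eq 0))) (*-congˡ (detℕ-cong n minors)) ⟩
    (- 1#) ^ c * x * d + (- 1#) ^ suc c * x * d
      ≈⟨ solve 3 (λ e x d → e :* x :* d :+ (:- :1 :* e) :* x :* d := :0) refl _ x d ⟩
    0# ∎
    where
    term : ℕ → Carrier
    term j = (- 1#) ^ j * M 0 j * detℕ n (minor j M)

    x d : Carrier
    x = M 0 (suc c)
    d = detℕ n (minor c M)

    minors : ∀ i k → i ℕ.< n → k ℕ.< n → minor (suc c) M i k ≈ minor c M i k
    minors i k _ _ with k ℕ.≟ c
    ... | yes ≡.refl = begin
      M (suc i) (skip (suc c) c) ≡⟨ ≡.cong (M (suc i)) (skip-suc-self c) ⟩
      M (suc i) c ≈⟨ eq (suc i) ⟩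
      M (suc i) (suc c) ≡⟨ ≡.cong (M (suc i)) (skip-self c) ⟨
      M (suc i) (skip c c) ∎
    ... | no k≢c = reflexive (≡.cong (M (suc i)) (≡.sym (skip-≡ k≢c)))

    others : ∀ j → j ℕ.< suc n → j ≢ c → j ≢ suc c → term j ≈ 0#
    others j (s≤s j≤n) j≢c j≢sc with skip-surjective₂ j≢c j≢sc
    ... | c′ , eq₁ , eq₂ =
      trans (*-congˡ (detℕ-adjacent n c′
              (skip-<⁻¹ j≤n (≡.subst (ℕ._< suc n) (≡.sym eq₂) (s≤s c<n)))
              λ i → begin
                M (suc i) (skip j c′) ≡⟨ ≡.cong (M (suc i)) eq₁ ⟩
                M (suc i) c ≈⟨ eq (suc i) ⟩
                M (suc i) (suc c) ≡⟨ ≡.cong (M (suc i)) eq₂ ⟨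
                M (suc i) (skip j (suc c′)) ∎))
            (zeroʳ _)

  opaque
    setColumn : ℕ → (ℕ → Carrier) → Matrix → Matrix
    setColumn c v M i j = choose (j ℕ.≟ c) (v i) (M i j)

    setColumn-≡ : ∀ c v M i → setColumn c v M i c ≡ v i
    setColumn-≡ c v M i with c ℕ.≟ c
    ... | yes _   = ≡.refl
    ... | no  c≢c = contradiction ≡.refl c≢c

    setColumn-≢ : ∀ {c j} v M i → j ≢ c → setColumn c v M i j ≡ M i j
    setColumn-≢ {c} {j} v M i j≢c with j ℕ.≟ c
    ... | yes j≡c = contradiction j≡c j≢c
    ... | no  _   = ≡.refl

  setColumn-unique : ∀ {c v} {M H : Matrix} → (∀ i → H i c ≈ v i) → (∀ i j → j ≢ c → H i j ≈ M i j) →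
                     ∀ i j → H i j ≈ setColumn c v M i j
  setColumn-unique {c} {v} {M} H-c H-other i j with j ℕ.≟ c
  ... | yes ≡.refl = trans (H-c i) (reflexive (≡.sym (setColumn-≡ c v M i)))
  ... | no  j≢c    = trans (H-other i j j≢c) (reflexive (≡.sym (setColumn-≢ v M i j≢c)))

  detℕ-setColumn-linear : ∀ n c s t u v M → c ℕ.< n →
    detℕ n (setColumn c (λ i → s * u i + t * v i) M) ≈
    s * detℕ n (setColumn c u M) + t * detℕ n (setColumn c v M)
  detℕ-setColumn-linear n c s t u v M c<n = detℕ-linear n c c<n
    (λ i j j≢c → reflexive (≡.trans (setColumn-≢ _ M i j≢c) (≡.sym (setColumn-≢ u M i j≢c))))
    (λ i j j≢c → reflexive (≡.trans (setColumn-≢ _ M i j≢c) (≡.sym (setColumn-≢ v M i j≢c))))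
    (λ i → begin
      setColumn c _ M i c ≡⟨ setColumn-≡ c _ M i ⟩
      s * u i + t * v i
        ≡⟨ ≡.cong₂ (λ x y → s * x + t * y) (setColumn-≡ c u M i) (setColumn-≡ c v M i) ⟨
      s * setColumn c u M i c + t * setColumn c v M i c ∎)

  detℕ-setColumn-self : ∀ n c M → detℕ n (setColumn c (λ i → M i c) M) ≈ detℕ n M
  detℕ-setColumn-self n c M = detℕ-cong n λ i j _ _ →
    sym (setColumn-unique {c} {λ i → M i c} {M} (λ _ → refl) (λ _ _ _ → refl) i j)

  private
    -- Induction on the distance of the two columns: exchanging the right one
    -- with its left neighbour changes only the sign.
    alternating : ∀ n g a {M} → suc (g ℕ.+ a) ℕ.< n →
                  (∀ i → M i a ≈ M i (suc (g ℕ.+ a))) → detℕ n M ≈ 0#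
    alternating n zero    a     b<n eq = detℕ-adjacent n a b<n eq
    alternating n (suc g) a {M} b<n eq = begin
      detℕ n M ≈⟨ detℕ-cong n (λ i j _ _ → G≈M i j) ⟩
      detℕ n (G x y) ≈⟨ solve 2 (λ p q → p := (p :+ q) :- q) refl _ _ ⟩
      (detℕ n (G x y) + detℕ n (G y x)) - detℕ n (G y x)
        ≈⟨ +-cong sum≈0 (-‿cong Gyx≈0) ⟩
      0# - 0# ≈⟨ -‿inverseʳ 0# ⟩
      0# ∎
      where
      b′ b : ℕ
      b′ = suc (g ℕ.+ a)
      b  = suc b′

      b′<n : b′ ℕ.< n
      b′<n = ℕ.<-trans (ℕ.n<1+n b′) b<n

      b≢b′ : b ≢ b′
      b≢b′ = ℕ.1+n≢n

      a<b′ : a ℕ.< b′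
      a<b′ = s≤s (ℕ.m≤n+m a g)

      x y : ℕ → Carrier
      x i = M i b′
      y i = M i b

      G : (ℕ → Carrier) → (ℕ → Carrier) → Matrix
      G u v = setColumn b′ u (setColumn b v M)

      G-b′ : ∀ u v i → G u v i b′ ≡ u i
      G-b′ u v i = setColumn-≡ b′ u _ i

      G-b : ∀ u v i → G u v i b ≡ v i
      G-b u v i = ≡.trans (setColumn-≢ u _ i b≢b′) (setColumn-≡ b v M i)

      G-other : ∀ u v i {j} → j ≢ b′ → j ≢ b → G u v i j ≡ M i j
      G-other u v i j≢b′ j≢b = ≡.trans (setColumn-≢ u _ i j≢b′) (setColumn-≢ v M i j≢b)

      G≈M : ∀ i j → M i j ≈ G x y i j
      G≈M = setColumn-unique (λ _ → refl) λ i j _ →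
        setColumn-unique {b} {y} {M} {M} (λ _ → refl) (λ _ _ _ → refl) i j

      diagonal≈0 : ∀ u → detℕ n (G u u) ≈ 0#
      diagonal≈0 u = detℕ-adjacent n b′ b<n λ i →
        reflexive (≡.trans (G-b′ u u i) (≡.sym (G-b u u i)))

      Gyx≈0 : detℕ n (G y x) ≈ 0#
      Gyx≈0 = alternating n g a b′<n λ i → begin
        G y x i a ≡⟨ G-other y x i (ℕ.<⇒≢ a<b′) (ℕ.<⇒≢ (ℕ.<-trans a<b′ (ℕ.n<1+n b′))) ⟩
        M i a ≈⟨ eq i ⟩
        M i b ≡⟨ G-b′ y x i ⟨
        G y x i b′ ∎

      -- Polarisation: with x + y in both columns the determinant vanishes, and it expands into four
      -- terms, two of which have a repeated column. The factors `1#` fit the shape of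
      -- `detℕ-linear`.
      z : ℕ → Carrier
      z i = 1# * x i + 1# * y i

      linearˡ : ∀ v → detℕ n (G z v) ≈ 1# * detℕ n (G x v) + 1# * detℕ n (G y v)
      linearˡ v = detℕ-setColumn-linear n b′ 1# 1# x y (setColumn b v M) b′<n

      linearʳ : ∀ u → detℕ n (G u z) ≈ 1# * detℕ n (G u x) + 1# * detℕ n (G u y)
      linearʳ u = detℕ-linear n b b<n
        (λ i j j≢b → reflexive (same x j≢b))
        (λ i j j≢b → reflexive (same y j≢b))
        (λ i → reflexive (≡.trans (G-b u z i)
          (≡.cong₂ (λ p q → 1# * p + 1# * q) (≡.sym (G-b u x i)) (≡.sym (G-b u y i)))))
        where
        same : ∀ v {i j} → j ≢ b → G u z i j ≡ G u v i j
        same v {i} {j} j≢b with j ℕ.≟ b′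
        ... | yes ≡.refl = ≡.trans (G-b′ u z i) (≡.sym (G-b′ u v i))
        ... | no  j≢b′   = ≡.trans (G-other u z i j≢b′ j≢b) (≡.sym (G-other u v i j≢b′ j≢b))

      sum≈0 : detℕ n (G x y) + detℕ n (G y x) ≈ 0#
      sum≈0 = begin
        detℕ n (G x y) + detℕ n (G y x)
          ≈⟨ solve 2 (λ p q → p :+ q := :1 :* (:1 :* :0 :+ :1 :* p) :+ :1 :* (:1 :* q :+ :1 :* :0))
                   refl _ _ ⟩
        1# * (1# * 0# + 1# * detℕ n (G x y)) + 1# * (1# * detℕ n (G y x) + 1# * 0#)
          ≈⟨ +-cong (*-congˡ (+-congʳ (*-congˡ (diagonal≈0 x))))
                    (*-congˡ (+-congˡ (*-congˡ (diagonal≈0 y)))) ⟨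
        1# * (1# * detℕ n (G x x) + 1# * detℕ n (G x y)) +
        1# * (1# * detℕ n (G y x) + 1# * detℕ n (G y y))
          ≈⟨ +-cong (*-congˡ (linearʳ x)) (*-congˡ (linearʳ y)) ⟨
        1# * detℕ n (G x z) + 1# * detℕ n (G y z) ≈⟨ linearˡ z ⟨
        detℕ n (G z z) ≈⟨ diagonal≈0 z ⟩
        0# ∎

  detℕ-alternating : ∀ n a b {M} → a ≢ b → a ℕ.< n → b ℕ.< n →
                     (∀ i → M i a ≈ M i b) → detℕ n M ≈ 0#
  detℕ-alternating n a b a≢b a<n b<n eq with ℕ.<-cmp a b
  ... | tri≈ _ a≡b _ = contradiction a≡b a≢b
  ... | tri< a<b _ _ with ℕ.m≤n⇒∃[o]m+o≡n a<b
  ...   | g , ≡.refl rewrite ℕ.+-comm a g = alternating n g a b<n eq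
  detℕ-alternating n a b a≢b a<n b<n eq | tri> _ _ b<a with ℕ.m≤n⇒∃[o]m+o≡n b<a
  ...   | g , ≡.refl rewrite ℕ.+-comm b g = alternating n g b a<n (sym ∘ eq)

  -- Linearity replaces column c by each column of `M` in turn; all but column c itself produce a
  -- repetition.
  detℕ-combination : ∀ n c (t : ℕ → Carrier) (M : Matrix) → c ℕ.< n →
    detℕ n (setColumn c (λ i → ∑< n λ k → M i k * t k) M) ≈ t c * detℕ n M
  detℕ-combination n c t M c<n = begin
    detℕ n (setColumn c (λ i → ∑< n λ k → M i k * t k) M)
      ≈⟨ expand n ⟩
    ∑< n (λ k → t k * detℕ n (setColumn c (λ i → M i k) M))
      ≈⟨ ∑-pick n c (λ k → t k * detℕ n (setColumn c (λ i → M i k) M)) c<n (λ k k<n k≢c → trans (*-congˡ (repeated k k<n k≢c)) (zeroʳ _)) ⟩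
    t c * detℕ n (setColumn c (λ i → M i c) M)
      ≈⟨ *-congˡ (detℕ-setColumn-self n c M) ⟩
    t c * detℕ n M ∎
    where
    column-cong : ∀ {u v} → (∀ i → u i ≈ v i) →
                  detℕ n (setColumn c u M) ≈ detℕ n (setColumn c v M)
    column-cong {u} {v} u≈v = detℕ-cong n λ i j _ _ →
      setColumn-unique {c} {v} {M} {setColumn c u M}
        (λ i → trans (reflexive (setColumn-≡ c u M i)) (u≈v i))
        (λ i j j≢c → reflexive (setColumn-≢ u M i j≢c)) i j

    repeated : ∀ k → k ℕ.< n → k ≢ c → detℕ n (setColumn c (λ i → M i k) M) ≈ 0#
    repeated k k<n k≢c = detℕ-alternating n k c k≢c k<n c<n λ i →
      reflexive (≡.trans (setColumn-≢ _ M i k≢c) (≡.sym (setColumn-≡ c _ M i)))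

    expand : ∀ N → detℕ n (setColumn c (λ i → ∑< N λ k → M i k * t k) M) ≈
                   ∑< N (λ k → t k * detℕ n (setColumn c (λ i → M i k) M))
    expand zero = begin
      detℕ n (setColumn c (λ i → ∑< 0 λ k → M i k * t k) M)
        -- The empty sum is written as a combination with coefficients 0, so that linearity yields
        -- the value 0.
        ≈⟨ column-cong (λ _ → trans (∑-zero _) (solve 0 (:0 := :0 :* :0 :+ :0 :* :0) refl)) ⟩
      detℕ n (setColumn c (λ _ → 0# * 0# + 0# * 0#) M)
        ≈⟨ detℕ-setColumn-linear n c 0# 0# (λ _ → 0#) (λ _ → 0#) M c<n ⟩
      0# * _ + 0# * _
        ≈⟨ solve 2 (λ p q → :0 :* p :+ :0 :* q := :0) refl _ _ ⟩
      0#
        ≈⟨ ∑-zero _ ⟨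
      ∑< 0 (λ k → t k * detℕ n (setColumn c (λ i → M i k) M)) ∎
    expand (suc N) = begin
      detℕ n (setColumn c (λ i → ∑< (suc N) λ k → M i k * t k) M)
        ≈⟨ column-cong (λ i → trans (∑-last N λ k → M i k * t k)
             (solve 3 (λ s x y → s :+ x :* y := :1 :* s :+ y :* x) refl _ (M i N) (t N))) ⟩
      detℕ n (setColumn c (λ i → 1# * ∑< N (λ k → M i k * t k) + t N * M i N) M)
        ≈⟨ detℕ-setColumn-linear n c 1# (t N) _ _ M c<n ⟩
      1# * detℕ n (setColumn c (λ i → ∑< N λ k → M i k * t k) M) +
      t N * detℕ n (setColumn c (λ i → M i N) M)
        ≈⟨ +-congʳ (trans (*-identityˡ _) (expand N)) ⟩
      ∑< N (λ k → t k * detℕ n (setColumn c (λ i → M i k) M)) +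
      t N * detℕ n (setColumn c (λ i → M i N) M)
        ≈⟨ ∑-last N (λ k → t k * detℕ n (setColumn c (λ i → M i k) M)) ⟨
      ∑< (suc N) (λ k → t k * detℕ n (setColumn c (λ i → M i k) M)) ∎

  mulMatrix : ℕ → Matrix → Matrix → Matrix
  mulMatrix n M T i l = ∑< n λ k → M i k * T k l

  private
    opaque
      firstColumns : ℕ → Matrix → Matrix → Matrix
      firstColumns j A B i l = choose (l ℕ.<? j) (A i l) (B i l)

      firstColumns-< : ∀ {j l} A B i → l ℕ.< j → firstColumns j A B i l ≡ A i l
      firstColumns-< {j} {l} A B i l<j with l ℕ.<? j
      ... | yes _   = ≡.refl
      ... | no  l≮j = contradiction l<j l≮j

      firstColumns-≥ : ∀ {j l} A B i → j ℕ.≤ l → firstColumns j A B i l ≡ B i l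
      firstColumns-≥ {j} {l} A B i j≤l with l ℕ.<? j
      ... | yes l<j = contradiction l<j (ℕ.≤⇒≯ j≤l)
      ... | no  _   = ≡.refl

    firstColumns-all : ∀ n A B → detℕ n (firstColumns n A B) ≈ detℕ n A
    firstColumns-all n A B = detℕ-cong n λ i l _ l<n → reflexive (firstColumns-< A B i l<n)

    firstColumns-none : ∀ n A B → detℕ n (firstColumns 0 A B) ≈ detℕ n B
    firstColumns-none n A B = detℕ-cong n λ i l _ _ → reflexive (firstColumns-≥ A B i z≤n)

    ∏-zero-* : ∀ f x → x ≈ ∏< 0 f * x
    ∏-zero-* f x = trans (sym (*-identityˡ x)) (*-congʳ (sym (∏-zero f)))

    -- H and H′ differ in column j only, which in H′ is the j-th column of M T.
    replaceColumn : ∀ n j (M T H H′ : Matrix) → j ℕ.< n →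
      (∀ i l → l ≢ j → H′ i l ≡ H i l) → (∀ i → H′ i j ≡ mulMatrix n M T i j) →
      (∀ i k → k ℕ.< n → M i k * T k j ≈ H i k * T k j) → detℕ n H′ ≈ T j j * detℕ n H
    replaceColumn n j M T H H′ j<n same new H-M = begin
      detℕ n H′ ≈⟨ detℕ-cong n (λ i l _ _ → lemma i l) ⟩
      detℕ n (setColumn j (λ i → ∑< n λ k → H i k * T k j) H) ≈⟨ detℕ-combination n j (λ k → T k j) H j<n ⟩
      T j j * detℕ n H ∎
      where
      lemma : ∀ i l → H′ i l ≈ setColumn j (λ i → ∑< n λ k → H i k * T k j) H i l
      lemma = setColumn-unique
        (λ i → trans (reflexive (new i)) (∑-cong n λ k k<n → H-M i k k<n))
        (λ i l l≢j → reflexive (same i l l≢j))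

  detℕ-mul-lower : ∀ n M T → (∀ k l → l ℕ.< n → k ℕ.< l → T k l ≈ 0#) →
                   detℕ n (mulMatrix n M T) ≈ ∏< n (λ l → T l l) * detℕ n M
  detℕ-mul-lower n M T lower =
    trans (sym (firstColumns-all n _ M)) (go n ℕ.≤-refl)
    where
    H : ℕ → Matrix
    H j = firstColumns j (mulMatrix n M T) M

    go : ∀ j → j ℕ.≤ n → detℕ n (H j) ≈ ∏< j (λ l → T l l) * detℕ n M
    go zero    _   = trans (firstColumns-none n _ M) (∏-zero-* _ _)
    go (suc j) j<n = begin
      detℕ n (H (suc j))
        ≈⟨ replaceColumn n j M T (H j) (H (suc j)) j<n same
             (λ i → firstColumns-< _ M i (ℕ.n<1+n j)) unchanged ⟩
      T j j * detℕ n (H j) ≈⟨ *-congˡ (go j (ℕ.<⇒≤ j<n)) ⟩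
      T j j * (∏< j (λ l → T l l) * detℕ n M) ≈⟨ *-assoc _ _ _ ⟨
      T j j * ∏< j (λ l → T l l) * detℕ n M ≈⟨ *-congʳ (trans (*-comm _ _) (sym (∏-last j λ l → T l l))) ⟩
      ∏< (suc j) (λ l → T l l) * detℕ n M ∎
      where
      same : ∀ i l → l ≢ j → H (suc j) i l ≡ H j i l
      same i l l≢j with ℕ.<-cmp l j
      ... | tri< l<j _ _ = ≡.trans (firstColumns-< _ M i (ℕ.m<n⇒m<1+n l<j)) (≡.sym (firstColumns-< _ M i l<j))
      ... | tri≈ _ l≡j _ = contradiction l≡j l≢j
      ... | tri> _ _ j<l = ≡.trans (firstColumns-≥ _ M i j<l) (≡.sym (firstColumns-≥ _ M i (ℕ.<⇒≤ j<l)))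

      unchanged : ∀ i k → k ℕ.< n → M i k * T k j ≈ H j i k * T k j
      unchanged i k k<n with k ℕ.<? j
      ... | no  k≮j = *-congʳ (reflexive (≡.sym (firstColumns-≥ _ M i (ℕ.≮⇒≥ k≮j))))
      ... | yes k<j = trans (trans (*-congˡ (lower k j j<n k<j)) (zeroʳ _))
                            (sym (trans (*-congˡ (lower k j j<n k<j)) (zeroʳ _)))

  -- The mirror image: column j of M T involves the columns k ≤ j of `M`, so the hybrid matrices
  -- must keep `M` on the left and M T on the right.
  detℕ-mul-upper : ∀ n M T → (∀ k l → k ℕ.< n → l ℕ.< k → T k l ≈ 0#) →
                   detℕ n (mulMatrix n M T) ≈ ∏< n (λ l → T l l) * detℕ n M
  detℕ-mul-upper n M T upper =
    trans (go n ℕ.≤-refl) (*-congˡ (firstColumns-all n M _))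
    where
    H : ℕ → Matrix
    H j = firstColumns j M (mulMatrix n M T)

    go : ∀ j → j ℕ.≤ n → detℕ n (mulMatrix n M T) ≈ ∏< j (λ l → T l l) * detℕ n (H j)
    go zero    _   = trans (sym (firstColumns-none n M _)) (∏-zero-* _ _)
    go (suc j) j<n = begin
      detℕ n (mulMatrix n M T) ≈⟨ go j (ℕ.<⇒≤ j<n) ⟩
      ∏< j (λ l → T l l) * detℕ n (H j)
        ≈⟨ *-congˡ (replaceColumn n j M T (H (suc j)) (H j) j<n same
             (λ i → firstColumns-≥ M _ i ℕ.≤-refl) unchanged) ⟩
      ∏< j (λ l → T l l) * (T j j * detℕ n (H (suc j))) ≈⟨ *-assoc _ _ _ ⟨
      ∏< j (λ l → T l l) * T j j * detℕ n (H (suc j)) ≈⟨ *-congʳ (sym (∏-last j λ l → T l l)) ⟩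
      ∏< (suc j) (λ l → T l l) * detℕ n (H (suc j)) ∎
      where
      same : ∀ i l → l ≢ j → H j i l ≡ H (suc j) i l
      same i l l≢j with ℕ.<-cmp l j
      ... | tri< l<j _ _ = ≡.trans (firstColumns-< M _ i l<j) (≡.sym (firstColumns-< M _ i (ℕ.m<n⇒m<1+n l<j)))
      ... | tri≈ _ l≡j _ = contradiction l≡j l≢j
      ... | tri> _ _ j<l = ≡.trans (firstColumns-≥ M _ i (ℕ.<⇒≤ j<l)) (≡.sym (firstColumns-≥ M _ i j<l))

      unchanged : ∀ i k → k ℕ.< n → M i k * T k j ≈ H (suc j) i k * T k j
      unchanged i k k<n with k ℕ.<? suc j
      ... | yes k≤j = *-congʳ (reflexive (≡.sym (firstColumns-< M _ i k≤j)))
      ... | no  k≮j = trans (trans (*-congˡ (upper k j k<n (ℕ.≰⇒> (k≮j ∘ s≤s)))) (zeroʳ _))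
                            (sym (trans (*-congˡ (upper k j k<n (ℕ.≰⇒> (k≮j ∘ s≤s)))) (zeroʳ _)))

  opaque
    δ : Matrix
    δ i j = choose (i ℕ.≟ j) 1# 0#

    δ-≡ : ∀ i → δ i i ≡ 1#
    δ-≡ i with i ℕ.≟ i
    ... | yes _   = ≡.refl
    ... | no  i≢i = contradiction ≡.refl i≢i

    δ-≢ : ∀ {i j} → i ≢ j → δ i j ≡ 0#
    δ-≢ {i} {j} i≢j with i ℕ.≟ j
    ... | yes i≡j = contradiction i≡j i≢j
    ... | no  _   = ≡.refl

  δ-suc : ∀ i j → δ (suc i) (suc j) ≡ δ i j
  δ-suc i j with i ℕ.≟ j
  ... | yes ≡.refl = ≡.trans (δ-≡ (suc i)) (≡.sym (δ-≡ i))
  ... | no  i≢j    = ≡.trans (δ-≢ (i≢j ∘ ℕ.suc-injective)) (≡.sym (δ-≢ i≢j))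

  -- Each of the first e rows contributes a single term to the expansion. The entries below the
  -- identity block are arbitrary, since only the rows are constrained.
  detℕ-block : ∀ e d {M} → (∀ i j → i ℕ.< e → j ℕ.< e ℕ.+ d → M i j ≈ δ i j) →
               detℕ (e ℕ.+ d) M ≈ detℕ d (λ i j → M (e ℕ.+ i) (e ℕ.+ j))
  detℕ-block zero    d     M≈δ = refl
  detℕ-block (suc e) d {M} M≈δ = begin
    detℕ (suc (e ℕ.+ d)) M
      ≈⟨ detℕ-suc (e ℕ.+ d) M ⟩
    ∑< (suc (e ℕ.+ d)) (λ j → (- 1#) ^ j * M 0 j * detℕ (e ℕ.+ d) (minor j M))
      ≈⟨ ∑-pick (suc (e ℕ.+ d)) 0 _ (s≤s z≤n) (λ j j<n j≢0 →
           trans (*-congʳ (trans (*-congˡ (trans (M≈δ 0 j (s≤s z≤n) j<n) (reflexive (δ-≢ (j≢0 ∘ ≡.sym))))) (zeroʳ _)))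
                 (zeroˡ _)) ⟩
    1# * M 0 0 * detℕ (e ℕ.+ d) (minor 0 M)
      ≈⟨ *-congʳ (trans (*-identityˡ _) (trans (M≈δ 0 0 (s≤s z≤n) (s≤s z≤n)) (reflexive (δ-≡ 0)))) ⟩
    1# * detℕ (e ℕ.+ d) (minor 0 M)
      ≈⟨ *-identityˡ _ ⟩
    detℕ (e ℕ.+ d) (minor 0 M)
      ≈⟨ detℕ-block e d (λ i j i<e j<n → trans (M≈δ (suc i) (suc j) (s≤s i<e) (s≤s j<n)) (reflexive (δ-suc i j))) ⟩
    detℕ d (λ i j → M (suc (e ℕ.+ i)) (suc (e ℕ.+ j))) ∎

  detℕ-δ : ∀ n → detℕ n δ ≈ 1#
  detℕ-δ n = begin
    detℕ n δ ≡⟨ ≡.cong (λ k → detℕ k δ) (ℕ.+-identityʳ n) ⟨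
    detℕ (n ℕ.+ 0) δ ≈⟨ trans (detℕ-block n 0 (λ _ _ _ _ → refl)) (detℕ-zero _) ⟩
    1# ∎

  detℕ-upper : ∀ n T → (∀ k l → k ℕ.< n → l ℕ.< k → T k l ≈ 0#) → detℕ n T ≈ ∏< n (λ l → T l l)
  detℕ-upper n T upper = begin
    detℕ n T ≈⟨ detℕ-cong n (λ i l i<n _ → sym (δT i l i<n)) ⟩
    detℕ n (mulMatrix n δ T) ≈⟨ detℕ-mul-upper n δ T upper ⟩
    ∏< n (λ l → T l l) * detℕ n δ ≈⟨ trans (*-congˡ (detℕ-δ n)) (*-identityʳ _) ⟩
    ∏< n (λ l → T l l) ∎
    where
    δT : ∀ i l → i ℕ.< n → mulMatrix n δ T i l ≈ T i l
    δT i l i<n = begin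
      ∑< n (λ k → δ i k * T k l)
        ≈⟨ ∑-pick n i _ i<n (λ k _ k≢i → trans (*-congʳ (reflexive (δ-≢ (k≢i ∘ ≡.sym)))) (zeroˡ _)) ⟩
      δ i i * T i l ≈⟨ trans (*-congʳ (reflexive (δ-≡ i))) (*-identityˡ _) ⟩
      T i l ∎

-- Polynomials

module Convolution (R : CommutativeRing c ℓ) where
  open CommutativeRing R hiding (_-_; zero)
  open Solver R
  open SetoidReasoning setoid

  Sequence : Set _
  Sequence = ℕ → Carrier

  -- The Cauchy product, with a recursion parallel to multiplication of coefficient lists. The ring
  -- laws are proved for sequences, where lengths and trailing zeros do not exist, and then
  -- transferred.
  conv : Sequence → Sequence → Sequence
  conv f g zero    = f 0 * g 0
  conv f g (suc k) = f 0 * g (suc k) + conv (f ∘ suc) g k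

  conv-cong : ∀ {f f′ g g′} → (∀ k → f k ≈ f′ k) → (∀ k → g k ≈ g′ k) →
              ∀ k → conv f g k ≈ conv f′ g′ k
  conv-cong f≈f′ g≈g′ zero    = *-cong (f≈f′ 0) (g≈g′ 0)
  conv-cong f≈f′ g≈g′ (suc k) =
    +-cong (*-cong (f≈f′ 0) (g≈g′ (suc k))) (conv-cong (f≈f′ ∘ suc) g≈g′ k)

  conv-+ˡ : ∀ f f′ g k → conv (λ i → f i + f′ i) g k ≈ conv f g k + conv f′ g k
  conv-+ˡ f f′ g zero    = distribʳ _ _ _
  conv-+ˡ f f′ g (suc k) = trans (+-congˡ (conv-+ˡ (f ∘ suc) (f′ ∘ suc) g k))
    (solve 5 (λ x y z u v → (x :+ y) :* z :+ (u :+ v) := (x :* z :+ u) :+ (y :* z :+ v)) refl _ _ _ _ _)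

  conv-*ˡ : ∀ x f g k → conv (λ i → x * f i) g k ≈ x * conv f g k
  conv-*ˡ x f g zero    = *-assoc _ _ _
  conv-*ˡ x f g (suc k) = trans (+-cong (*-assoc _ _ _) (conv-*ˡ x (f ∘ suc) g k)) (sym (distribˡ _ _ _))

  conv-0ˡ : ∀ {f} g → (∀ i → f i ≈ 0#) → ∀ k → conv f g k ≈ 0#
  conv-0ˡ g f≈0 zero    = trans (*-congʳ (f≈0 0)) (zeroˡ _)
  conv-0ˡ g f≈0 (suc k) =
    trans (+-cong (trans (*-congʳ (f≈0 0)) (zeroˡ _)) (conv-0ˡ g (f≈0 ∘ suc) k)) (+-identityˡ _)

  conv-last : ∀ f g k → conv f g (suc k) ≈ conv f (g ∘ suc) k + f (suc k) * g 0
  conv-last f g zero    = refl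
  conv-last f g (suc k) = trans (+-congˡ (conv-last (f ∘ suc) g k)) (sym (+-assoc _ _ _))

  conv-comm : ∀ f g k → conv f g k ≈ conv g f k
  conv-comm f g zero    = *-comm _ _
  conv-comm f g (suc k) = begin
    f 0 * g (suc k) + conv (f ∘ suc) g k ≈⟨ +-cong (*-comm _ _) (conv-comm (f ∘ suc) g k) ⟩
    g (suc k) * f 0 + conv g (f ∘ suc) k ≈⟨ +-comm _ _ ⟩
    conv g (f ∘ suc) k + g (suc k) * f 0 ≈⟨ conv-last g f k ⟨
    conv g f (suc k) ∎

  conv-assoc : ∀ f g h k → conv (conv f g) h k ≈ conv f (conv g h) k
  conv-assoc f g h zero    = *-assoc _ _ _
  conv-assoc f g h (suc k) = begin
    f 0 * g 0 * h (suc k) + conv (λ i → f 0 * g (suc i) + conv (f ∘ suc) g i) h k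
      ≈⟨ +-congˡ (conv-+ˡ (λ i → f 0 * g (suc i)) (conv (f ∘ suc) g) h k) ⟩
    f 0 * g 0 * h (suc k) + (conv (λ i → f 0 * g (suc i)) h k + conv (conv (f ∘ suc) g) h k)
      ≈⟨ +-congˡ (+-cong (conv-*ˡ (f 0) (g ∘ suc) h k) (conv-assoc (f ∘ suc) g h k)) ⟩
    f 0 * g 0 * h (suc k) + (f 0 * conv (g ∘ suc) h k + conv (f ∘ suc) (conv g h) k)
      ≈⟨ solve 5 (λ x y z u v → x :* y :* z :+ (x :* u :+ v) := x :* (y :* z :+ u) :+ v) refl _ _ _ _ _ ⟩
    f 0 * (g 0 * h (suc k) + conv (g ∘ suc) h k) + conv (f ∘ suc) (conv g h) k ∎

  conv-vanish : ∀ a b {f g} → (∀ k → a ℕ.< k → f k ≈ 0#) → (∀ k → b ℕ.< k → g k ≈ 0#) →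
                ∀ k → a ℕ.+ b ℕ.< k → conv f g k ≈ 0#
  conv-vanish zero    b {f} {g} f≈0 g≈0 (suc k) b<k =
    trans (+-cong (trans (*-congˡ (g≈0 (suc k) b<k)) (zeroʳ _))
                  (conv-0ˡ g (λ i → f≈0 (suc i) (s≤s z≤n)) k))
          (+-identityˡ _)
  conv-vanish (suc a) b {f} {g} f≈0 g≈0 (suc k) (s≤s a+b<k) =
    trans (+-cong (trans (*-congˡ (g≈0 (suc k) (ℕ.m<n⇒m<1+n (ℕ.≤-<-trans (ℕ.m≤n+m b a) a+b<k)))) (zeroʳ _))
                  (conv-vanish a b (λ i a<i → f≈0 (suc i) (s≤s a<i)) g≈0 k a+b<k))
          (+-identityˡ _)

module Polynomials (R : CommutativeRing c ℓ) where
  open CommutativeRing R hiding (_-_; zero)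
  open RingNotation rawRing
  open RingProperties ring using (-0#≈0#)
    renaming (x∙y⁻¹≈ε⇒x≈y to x-y≈0⇒x≈y)
  open Polynomial rawRing public using (coeff; eval)
  open Polynomial rawRing using (add; mul)
  open FiniteSums R using (∏<; ∏-zero; ∏-suc)
  open Convolution R
  open Solver R
  open SetoidReasoning setoid

  private
    neg : List Carrier → List Carrier
    neg = map (λ x → - x)

    coeff-add : ∀ p q k → coeff (add p q) k ≈ coeff p k + coeff q k
    coeff-add []      q       k       = sym (+-identityˡ _)
    coeff-add (x ∷ p) []      k       = sym (+-identityʳ _)
    coeff-add (x ∷ p) (y ∷ q) zero    = refl
    coeff-add (x ∷ p) (y ∷ q) (suc k) = coeff-add p q k

    coeff-map-* : ∀ x p k → coeff (map (x *_) p) k ≈ x * coeff p k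
    coeff-map-* x []      k       = sym (zeroʳ x)
    coeff-map-* x (y ∷ p) zero    = refl
    coeff-map-* x (y ∷ p) (suc k) = coeff-map-* x p k

    coeff-neg : ∀ p k → coeff (neg p) k ≈ - coeff p k
    coeff-neg []      k       = sym -0#≈0#
    coeff-neg (y ∷ p) zero    = refl
    coeff-neg (y ∷ p) (suc k) = coeff-neg p k

    coeff-mul : ∀ p q k → coeff (mul p q) k ≈ conv (coeff p) (coeff q) k
    coeff-mul []      q k       = sym (conv-0ˡ (coeff q) (λ _ → refl) k)
    coeff-mul (x ∷ p) q zero    =
      trans (coeff-add (map (x *_) q) _ 0) (trans (+-identityʳ _) (coeff-map-* x q 0))
    coeff-mul (x ∷ p) q (suc k) =
      trans (coeff-add (map (x *_) q) _ (suc k)) (+-cong (coeff-map-* x q (suc k)) (coeff-mul p q k))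

    eval-add : ∀ p q x → eval (add p q) x ≈ eval p x + eval q x
    eval-add []      q       x = sym (+-identityˡ _)
    eval-add (y ∷ p) []      x = sym (+-identityʳ _)
    eval-add (y ∷ p) (z ∷ q) x = trans (+-congˡ (*-congˡ (eval-add p q x)))
      (solve 5 (λ y z x u v → y :+ z :+ x :* (u :+ v) := y :+ x :* u :+ (z :+ x :* v)) refl _ _ _ _ _)

    eval-map-* : ∀ a p x → eval (map (a *_) p) x ≈ a * eval p x
    eval-map-* a []      x = sym (zeroʳ a)
    eval-map-* a (y ∷ p) x = trans (+-congˡ (*-congˡ (eval-map-* a p x)))
      (solve 4 (λ a y x u → a :* y :+ x :* (a :* u) := a :* (y :+ x :* u)) refl _ _ _ _)

    eval-neg : ∀ p x → eval (neg p) x ≈ - eval p x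
    eval-neg []      x = sym -0#≈0#
    eval-neg (y ∷ p) x = trans (+-congˡ (*-congˡ (eval-neg p x)))
      (solve 3 (λ y x u → :- y :+ x :* (:- u) := :- (y :+ x :* u)) refl _ _ _)

    eval-mul : ∀ p q x → eval (mul p q) x ≈ eval p x * eval q x
    eval-mul []      q x = sym (zeroˡ _)
    eval-mul (y ∷ p) q x = begin
      eval (add (map (y *_) q) (0# ∷ mul p q)) x ≈⟨ eval-add (map (y *_) q) _ x ⟩
      eval (map (y *_) q) x + (0# + x * eval (mul p q) x)
        ≈⟨ +-cong (eval-map-* y q x) (+-congˡ (*-congˡ (eval-mul p q x))) ⟩
      y * eval q x + (0# + x * (eval p x * eval q x))
        ≈⟨ solve 4 (λ y v x u → y :* v :+ (:0 :+ x :* (u :* v)) := (y :+ x :* u) :* v) refl _ _ _ _ ⟩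
      (y + x * eval p x) * eval q x ∎

  -- The operations of Poly rawRing, made opaque so that implicit arguments can
  -- be inferred.
  opaque
    infix  4 _≋_
    infixl 6 _⊕_
    infixl 7 _⊛_
    infix  8 ⊖_

    _≋_ : List Carrier → List Carrier → Set ℓ
    p ≋ q = ∀ k → coeff p k ≈ coeff q k

    _⊕_ _⊛_ : List Carrier → List Carrier → List Carrier
    _⊕_ = add
    _⊛_ = mul

    ⊖_ : List Carrier → List Carrier
    ⊖_ = neg

    𝟘 𝟙 X : List Carrier
    𝟘 = []
    𝟙 = 1# ∷ []
    X = Polynomial.X rawRing

    C : Carrier → List Carrier
    C = Polynomial.C rawRing

    ≋-intro : ∀ {p q} → (∀ k → coeff p k ≈ coeff q k) → p ≋ q
    ≋-intro p≋q = p≋q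

    coeff-cong : ∀ {p q} → p ≋ q → ∀ k → coeff p k ≈ coeff q k
    coeff-cong p≋q = p≋q

    coeff-⊕ : ∀ p q k → coeff (p ⊕ q) k ≈ coeff p k + coeff q k
    coeff-⊕ = coeff-add

    coeff-⊖ : ∀ p k → coeff (⊖ p) k ≈ - coeff p k
    coeff-⊖ = coeff-neg

    coeff-⊛ : ∀ p q k → coeff (p ⊛ q) k ≈ conv (coeff p) (coeff q) k
    coeff-⊛ = coeff-mul

    coeff-𝟘 : ∀ k → coeff 𝟘 k ≈ 0#
    coeff-𝟘 k = refl

    coeff-C-zero : ∀ x → coeff (C x) 0 ≈ x
    coeff-C-zero x = refl

    coeff-C-suc : ∀ x k → coeff (C x) (suc k) ≈ 0#
    coeff-C-suc x k = refl

    coeff-X-zero : coeff X 0 ≈ 0#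
    coeff-X-zero = refl

    coeff-X-suc : ∀ k → coeff X (suc k) ≈ coeff (C 1#) k
    coeff-X-suc k = refl

    𝟙≋C : 𝟙 ≋ C 1#
    𝟙≋C k = refl

    eval-⊕ : ∀ p q x → eval (p ⊕ q) x ≈ eval p x + eval q x
    eval-⊕ = eval-add

    eval-⊛ : ∀ p q x → eval (p ⊛ q) x ≈ eval p x * eval q x
    eval-⊛ = eval-mul

    eval-⊖ : ∀ p x → eval (⊖ p) x ≈ - eval p x
    eval-⊖ = eval-neg

    eval-𝟘 : ∀ x → eval 𝟘 x ≈ 0#
    eval-𝟘 x = refl

    eval-C : ∀ a x → eval (C a) x ≈ a
    eval-C a x = trans (+-congˡ (zeroʳ x)) (+-identityʳ a)

    eval-X : ∀ x → eval X x ≈ x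
    eval-X x = solve 1 (λ x → :0 :+ x :* (:1 :+ x :* :0) := x) refl x

  private
    ≋-refl : ∀ {p} → p ≋ p
    ≋-refl = ≋-intro λ _ → refl

    ≋-sym : ∀ {p q} → p ≋ q → q ≋ p
    ≋-sym p≋q = ≋-intro λ k → sym (coeff-cong p≋q k)

    ≋-trans : ∀ {p q r} → p ≋ q → q ≋ r → p ≋ r
    ≋-trans p≋q q≋r = ≋-intro λ k → trans (coeff-cong p≋q k) (coeff-cong q≋r k)

    ⊛-cong : ∀ {p p′ q q′} → p ≋ p′ → q ≋ q′ → p ⊛ q ≋ p′ ⊛ q′
    ⊛-cong {p} {p′} {q} {q′} p≋p′ q≋q′ = ≋-intro λ k → begin
      coeff (p ⊛ q) k ≈⟨ coeff-⊛ p q k ⟩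
      conv (coeff p) (coeff q) k ≈⟨ conv-cong (coeff-cong p≋p′) (coeff-cong q≋q′) k ⟩
      conv (coeff p′) (coeff q′) k ≈⟨ coeff-⊛ p′ q′ k ⟨
      coeff (p′ ⊛ q′) k ∎

    ⊛-assoc : ∀ p q r → (p ⊛ q) ⊛ r ≋ p ⊛ (q ⊛ r)
    ⊛-assoc p q r = ≋-intro λ k → begin
      coeff ((p ⊛ q) ⊛ r) k ≈⟨ coeff-⊛ (p ⊛ q) r k ⟩
      conv (coeff (p ⊛ q)) (coeff r) k ≈⟨ conv-cong (coeff-⊛ p q) (λ _ → refl) k ⟩
      conv (conv (coeff p) (coeff q)) (coeff r) k ≈⟨ conv-assoc (coeff p) (coeff q) (coeff r) k ⟩
      conv (coeff p) (conv (coeff q) (coeff r)) k ≈⟨ conv-cong {coeff p} (λ _ → refl) (coeff-⊛ q r) k ⟨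
      conv (coeff p) (coeff (q ⊛ r)) k ≈⟨ coeff-⊛ p (q ⊛ r) k ⟨
      coeff (p ⊛ (q ⊛ r)) k ∎

    ⊛-comm : ∀ p q → p ⊛ q ≋ q ⊛ p
    ⊛-comm p q = ≋-intro λ k → trans (coeff-⊛ p q k)
      (trans (conv-comm (coeff p) (coeff q) k) (sym (coeff-⊛ q p k)))

    conv-C : ∀ x f k → conv (coeff (C x)) f k ≈ x * f k
    conv-C x f zero    = *-congʳ (coeff-C-zero x)
    conv-C x f (suc k) =
      trans (+-cong (*-congʳ (coeff-C-zero x)) (conv-0ˡ f (coeff-C-suc x) k)) (+-identityʳ _)

    ⊛-identityˡ : ∀ p → 𝟙 ⊛ p ≋ p
    ⊛-identityˡ p = ≋-intro λ k → begin
      coeff (𝟙 ⊛ p) k ≈⟨ coeff-⊛ 𝟙 p k ⟩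
      conv (coeff 𝟙) (coeff p) k ≈⟨ conv-cong (coeff-cong 𝟙≋C) (λ _ → refl) k ⟩
      conv (coeff (C 1#)) (coeff p) k ≈⟨ conv-C 1# (coeff p) k ⟩
      1# * coeff p k ≈⟨ *-identityˡ _ ⟩
      coeff p k ∎

    ⊛-distribʳ : ∀ p q r → (q ⊕ r) ⊛ p ≋ q ⊛ p ⊕ r ⊛ p
    ⊛-distribʳ p q r = ≋-intro λ k → begin
      coeff ((q ⊕ r) ⊛ p) k ≈⟨ coeff-⊛ (q ⊕ r) p k ⟩
      conv (coeff (q ⊕ r)) (coeff p) k ≈⟨ conv-cong (coeff-⊕ q r) (λ _ → refl) k ⟩
      conv (λ i → coeff q i + coeff r i) (coeff p) k ≈⟨ conv-+ˡ (coeff q) (coeff r) (coeff p) k ⟩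
      conv (coeff q) (coeff p) k + conv (coeff r) (coeff p) k
        ≈⟨ +-cong (coeff-⊛ q p k) (coeff-⊛ r p k) ⟨
      coeff (q ⊛ p) k + coeff (r ⊛ p) k ≈⟨ coeff-⊕ (q ⊛ p) (r ⊛ p) k ⟨
      coeff (q ⊛ p ⊕ r ⊛ p) k ∎

    ⊕-cong : ∀ {p p′ q q′} → p ≋ p′ → q ≋ q′ → p ⊕ q ≋ p′ ⊕ q′
    ⊕-cong {p} {p′} {q} {q′} p≋p′ q≋q′ = ≋-intro λ k →
      trans (coeff-⊕ p q k)
        (trans (+-cong (coeff-cong p≋p′ k) (coeff-cong q≋q′ k)) (sym (coeff-⊕ p′ q′ k)))

    ⊛-distribˡ : ∀ p q r → p ⊛ (q ⊕ r) ≋ p ⊛ q ⊕ p ⊛ r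
    ⊛-distribˡ p q r = ≋-trans (⊛-comm p (q ⊕ r))
      (≋-trans (⊛-distribʳ p q r) (⊕-cong (⊛-comm q p) (⊛-comm r p)))

    ⊕-assoc : ∀ p q r → (p ⊕ q) ⊕ r ≋ p ⊕ (q ⊕ r)
    ⊕-assoc p q r = ≋-intro λ k → begin
      coeff ((p ⊕ q) ⊕ r) k ≈⟨ trans (coeff-⊕ (p ⊕ q) r k) (+-congʳ (coeff-⊕ p q k)) ⟩
      (coeff p k + coeff q k) + coeff r k ≈⟨ +-assoc _ _ _ ⟩
      coeff p k + (coeff q k + coeff r k) ≈⟨ trans (coeff-⊕ p (q ⊕ r) k) (+-congˡ (coeff-⊕ q r k)) ⟨
      coeff (p ⊕ (q ⊕ r)) k ∎

    ⊕-comm : ∀ p q → p ⊕ q ≋ q ⊕ p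
    ⊕-comm p q = ≋-intro λ k → trans (coeff-⊕ p q k) (trans (+-comm _ _) (sym (coeff-⊕ q p k)))

    ⊕-identityˡ : ∀ p → 𝟘 ⊕ p ≋ p
    ⊕-identityˡ p = ≋-intro λ k →
      trans (coeff-⊕ 𝟘 p k) (trans (+-congʳ (coeff-𝟘 k)) (+-identityˡ _))

    ⊖-inverseʳ : ∀ p → p ⊕ ⊖ p ≋ 𝟘
    ⊖-inverseʳ p = ≋-intro λ k →
      trans (coeff-⊕ p (⊖ p) k) (trans (+-congˡ (coeff-⊖ p k)) (trans (-‿inverseʳ _) (sym (coeff-𝟘 k))))

    ⊖-cong : ∀ {p q} → p ≋ q → ⊖ p ≋ ⊖ q
    ⊖-cong {p} {q} p≋q = ≋-intro λ k →
      trans (coeff-⊖ p k) (trans (-‿cong (coeff-cong p≋q k)) (sym (coeff-⊖ q k)))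

  polyRing : CommutativeRing c ℓ
  polyRing = record
    { Carrier = List Carrier
    ; _≈_     = _≋_
    ; _+_     = _⊕_
    ; _*_     = _⊛_
    ; -_      = ⊖_
    ; 0#      = 𝟘
    ; 1#      = 𝟙
    ; isCommutativeRing = record
      { isRing = record
        { +-isAbelianGroup = record
          { isGroup = record
            { isMonoid = record
              { isSemigroup = record
                { isMagma = record
                  { isEquivalence = record { refl = ≋-refl ; sym = ≋-sym ; trans = ≋-trans }
                  ; ∙-cong = ⊕-cong
                  }
                ; assoc = ⊕-assoc
                }
              ; identity = ⊕-identityˡ , λ p → ≋-trans (⊕-comm p 𝟘) (⊕-identityˡ p)
              }
            ; inverse = (λ p → ≋-trans (⊕-comm (⊖ p) p) (⊖-inverseʳ p)) , ⊖-inverseʳ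
            ; ⁻¹-cong = ⊖-cong
            }
          ; comm = ⊕-comm
          }
        ; *-cong     = ⊛-cong
        ; *-assoc    = ⊛-assoc
        ; *-identity = ⊛-identityˡ , λ p → ≋-trans (⊛-comm p 𝟙) (⊛-identityˡ p)
        ; distrib    = ⊛-distribˡ , ⊛-distribʳ
        }
      ; *-comm = ⊛-comm
      }
    }

  private
    module P where
      open CommutativeRing polyRing public
      open RingNotation (CommutativeRing.rawRing polyRing) using (_^_; fromℕ) public
      open FiniteSums polyRing public using (∏<; ∏-zero; ∏-suc)

  opaque
    unfolding _≋_

    eval-≋𝟘 : ∀ p x → p ≋ 𝟘 → eval p x ≈ 0#
    eval-≋𝟘 []      x p≋𝟘 = refl
    eval-≋𝟘 (y ∷ p) x p≋𝟘 =
      trans (+-cong (p≋𝟘 0) (trans (*-congˡ (eval-≋𝟘 p x (p≋𝟘 ∘ suc))) (zeroʳ x))) (+-identityˡ _)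

    eval-cong : ∀ {p q} x → p ≋ q → eval p x ≈ eval q x
    eval-cong {[]}    {q}     x p≋q = sym (eval-≋𝟘 q x λ k → sym (p≋q k))
    eval-cong {y ∷ p} {[]}    x p≋q = eval-≋𝟘 (y ∷ p) x p≋q
    eval-cong {y ∷ p} {z ∷ q} x p≋q = +-cong (p≋q 0) (*-congˡ (eval-cong {p} {q} x (p≋q ∘ suc)))

  eval-congʳ : ∀ p {x y} → x ≈ y → eval p x ≈ eval p y
  eval-congʳ []      x≈y = refl
  eval-congʳ (z ∷ p) x≈y = +-congˡ (*-cong x≈y (eval-congʳ p x≈y))

  eval-𝟙 : ∀ x → eval 𝟙 x ≈ 1#
  eval-𝟙 x = trans (eval-cong x 𝟙≋C) (eval-C 1# x)

  eval-^ : ∀ p n x → eval (p P.^ n) x ≈ eval p x ^ n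
  eval-^ p zero    x = eval-𝟙 x
  eval-^ p (suc n) x = trans (eval-⊛ p (p P.^ n) x) (*-congˡ (eval-^ p n x))

  eval-fromℕ : ∀ n x → eval (P.fromℕ n) x ≈ fromℕ n
  eval-fromℕ zero    x = eval-𝟘 x
  eval-fromℕ (suc n) x = trans (eval-⊕ 𝟙 (P.fromℕ n) x) (+-cong (eval-𝟙 x) (eval-fromℕ n x))

  eval-∏ : ∀ n f x → eval (P.∏< n f) x ≈ ∏< n (λ k → eval (f k) x)
  eval-∏ zero    f x = trans (eval-cong x (P.∏-zero f)) (trans (eval-𝟙 x) (sym (∏-zero _)))
  eval-∏ (suc n) f x = begin
    eval (P.∏< (suc n) f) x ≈⟨ eval-cong x (P.∏-suc n f) ⟩
    eval (f 0 ⊛ P.∏< n (f ∘ suc)) x ≈⟨ eval-⊛ (f 0) _ x ⟩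
    eval (f 0) x * eval (P.∏< n (f ∘ suc)) x ≈⟨ *-congˡ (eval-∏ n (f ∘ suc) x) ⟩
    eval (f 0) x * ∏< n (λ k → eval (f (suc k)) x) ≈⟨ ∏-suc n (λ k → eval (f k) x) ⟨
    ∏< (suc n) (λ k → eval (f k) x) ∎

  coeff-C* : ∀ a p k → coeff (C a ⊛ p) k ≈ a * coeff p k
  coeff-C* a p k = trans (coeff-⊛ (C a) p k) (conv-C a (coeff p) k)

  coeff-X*-zero : ∀ p → coeff (X ⊛ p) 0 ≈ 0#
  coeff-X*-zero p = trans (coeff-⊛ X p 0) (trans (*-congʳ coeff-X-zero) (zeroˡ _))

  coeff-X*-suc : ∀ p k → coeff (X ⊛ p) (suc k) ≈ coeff p k
  coeff-X*-suc p k = begin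
    coeff (X ⊛ p) (suc k) ≈⟨ coeff-⊛ X p (suc k) ⟩
    coeff X 0 * coeff p (suc k) + conv (coeff X ∘ suc) (coeff p) k
      ≈⟨ +-cong (trans (*-congʳ coeff-X-zero) (zeroˡ _)) (conv-cong coeff-X-suc (λ _ → refl) k) ⟩
    0# + conv (coeff (C 1#)) (coeff p) k ≈⟨ +-identityˡ _ ⟩
    conv (coeff (C 1#)) (coeff p) k ≈⟨ conv-C 1# (coeff p) k ⟩
    1# * coeff p k ≈⟨ *-identityˡ _ ⟩
    coeff p k ∎

  X*-∷ : ∀ p → X ⊛ p ≋ 0# ∷ p
  X*-∷ p = ≋-intro λ where
    zero    → coeff-X*-zero p
    (suc k) → coeff-X*-suc p k

  C-cong : ∀ {x y} → x ≈ y → C x ≋ C y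
  C-cong {x} {y} x≈y = ≋-intro λ where
    zero    → trans (coeff-C-zero x) (trans x≈y (sym (coeff-C-zero y)))
    (suc k) → trans (coeff-C-suc x k) (sym (coeff-C-suc y k))

  C-0 : C 0# ≋ 𝟘
  C-0 = ≋-intro λ where
    zero    → trans (coeff-C-zero 0#) (sym (coeff-𝟘 0))
    (suc k) → trans (coeff-C-suc 0# k) (sym (coeff-𝟘 (suc k)))

  C-+ : ∀ x y → C (x + y) ≋ C x ⊕ C y
  C-+ x y = ≋-intro λ where
    zero    → trans (coeff-C-zero _)
      (sym (trans (coeff-⊕ (C x) (C y) 0) (+-cong (coeff-C-zero x) (coeff-C-zero y))))
    (suc k) → trans (coeff-C-suc _ k)
      (sym (trans (coeff-⊕ (C x) (C y) (suc k))
                  (trans (+-cong (coeff-C-suc x k) (coeff-C-suc y k)) (+-identityˡ _))))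

  C-neg : ∀ x → C (- x) ≋ ⊖ C x
  C-neg x = ≋-intro λ where
    zero    → trans (coeff-C-zero _) (sym (trans (coeff-⊖ (C x) 0) (-‿cong (coeff-C-zero x))))
    (suc k) → trans (coeff-C-suc _ k)
      (sym (trans (coeff-⊖ (C x) (suc k)) (trans (-‿cong (coeff-C-suc x k)) -0#≈0#)))

  C-sub : ∀ x y → C (x - y) ≋ C x ⊕ ⊖ C y
  C-sub x y = P.trans (C-+ x (- y)) (P.+-congˡ (C-neg y))

  C-* : ∀ x y → C (x * y) ≋ C x ⊛ C y
  C-* x y = ≋-intro λ where
    zero    → trans (coeff-C-zero _) (sym (trans (coeff-C* x (C y) 0) (*-congˡ (coeff-C-zero y))))
    (suc k) → trans (coeff-C-suc _ k)
      (sym (trans (coeff-C* x (C y) (suc k)) (trans (*-congˡ (coeff-C-suc y k)) (zeroʳ x))))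

  C-^ : ∀ x n → C (x ^ n) ≋ C x P.^ n
  C-^ x zero    = P.sym 𝟙≋C
  C-^ x (suc n) = P.trans (C-* x (x ^ n)) (P.*-congˡ (C-^ x n))

  C-fromℕ : ∀ n → C (fromℕ n) ≋ P.fromℕ n
  C-fromℕ zero    = C-0
  C-fromℕ (suc n) = P.trans (C-+ 1# (fromℕ n)) (P.+-cong (P.sym 𝟙≋C) (C-fromℕ n))

  -- deg p < n
  Below : ℕ → List Carrier → Set ℓ
  Below n p = ∀ k → n ℕ.≤ k → coeff p k ≈ 0#

  Below-≤ : ∀ {m n} p → m ℕ.≤ n → Below m p → Below n p
  Below-≤ p m≤n p< k n≤k = p< k (ℕ.≤-trans m≤n n≤k)

  Below-cong : ∀ {n p q} → p ≋ q → Below n p → Below n q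
  Below-cong p≋q p< k n≤k = trans (sym (coeff-cong p≋q k)) (p< k n≤k)

  Below-⊕ : ∀ {n} p q → Below n p → Below n q → Below n (p ⊕ q)
  Below-⊕ p q p< q< k n≤k =
    trans (coeff-⊕ p q k) (trans (+-cong (p< k n≤k) (q< k n≤k)) (+-identityˡ _))

  Below-⊖ : ∀ {n} p → Below n p → Below n (⊖ p)
  Below-⊖ p p< k n≤k = trans (coeff-⊖ p k) (trans (-‿cong (p< k n≤k)) -0#≈0#)

  Below-⊛ : ∀ a b p q → Below (suc a) p → Below (suc b) q → Below (suc (a ℕ.+ b)) (p ⊛ q)
  Below-⊛ a b p q p< q< k a+b<k = trans (coeff-⊛ p q k) (conv-vanish a b p< q< k a+b<k)

  Below-C : ∀ a → Below 1 (C a)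
  Below-C a (suc k) _ = coeff-C-suc a k

  Below-X : Below 2 X
  Below-X (suc (suc k)) (s≤s (s≤s _)) = trans (coeff-X-suc (suc k)) (coeff-C-suc 1# k)

  Below-X^ : ∀ n → Below (suc n) (X P.^ n)
  Below-X^ zero    = Below-cong (P.sym 𝟙≋C) (Below-C 1#)
  Below-X^ (suc n) = Below-⊛ 1 n X (X P.^ n) Below-X (Below-X^ n)

  coeff-X^ : ∀ n → coeff (X P.^ n) n ≈ 1#
  coeff-X^ zero    = trans (coeff-cong 𝟙≋C 0) (coeff-C-zero 1#)
  coeff-X^ (suc n) = trans (coeff-X*-suc (X P.^ n) n) (coeff-X^ n)

  X-C : Carrier → List Carrier
  X-C a = X ⊕ ⊖ C a

  X-C-cong : ∀ {a b} → a ≈ b → X-C a ≋ X-C b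
  X-C-cong a≈b = P.+-congˡ (P.-‿cong (C-cong a≈b))

  eval-X-C : ∀ a x → eval (X-C a) x ≈ x - a
  eval-X-C a x = trans (eval-⊕ X (⊖ C a) x)
    (+-cong (eval-X x) (trans (eval-⊖ (C a) x) (-‿cong (eval-C a x))))

  private
    X-C-* : ∀ a p → X-C a ⊛ p ≋ X ⊛ p ⊕ ⊖ (C a ⊛ p)
    X-C-* a p = P.trans (P.distribʳ p X (⊖ C a))
      (P.+-congˡ (P.sym (RingProperties.-‿distribˡ-* P.ring (C a) p)))

  coeff-X-C*-zero : ∀ a p → coeff (X-C a ⊛ p) 0 ≈ - (a * coeff p 0)
  coeff-X-C*-zero a p = begin
    coeff (X-C a ⊛ p) 0 ≈⟨ coeff-cong (X-C-* a p) 0 ⟩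
    coeff (X ⊛ p ⊕ ⊖ (C a ⊛ p)) 0 ≈⟨ coeff-⊕ (X ⊛ p) _ 0 ⟩
    coeff (X ⊛ p) 0 + coeff (⊖ (C a ⊛ p)) 0
      ≈⟨ +-cong (coeff-X*-zero p) (trans (coeff-⊖ (C a ⊛ p) 0) (-‿cong (coeff-C* a p 0))) ⟩
    0# - a * coeff p 0 ≈⟨ +-identityˡ _ ⟩
    - (a * coeff p 0) ∎

  coeff-X-C*-suc : ∀ a p k → coeff (X-C a ⊛ p) (suc k) ≈ coeff p k - a * coeff p (suc k)
  coeff-X-C*-suc a p k = begin
    coeff (X-C a ⊛ p) (suc k) ≈⟨ coeff-cong (X-C-* a p) (suc k) ⟩
    coeff (X ⊛ p ⊕ ⊖ (C a ⊛ p)) (suc k) ≈⟨ coeff-⊕ (X ⊛ p) _ (suc k) ⟩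
    coeff (X ⊛ p) (suc k) + coeff (⊖ (C a ⊛ p)) (suc k)
      ≈⟨ +-cong (coeff-X*-suc p k) (trans (coeff-⊖ (C a ⊛ p) (suc k)) (-‿cong (coeff-C* a p (suc k)))) ⟩
    coeff p k - a * coeff p (suc k) ∎

  -- Synthetic division by x - a: the coefficients of the quotient are the Horner values of the
  -- successive tails of p.
  quot : Carrier → List Carrier → List Carrier
  quot a []      = []
  quot a (x ∷ p) = eval p a ∷ quot a p

  private
    -- The coefficients of p = p(a) + (x - a) q. Putting `eval p a` in front of the quotient
    -- supplies both the shift by x and the remainder.
    coeff-quot : ∀ a p k → coeff p k ≈ coeff (eval p a ∷ quot a p) k - a * coeff (quot a p) k
    coeff-quot a []      zero    = solve 1 (λ a → :0 := :0 :- a :* :0) refl a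
    coeff-quot a []      (suc k) = solve 1 (λ a → :0 := :0 :- a :* :0) refl a
    coeff-quot a (x ∷ p) zero    = solve 3 (λ x a e → x := x :+ a :* e :- a :* e) refl _ _ _
    coeff-quot a (x ∷ p) (suc k) = coeff-quot a p k

  factor-root : ∀ a p → eval p a ≈ 0# → p ≋ X-C a ⊛ quot a p
  factor-root a p pa≈0 = ≋-intro λ where
    zero    → begin
      coeff p 0 ≈⟨ coeff-quot a p 0 ⟩
      eval p a - a * coeff (quot a p) 0 ≈⟨ +-congʳ pa≈0 ⟩
      0# - a * coeff (quot a p) 0 ≈⟨ +-identityˡ _ ⟩
      - (a * coeff (quot a p) 0) ≈⟨ coeff-X-C*-zero a (quot a p) ⟨
      coeff (X-C a ⊛ quot a p) 0 ∎
    (suc k) → trans (coeff-quot a p (suc k)) (sym (coeff-X-C*-suc a (quot a p) k))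

  Below-0⇒eval : ∀ p x → Below 0 p → eval p x ≈ 0#
  Below-0⇒eval p x p≈0 =
    trans (eval-cong {p} {𝟘} x (≋-intro λ k → trans (p≈0 k z≤n) (sym (coeff-𝟘 k)))) (eval-𝟘 x)

  Below-quot : ∀ n a p → Below (suc n) p → Below n (quot a p)
  Below-quot n       a []      p< k       n≤k = refl
  Below-quot zero    a (x ∷ p) p< zero    n≤k = Below-0⇒eval p a λ k _ → p< (suc k) (s≤s z≤n)
  Below-quot zero    a (x ∷ p) p< (suc k) n≤k =
    Below-quot zero a p (λ i _ → p< (suc i) (s≤s z≤n)) k z≤n
  Below-quot (suc n) a (x ∷ p) p< (suc k) (s≤s n≤k) =
    Below-quot n a p (λ i n<i → p< (suc i) (s≤s n<i)) k n≤k

  coeff-quot-leading : ∀ n a p → Below (suc (suc n)) p → coeff (quot a p) n ≈ coeff p (suc n)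
  coeff-quot-leading n a p p< = sym (begin
    coeff p (suc n) ≈⟨ coeff-quot a p (suc n) ⟩
    coeff (quot a p) n - a * coeff (quot a p) (suc n)
      ≈⟨ +-congˡ (-‿cong (*-congˡ (Below-quot (suc n) a p p< (suc n) ℕ.≤-refl))) ⟩
    coeff (quot a p) n - a * 0# ≈⟨ solve 2 (λ q a → q :- a :* :0 := q) refl _ a ⟩
    coeff (quot a p) n ∎)

  -- This holds over any commutative ring because x - a is monic. The coefficients of the difference
  -- r satisfy rₖ = a rₖ₊₁ and are zero beyond the end of the list, hence all zero.
  X-C-cancel : ∀ a {p q} → X-C a ⊛ p ≋ X-C a ⊛ q → p ≋ q
  X-C-cancel a {p} {q} eq = ≋-intro λ k →
    x-y≈0⇒x≈y _ _ (trans (sym (coeff-sub k)) (vanish (p ⊕ ⊖ q) recurrence k))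
    where
    coeff-sub : ∀ k → coeff (p ⊕ ⊖ q) k ≈ coeff p k - coeff q k
    coeff-sub k = trans (coeff-⊕ p (⊖ q) k) (+-congˡ (coeff-⊖ q k))

    recurrence : ∀ k → coeff (p ⊕ ⊖ q) k ≈ a * coeff (p ⊕ ⊖ q) (suc k)
    recurrence k = begin
      coeff (p ⊕ ⊖ q) k
        ≈⟨ coeff-sub k ⟩
      coeff p k - coeff q k
        ≈⟨ solve 5 (λ a x y x′ y′ → x :- y := (x :- a :* x′) :- (y :- a :* y′) :+ a :* (x′ :- y′))
                 refl a _ _ (coeff p (suc k)) (coeff q (suc k)) ⟩
      (coeff p k - a * coeff p (suc k)) - (coeff q k - a * coeff q (suc k)) +
      a * (coeff p (suc k) - coeff q (suc k))
        ≈⟨ +-congʳ (+-cong (coeff-X-C*-suc a p k) (-‿cong (coeff-X-C*-suc a q k))) ⟨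
      coeff (X-C a ⊛ p) (suc k) - coeff (X-C a ⊛ q) (suc k) +
      a * (coeff p (suc k) - coeff q (suc k))
        ≈⟨ +-congʳ (trans (+-congʳ (coeff-cong eq (suc k))) (-‿inverseʳ _)) ⟩
      0# + a * (coeff p (suc k) - coeff q (suc k))
        ≈⟨ trans (+-identityˡ _) (*-congˡ (sym (coeff-sub (suc k)))) ⟩
      a * coeff (p ⊕ ⊖ q) (suc k) ∎

    vanish : ∀ r → (∀ k → coeff r k ≈ a * coeff r (suc k)) → ∀ k → coeff r k ≈ 0#
    vanish []      rec k       = refl
    vanish (x ∷ r) rec zero    = trans (rec 0) (trans (*-congˡ (vanish r (rec ∘ suc) 0)) (zeroʳ a))
    vanish (x ∷ r) rec (suc k) = vanish r (rec ∘ suc) k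

  -- Splitting off x - β₀ leaves the other roots in place provided that βₖ - β₀ can be cancelled.
  -- Cancellability is demanded of these differences alone, as the coefficients are themselves
  -- polynomials.
  factor-roots : ∀ n p (β : ℕ → Carrier) → Below (suc n) p →
    (∀ k → k ℕ.< n → eval p (β k) ≈ 0#) →
    (∀ i j → i ℕ.< j → j ℕ.< n → ∀ x → (β j - β i) * x ≈ 0# → x ≈ 0#) →
    p ≋ C (coeff p n) ⊛ P.∏< n (λ k → X-C (β k))
  factor-roots zero    p β p< root cancel =
    P.trans constant (P.trans (P.sym (P.*-identityʳ _)) (P.*-congˡ (P.sym (P.∏-zero λ k → X-C (β k)))))
    where
    constant : p ≋ C (coeff p 0)
    constant = ≋-intro λ where
      zero    → sym (coeff-C-zero _)
      (suc k) → trans (p< (suc k) (s≤s z≤n)) (sym (coeff-C-suc _ k))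
  factor-roots (suc n) p β p< root cancel =
    P.trans p≋ (P.trans (P.*-congˡ IH)
    (P.trans (PS.solve 3 (λ x y z → x PS.:* (y PS.:* z) PS.:= y PS.:* (x PS.:* z)) P.refl
                (X-C (β 0)) (C (coeff q n)) _)
    (P.*-cong (C-cong (coeff-quot-leading n (β 0) p p<))
      (P.sym (P.∏-suc n λ k → X-C (β k))))))
    where
    module PS = Solver polyRing
    q : List Carrier
    q = quot (β 0) p

    p≋ : p ≋ X-C (β 0) ⊛ q
    p≋ = factor-root (β 0) p (root 0 (s≤s z≤n))

    q-root : ∀ k → k ℕ.< n → eval q (β (suc k)) ≈ 0#
    q-root k k<n = cancel 0 (suc k) (s≤s z≤n) (s≤s k<n) _ (begin
      (β (suc k) - β 0) * eval q (β (suc k)) ≈⟨ *-congʳ (eval-X-C (β 0) (β (suc k))) ⟨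
      eval (X-C (β 0)) (β (suc k)) * eval q (β (suc k)) ≈⟨ eval-⊛ (X-C (β 0)) q (β (suc k)) ⟨
      eval (X-C (β 0) ⊛ q) (β (suc k)) ≈⟨ eval-cong (β (suc k)) p≋ ⟨
      eval p (β (suc k)) ≈⟨ root (suc k) (s≤s k<n) ⟩
      0# ∎)

    IH : q ≋ C (coeff q n) ⊛ P.∏< n (λ k → X-C (β (suc k)))
    IH = factor-roots n q (β ∘ suc) (Below-quot (suc n) (β 0) p p<) q-root
      (λ i j i<j j<n → cancel (suc i) (suc j) (s≤s i<j) (s≤s j<n))

-- Divided differences and resultants

≤ᵇ-true : ∀ m n → (m ℕ.≤ᵇ n) ≡ true → m ℕ.≤ n
≤ᵇ-true m n eq = ℕ.≤ᵇ⇒≤ m n (≡.subst T (≡.sym eq) tt)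

≤ᵇ-false : ∀ m n → (m ℕ.≤ᵇ n) ≡ false → n ℕ.< m
≤ᵇ-false m n eq = ℕ.≰⇒> λ m≤n → ≡.subst T eq (ℕ.≤⇒≤ᵇ m≤n)

∸-suc-< : ∀ {n k} → k ℕ.< n → n ∸ suc k ℕ.< n
∸-suc-< {suc n} {k} _ = s≤s (ℕ.m∸n≤m n k)

∸-suc-mono : ∀ {n k l} → k ℕ.< l → l ℕ.< n → n ∸ suc l ℕ.< n ∸ suc k
∸-suc-mono k<l l<n = ℕ.∸-monoʳ-< (s≤s k<l) l<n

∸-suc-injective : ∀ {n k l} → k ℕ.< n → l ℕ.< n → n ∸ suc k ≡ n ∸ suc l → k ≡ l
∸-suc-injective k<n l<n eq = ℕ.suc-injective (ℕ.∸-cancelˡ-≡ k<n l<n eq)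

select : {A : Set ℓ₁} → ℕ → (ℕ → A) → (ℕ → A) → ℕ → A
select zero    f g r       = g r
select (suc e) f g zero    = f 0
select (suc e) f g (suc r) = select e (f ∘ suc) g r

select-< : {A : Set ℓ₁} → ∀ e (f g : ℕ → A) {r} → r ℕ.< e → select e f g r ≡ f r
select-< (suc e) f g {zero}  _         = ≡.refl
select-< (suc e) f g {suc r} (s≤s r<e) = select-< e (f ∘ suc) g r<e

select-+ : {A : Set ℓ₁} → ∀ e (f g : ℕ → A) r → select e f g (e ℕ.+ r) ≡ g r
select-+ zero    f g r = ≡.refl
select-+ (suc e) f g r = select-+ e (f ∘ suc) g r

select-splitAt : {A : Set ℓ₁} → ∀ e {d} (f g : ℕ → A) (r : Fin (e ℕ.+ d)) →
                 [ f ∘ toℕ , g ∘ toℕ ]′ (splitAt e r) ≡ select e f g (toℕ r)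
select-splitAt zero    f g r       = ≡.refl
select-splitAt (suc e) f g zero    = ≡.refl
select-splitAt (suc e) f g (suc r) with splitAt e r | select-splitAt e (f ∘ suc) g r
... | inj₁ _ | eq = eq
... | inj₂ _ | eq = eq

-- The Newton coefficients of a polynomial p for the nodes β: those with
-- p = ∑ᵢ newton β i p · (x - β₀) ⋯ (x - βᵢ₋₁). They are divided differences.
module Newton (R : CommutativeRing c ℓ) where
  open CommutativeRing R hiding (_-_; zero)
  open RingNotation rawRing
  open FiniteSums R
  open Polynomials R
  open Solver R
  open SetoidReasoning setoid

  private
    module P where
      open CommutativeRing polyRing public
      open FiniteSums polyRing public using (∏<; ∏-zero; ∏-suc; ∏-last)
      open Solver polyRing public

  -- For the Newton basis Nᵢ = (x - β₀) ⋯ (x - βᵢ₋₁) one has x Nᵢ = Nᵢ₊₁ + βᵢ Nᵢ. Hence coefficient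
  -- c of x p is β_c times coefficient c of p plus coefficient c - 1, which is a Horner scheme
  -- without division, valid also for repeated nodes.
  newton : (ℕ → Carrier) → ℕ → List Carrier → Carrier
  newton β c       []      = 0#
  newton β zero    (x ∷ p) = x + β 0 * newton β 0 p
  newton β (suc c) (x ∷ p) = β (suc c) * newton β (suc c) p + newton β c p

  newton-zero : ∀ β p → newton β 0 p ≡ eval p (β 0)
  newton-zero β []      = ≡.refl
  newton-zero β (x ∷ p) = ≡.cong (λ v → x + β 0 * v) (newton-zero β p)

  newton-length : ∀ β c p → length p ℕ.≤ c → newton β c p ≈ 0#
  newton-length β c       []      _         = refl
  newton-length β (suc c) (x ∷ p) (s≤s p≤c) =
    trans (+-cong (trans (*-congˡ (newton-length β (suc c) p (ℕ.m≤n⇒m≤1+n p≤c))) (zeroʳ _))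
                  (newton-length β c p p≤c))
          (+-identityˡ _)

  opaque
    unfolding _≋_

    []≋𝟘 : [] ≋ 𝟘
    []≋𝟘 k = refl

    𝟙≋ : 𝟙 ≋ 1# ∷ []
    𝟙≋ k = refl

    ∷≋ : ∀ x p → x ∷ p ≋ C x ⊕ (0# ∷ p)
    ∷≋ x p zero    = sym (+-identityʳ x)
    ∷≋ x p (suc k) = refl

    newton-≋𝟘 : ∀ β c p → p ≋ 𝟘 → newton β c p ≈ 0#
    newton-≋𝟘 β c       []      p≋𝟘 = refl
    newton-≋𝟘 β zero    (x ∷ p) p≋𝟘 =
      trans (+-cong (p≋𝟘 0) (trans (*-congˡ (newton-≋𝟘 β 0 p (p≋𝟘 ∘ suc))) (zeroʳ _))) (+-identityˡ _)
    newton-≋𝟘 β (suc c) (x ∷ p) p≋𝟘 =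
      trans (+-cong (trans (*-congˡ (newton-≋𝟘 β (suc c) p (p≋𝟘 ∘ suc))) (zeroʳ _))
                    (newton-≋𝟘 β c p (p≋𝟘 ∘ suc)))
            (+-identityˡ _)

    newton-cong : ∀ β c {p q} → p ≋ q → newton β c p ≈ newton β c q
    newton-cong β c       {[]}    {q}     p≋q = sym (newton-≋𝟘 β c q λ k → sym (p≋q k))
    newton-cong β c       {x ∷ p} {[]}    p≋q = newton-≋𝟘 β c (x ∷ p) p≋q
    newton-cong β zero    {x ∷ p} {y ∷ q} p≋q =
      +-cong (p≋q 0) (*-congˡ (newton-cong β 0 {p} {q} (p≋q ∘ suc)))
    newton-cong β (suc c) {x ∷ p} {y ∷ q} p≋q =
      +-cong (*-congˡ (newton-cong β (suc c) {p} {q} (p≋q ∘ suc))) (newton-cong β c {p} {q} (p≋q ∘ suc))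

    newton-⊕ : ∀ β c p q → newton β c (p ⊕ q) ≈ newton β c p + newton β c q
    newton-⊕ β c       []      q       = sym (+-identityˡ _)
    newton-⊕ β c       (x ∷ p) []      = sym (+-identityʳ _)
    newton-⊕ β zero    (x ∷ p) (y ∷ q) = trans (+-congˡ (*-congˡ (newton-⊕ β 0 p q)))
      (solve 5 (λ x y b u v → x :+ y :+ b :* (u :+ v) := x :+ b :* u :+ (y :+ b :* v)) refl _ _ _ _ _)
    newton-⊕ β (suc c) (x ∷ p) (y ∷ q) =
      trans (+-cong (*-congˡ (newton-⊕ β (suc c) p q)) (newton-⊕ β c p q))
      (solve 5 (λ b u v s t → b :* (u :+ v) :+ (s :+ t) := b :* u :+ s :+ (b :* v :+ t)) refl _ _ _ _ _)

  newton-map-* : ∀ β c a p → newton β c (map (a *_) p) ≈ a * newton β c p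
  newton-map-* β c       a []      = sym (zeroʳ a)
  newton-map-* β zero    a (x ∷ p) = trans (+-congˡ (*-congˡ (newton-map-* β 0 a p)))
    (solve 4 (λ a x b u → a :* x :+ b :* (a :* u) := a :* (x :+ b :* u)) refl _ _ _ _)
  newton-map-* β (suc c) a (x ∷ p) =
    trans (+-cong (*-congˡ (newton-map-* β (suc c) a p)) (newton-map-* β c a p))
    (solve 4 (λ a b u v → b :* (a :* u) :+ a :* v := a :* (b :* u :+ v)) refl _ _ _ _)

  newton-C* : ∀ β c a p → newton β c (C a ⊛ p) ≈ a * newton β c p
  newton-C* β c a p =
    trans (newton-cong β c {C a ⊛ p} {map (a *_) p} (≋-intro λ k → trans (coeff-C* a p k) (sym (coeff-map p k))))
          (newton-map-* β c a p)
    where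
    coeff-map : ∀ p k → coeff (map (a *_) p) k ≈ a * coeff p k
    coeff-map []      k       = sym (zeroʳ a)
    coeff-map (x ∷ p) zero    = refl
    coeff-map (x ∷ p) (suc k) = coeff-map p k

  X-C*≋ : ∀ b p → X-C b ⊛ p ≋ (0# ∷ p) ⊕ C (- b) ⊛ p
  X-C*≋ b p = P.trans (P.distribʳ p X (⊖ C b)) (P.+-cong (X*-∷ p) (P.*-congʳ (P.sym (C-neg b))))

  newton-X-C* : ∀ β c b p → newton β c (X-C b ⊛ p) ≈ newton β c (0# ∷ p) - b * newton β c p
  newton-X-C* β c b p = begin
    newton β c (X-C b ⊛ p) ≈⟨ newton-cong β c (X-C*≋ b p) ⟩
    newton β c ((0# ∷ p) ⊕ C (- b) ⊛ p) ≈⟨ newton-⊕ β c (0# ∷ p) _ ⟩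
    newton β c (0# ∷ p) + newton β c (C (- b) ⊛ p) ≈⟨ +-congˡ (newton-C* β c (- b) p) ⟩
    newton β c (0# ∷ p) + - b * newton β c p
      ≈⟨ solve 3 (λ u b v → u :+ (:- b) :* v := u :- b :* v) refl _ _ _ ⟩
    newton β c (0# ∷ p) - b * newton β c p ∎

  -- The classical recursion for divided differences with its denominator cleared.
  divided-difference : ∀ β c p →
    (β (suc c) - β 0) * newton β (suc c) p + newton β c p ≈ newton (β ∘ suc) c p
  divided-difference β c       []      = trans (+-identityʳ _) (zeroʳ _)
  divided-difference β zero    (x ∷ p) = begin
    (β 1 - β 0) * (β 1 * u + v) + (x + β 0 * v)
      ≈⟨ solve 5 (λ b₁ b₀ u v x → (b₁ :- b₀) :* (b₁ :* u :+ v) :+ (x :+ b₀ :* v)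
                                  := x :+ b₁ :* ((b₁ :- b₀) :* u :+ v)) refl _ _ _ _ _ ⟩
    x + β 1 * ((β 1 - β 0) * u + v) ≈⟨ +-congˡ (*-congˡ (divided-difference β 0 p)) ⟩
    x + β 1 * newton (β ∘ suc) 0 p ∎
    where
    u v : Carrier
    u = newton β 1 p
    v = newton β 0 p
  divided-difference β (suc c) (x ∷ p) = begin
    (b₂ - β 0) * (b₂ * u + v) + (b₁ * v + w)
      ≈⟨ solve 6 (λ b₂ b₁ b₀ u v w → (b₂ :- b₀) :* (b₂ :* u :+ v) :+ (b₁ :* v :+ w)
                   := b₂ :* ((b₂ :- b₀) :* u :+ v) :+ ((b₁ :- b₀) :* v :+ w)) refl _ _ _ _ _ _ ⟩
    b₂ * ((b₂ - β 0) * u + v) + ((b₁ - β 0) * v + w)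
      ≈⟨ +-cong (*-congˡ (divided-difference β (suc c) p)) (divided-difference β c p) ⟩
    b₂ * newton (β ∘ suc) (suc c) p + newton (β ∘ suc) c p ∎
    where
    b₁ b₂ u v w : Carrier
    b₁ = β (suc c)
    b₂ = β (suc (suc c))
    u  = newton β (suc (suc c)) p
    v  = newton β (suc c) p
    w  = newton β c p

  nodes : (ℕ → Carrier) → ℕ → List Carrier
  nodes β k = P.∏< k (λ i → X-C (β i))

  nodes-suc* : ∀ β k g → nodes β (suc k) ⊛ g ≋ X-C (β 0) ⊛ (nodes (β ∘ suc) k ⊛ g)
  nodes-suc* β k g = P.trans (P.*-congʳ (P.∏-suc k λ i → X-C (β i))) (P.*-assoc _ _ g)

  nodes-last* : ∀ β k g → nodes β (suc k) ⊛ g ≋ X-C (β k) ⊛ (nodes β k ⊛ g)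
  nodes-last* β k g = P.trans (P.*-congʳ (P.∏-last k λ i → X-C (β i)))
    (P.solve 3 (λ x y z → (x P.:* y) P.:* z P.:= y P.:* (x P.:* z)) P.refl _ (X-C (β k)) g)

  nodes-zero* : ∀ β g → nodes β 0 ⊛ g ≋ g
  nodes-zero* β g = P.trans (P.*-congʳ (P.∏-zero λ i → X-C (β i))) (P.*-identityˡ g)

  -- By `divided-difference`, multiplying by x - β₀ lowers the index of a Newton coefficient by one
  -- and drops the first node. At index 0 the coefficient is the value at β₀, which the factor
  -- annihilates.
  newton-nodes-< : ∀ β k c g → c ℕ.< k → newton β c (nodes β k ⊛ g) ≈ 0#
  newton-nodes-< β (suc k) c g c<k = trans (newton-cong β c (nodes-suc* β k g))
    (trans (newton-X-C* β c (β 0) _) (lemma c c<k))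
    where
    h : List Carrier
    h = nodes (β ∘ suc) k ⊛ g

    lemma : ∀ c → c ℕ.< suc k → newton β c (0# ∷ h) - β 0 * newton β c h ≈ 0#
    lemma zero    _         = solve 2 (λ b u → :0 :+ b :* u :- b :* u := :0) refl _ _
    lemma (suc c) (s≤s c<k) = begin
      β (suc c) * newton β (suc c) h + newton β c h - β 0 * newton β (suc c) h
        ≈⟨ solve 4 (λ b₁ b₀ u v → b₁ :* u :+ v :- b₀ :* u := (b₁ :- b₀) :* u :+ v) refl _ _ _ _ ⟩
      (β (suc c) - β 0) * newton β (suc c) h + newton β c h ≈⟨ divided-difference β c h ⟩
      newton (β ∘ suc) c h ≈⟨ newton-nodes-< (β ∘ suc) k c g c<k ⟩
      0# ∎

  -- Each of the k factors uses up one node and one unit of the index, leaving the Newton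
  -- coefficient of g for the nodes from βₖ on.
  newton-nodes-+ : ∀ β k i g → newton β (k ℕ.+ i) (nodes β k ⊛ g) ≈ newton (λ j → β (k ℕ.+ j)) i g
  newton-nodes-+ β zero    i g = newton-cong β i (nodes-zero* β g)
  newton-nodes-+ β (suc k) i g = begin
    newton β (suc (k ℕ.+ i)) (nodes β (suc k) ⊛ g)
      ≈⟨ newton-cong β (suc (k ℕ.+ i)) (nodes-suc* β k g) ⟩
    newton β (suc (k ℕ.+ i)) (X-C (β 0) ⊛ h) ≈⟨ newton-X-C* β (suc (k ℕ.+ i)) (β 0) h ⟩
    β (suc (k ℕ.+ i)) * newton β (suc (k ℕ.+ i)) h + newton β (k ℕ.+ i) h - β 0 * newton β (suc (k ℕ.+ i)) h
      ≈⟨ solve 4 (λ b₁ b₀ u v → b₁ :* u :+ v :- b₀ :* u := (b₁ :- b₀) :* u :+ v) refl _ _ _ _ ⟩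
    (β (suc (k ℕ.+ i)) - β 0) * newton β (suc (k ℕ.+ i)) h + newton β (k ℕ.+ i) h
      ≈⟨ divided-difference β (k ℕ.+ i) h ⟩
    newton (β ∘ suc) (k ℕ.+ i) h ≈⟨ newton-nodes-+ (β ∘ suc) k i g ⟩
    newton (λ j → β (suc (k ℕ.+ j))) i g ∎
    where
    h : List Carrier
    h = nodes (β ∘ suc) k ⊛ g

  newton-nodes-diagonal : ∀ β k g → newton β k (nodes β k ⊛ g) ≈ eval g (β k)
  newton-nodes-diagonal β k g = begin
    newton β k (nodes β k ⊛ g) ≡⟨ ≡.cong (λ j → newton β j (nodes β k ⊛ g)) (ℕ.+-identityʳ k) ⟨
    newton β (k ℕ.+ 0) (nodes β k ⊛ g) ≈⟨ newton-nodes-+ β k 0 g ⟩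
    newton (λ j → β (k ℕ.+ j)) 0 g ≡⟨ newton-zero _ g ⟩
    eval g (β (k ℕ.+ 0)) ≡⟨ ≡.cong (λ j → eval g (β j)) (ℕ.+-identityʳ k) ⟩
    eval g (β k) ∎

  -- With all nodes zero the Newton basis is the basis of monomials.
  newton-0-nodes : ∀ {β} → (∀ k → β k ≈ 0#) → ∀ i g → newton β i g ≈ coeff g i
  newton-0-nodes β≈0 i       []      = refl
  newton-0-nodes β≈0 zero    (x ∷ g) = trans (+-congˡ (trans (*-congʳ (β≈0 0)) (zeroˡ _))) (+-identityʳ x)
  newton-0-nodes β≈0 (suc i) (x ∷ g) =
    trans (+-cong (trans (*-congʳ (β≈0 (suc i))) (zeroˡ _)) (newton-0-nodes β≈0 i g)) (+-identityˡ _)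

  newton-nodes-∷ : ∀ β c k q → newton β c (0# ∷ nodes β k ⊛ q) ≈
                   newton β c (nodes β (suc k) ⊛ q) + β k * newton β c (nodes β k ⊛ q)
  newton-nodes-∷ β c k q = sym (begin
    newton β c (nodes β (suc k) ⊛ q) + β k * newton β c h ≈⟨ +-congʳ (newton-cong β c (nodes-last* β k q)) ⟩
    newton β c (X-C (β k) ⊛ h) + β k * newton β c h ≈⟨ +-congʳ (newton-X-C* β c (β k) h) ⟩
    newton β c (0# ∷ h) - β k * newton β c h + β k * newton β c h
      ≈⟨ solve 2 (λ x y → x :- y :+ y := x) refl _ _ ⟩
    newton β c (0# ∷ h) ∎)
    where
    h : List Carrier
    h = nodes β k ⊛ q

  -- The hypothesis ranges over all indices because coefficient c of x p involves the coefficients c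
  -- and c - 1 of p.
  newton-∷-∑ : ∀ β c n (g : ℕ → Carrier) (h : ℕ → List Carrier) p →
    (∀ c → newton β c p ≈ ∑< n (λ k → g k * newton β c (h k))) →
    newton β c (0# ∷ p) ≈ ∑< n (λ k → g k * newton β c (0# ∷ h k))
  newton-∷-∑ β zero    n g h p p≈ = begin
    0# + β 0 * newton β 0 p
      ≈⟨ trans (+-identityˡ _) (trans (*-congˡ (p≈ 0)) (sym (∑-*ˡ n (β 0) _))) ⟩
    ∑< n (λ k → β 0 * (g k * newton β 0 (h k)))
      ≈⟨ ∑-cong n (λ k _ → solve 3 (λ b x y → b :* (x :* y) := x :* (:0 :+ b :* y)) refl _ _ _) ⟩
    ∑< n (λ k → g k * (0# + β 0 * newton β 0 (h k))) ∎
  newton-∷-∑ β (suc c) n g h p p≈ = begin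
    β (suc c) * newton β (suc c) p + newton β c p
      ≈⟨ +-cong (trans (*-congˡ (p≈ (suc c))) (sym (∑-*ˡ n (β (suc c)) _))) (p≈ c) ⟩
    ∑< n (λ k → β (suc c) * (g k * newton β (suc c) (h k))) + ∑< n (λ k → g k * newton β c (h k))
      ≈⟨ ∑-+ n _ _ ⟨
    ∑< n (λ k → β (suc c) * (g k * newton β (suc c) (h k)) + g k * newton β c (h k))
      ≈⟨ ∑-cong n (λ k _ → solve 4 (λ b x y z → b :* (x :* y) :+ x :* z := x :* (b :* y :+ z)) refl _ _ _ _) ⟩
    ∑< n (λ k → g k * (β (suc c) * newton β (suc c) (h k) + newton β c (h k))) ∎

  -- The Leibniz rule for divided differences.
  newton-⊛ : ∀ β c d p q → length p ℕ.≤ d →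
    newton β c (p ⊛ q) ≈ ∑< d (λ k → newton β k p * newton β c (nodes β k ⊛ q))
  newton-⊛ β c d       []      q _         =
    trans (newton-≋𝟘 β c _ (P.trans (P.*-congʳ []≋𝟘) (P.zeroˡ q))) (sym (∑-0 d λ k _ → zeroˡ _))
  newton-⊛ β c (suc d) (x ∷ p) q (s≤s p≤d) = begin
    newton β c ((x ∷ p) ⊛ q)
      ≈⟨ newton-cong β c expand ⟩
    newton β c (C x ⊛ q ⊕ (0# ∷ p ⊛ q))
      ≈⟨ newton-⊕ β c (C x ⊛ q) _ ⟩
    newton β c (C x ⊛ q) + newton β c (0# ∷ p ⊛ q)
      ≈⟨ +-cong (newton-C* β c x q)
                (newton-∷-∑ β c d (λ k → newton β k p) (λ k → nodes β k ⊛ q) (p ⊛ q)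
                            (λ c → newton-⊛ β c d p q p≤d)) ⟩
    x * newton β c q + ∑< d (λ k → l k * newton β c (0# ∷ nodes β k ⊛ q))
      ≈⟨ +-cong (*-congˡ (newton-cong β c (P.sym (nodes-zero* β q))))
                (∑-cong d λ k _ → trans (*-congˡ (newton-nodes-∷ β c k q)) (distribˡ _ _ _)) ⟩
    x * τ 0 + ∑< d (λ k → l k * τ (suc k) + l k * (β k * τ k))
      ≈⟨ +-congˡ (∑-+ d _ _) ⟩
    x * τ 0 + (∑< d (λ k → l k * τ (suc k)) + ∑< d (λ k → l k * (β k * τ k)))
      -- The sum is extended by its term k = d, which vanishes because p has at most d coefficients;
      -- then the term k = 0 is split off, so that both sums run over the same range.
      ≈⟨ +-congˡ (+-congˡ (trans (sym (trans (∑-last d (λ k → l k * (β k * τ k)))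
                   (trans (+-congˡ (trans (*-congʳ (newton-length β d p p≤d)) (zeroˡ _))) (+-identityʳ _))))
                   (∑-suc d (λ k → l k * (β k * τ k))))) ⟩
    x * τ 0 + (∑< d (λ k → l k * τ (suc k)) +
               (l 0 * (β 0 * τ 0) + ∑< d (λ k → l (suc k) * (β (suc k) * τ (suc k)))))
      ≈⟨ solve 6 (λ x t s l b r → x :* t :+ (s :+ (l :* (b :* t) :+ r)) := (x :+ b :* l) :* t :+ (r :+ s))
               refl _ _ _ _ _ _ ⟩
    (x + β 0 * l 0) * τ 0 +
    (∑< d (λ k → l (suc k) * (β (suc k) * τ (suc k))) + ∑< d (λ k → l k * τ (suc k)))
      ≈⟨ +-congˡ (trans (sym (∑-+ d _ _)) (∑-cong d λ k _ →
           solve 4 (λ l b t m → l :* (b :* t) :+ m :* t := (b :* l :+ m) :* t) refl _ _ _ _)) ⟩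
    newton β 0 (x ∷ p) * τ 0 + ∑< d (λ k → newton β (suc k) (x ∷ p) * τ (suc k))
      ≈⟨ ∑-suc d (λ k → newton β k (x ∷ p) * τ k) ⟨
    ∑< (suc d) (λ k → newton β k (x ∷ p) * τ k) ∎
    where
    l τ : ℕ → Carrier
    l k = newton β k p
    τ k = newton β c (nodes β k ⊛ q)

    expand : (x ∷ p) ⊛ q ≋ C x ⊛ q ⊕ (0# ∷ p ⊛ q)
    expand = P.trans (P.*-congʳ (∷≋ x p)) (P.trans (P.distribʳ q (C x) (0# ∷ p))
      (P.+-congˡ (P.trans (P.*-congʳ (P.sym (X*-∷ p))) (P.trans (P.*-assoc X p q) (X*-∷ (p ⊛ q))))))

  shift : ℕ → List Carrier → List Carrier
  shift zero    p = p
  shift (suc a) p = 0# ∷ shift a p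

  monomial : ℕ → List Carrier
  monomial a = shift a (1# ∷ [])

  length-monomial : ∀ a → length (monomial a) ≡ suc a
  length-monomial zero    = ≡.refl
  length-monomial (suc a) = ≡.cong suc (length-monomial a)

  coeff-shift-+ : ∀ a p k → coeff (shift a p) (a ℕ.+ k) ≡ coeff p k
  coeff-shift-+ zero    p k = ≡.refl
  coeff-shift-+ (suc a) p k = coeff-shift-+ a p k

  coeff-shift-< : ∀ a p {k} → k ℕ.< a → coeff (shift a p) k ≡ 0#
  coeff-shift-< (suc a) p {zero}  _         = ≡.refl
  coeff-shift-< (suc a) p {suc k} (s≤s k<a) = coeff-shift-< a p k<a

  coeff-monomial-≡ : ∀ a → coeff (monomial a) a ≡ 1#
  coeff-monomial-≡ zero    = ≡.refl
  coeff-monomial-≡ (suc a) = coeff-monomial-≡ a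

  coeff-monomial-≢ : ∀ a i → a ≢ i → coeff (monomial a) i ≡ 0#
  coeff-monomial-≢ zero    zero    a≢i = contradiction ≡.refl a≢i
  coeff-monomial-≢ zero    (suc i) a≢i = ≡.refl
  coeff-monomial-≢ (suc a) zero    a≢i = ≡.refl
  coeff-monomial-≢ (suc a) (suc i) a≢i = coeff-monomial-≢ a i (a≢i ∘ ≡.cong suc)

  Below-shift : ∀ a {n p} → Below n p → Below (a ℕ.+ n) (shift a p)
  Below-shift zero    p< k       n≤k       = p< k n≤k
  Below-shift (suc a) p< (suc k) (s≤s n≤k) = Below-shift a p< k n≤k

  shift≋⊛ : ∀ a p q → p ≋ q → shift a p ≋ q ⊛ monomial a
  shift≋⊛ zero    p q p≋q = P.trans p≋q (P.trans (P.sym (P.*-identityʳ q)) (P.*-congˡ 𝟙≋))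
  shift≋⊛ (suc a) p q p≋q = P.trans (P.sym (X*-∷ (shift a p))) (P.trans (P.*-congˡ (shift≋⊛ a p q p≋q))
    (P.trans (P.solve 3 (λ x y z → x P.:* (y P.:* z) P.:= y P.:* (x P.:* z)) P.refl X q (monomial a))
             (P.*-congˡ (X*-∷ (monomial a)))))

  newton-monomial-diagonal : ∀ β a → newton β a (monomial a) ≈ 1#
  newton-monomial-diagonal β zero    = trans (+-congˡ (zeroʳ _)) (+-identityʳ 1#)
  newton-monomial-diagonal β (suc a) =
    trans (+-cong (trans (*-congˡ (newton-length β (suc a) (monomial a) (ℕ.≤-reflexive (length-monomial a))))
                         (zeroʳ _))
                  (newton-monomial-diagonal β a))
          (+-identityˡ _)

  newton-monomial-< : ∀ β a c → a ℕ.< c → newton β c (monomial a) ≈ 0#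
  newton-monomial-< β a c a<c =
    newton-length β c (monomial a) (≡.subst (ℕ._≤ c) (≡.sym (length-monomial a)) a<c)

  newton-∑ : ∀ β n c p → Below n p → newton β c p ≈ ∑< n (λ k → coeff p k * newton β c (monomial k))
  newton-∑ β n       c []      p< = sym (∑-0 n λ k _ → zeroˡ _)
  newton-∑ β zero    c (x ∷ p) p< = trans
    (newton-≋𝟘 β c (x ∷ p) (≋-intro λ k → trans (p< k z≤n) (sym (coeff-𝟘 k)))) (sym (∑-zero _))
  newton-∑ β (suc n) c (x ∷ p) p< = begin
    newton β c (x ∷ p) ≈⟨ newton-cong β c (∷≋ x p) ⟩
    newton β c (C x ⊕ (0# ∷ p)) ≈⟨ newton-⊕ β c (C x) _ ⟩
    newton β c (C x) + newton β c (0# ∷ p)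
      ≈⟨ +-cong (trans (newton-cong β c (P.sym (P.*-identityʳ (C x)))) (trans (newton-C* β c x 𝟙)
                  (*-congˡ (newton-cong β c 𝟙≋))))
                (newton-∷-∑ β c n (coeff p) monomial p λ c → newton-∑ β n c p λ k n≤k → p< (suc k) (s≤s n≤k)) ⟩
    x * newton β c (monomial 0) + ∑< n (λ k → coeff p k * newton β c (monomial (suc k)))
      ≈⟨ ∑-suc n (λ k → coeff (x ∷ p) k * newton β c (monomial k)) ⟨
    ∑< (suc n) (λ k → coeff (x ∷ p) k * newton β c (monomial k)) ∎

-- The resultant as a product over the roots

module ResultantProduct (R : CommutativeRing c ℓ) where
  open CommutativeRing R hiding (_-_; zero)
  open RingNotation rawRing
  open FiniteSums R
  open Polynomials R
  open Determinant R
  open Newton R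
  open Resultant rawRing using (shiftedRow; sylvester; Res)
  open SetoidReasoning setoid
  open ℕSolver.+-*-Solver using ()
    renaming (solve to solveℕ; _:=_ to _:≡_; _:+_ to _:⊹_; con to conℕ)

  private
    module P where
      open CommutativeRing polyRing public
      open FiniteSums polyRing public using (∏<; ∏-cong)

  -- Row i lists xᵃ p in descending degrees, and column j holds degree k. The equation between
  -- indices is free of subtraction. Right of the constant term the shift gives zero; left of the
  -- leading term it is the degree bound on p.
  shiftedRow≈coeff : ∀ a d p i j k → Below (suc d) p → a ℕ.+ i ℕ.+ d ≡ k ℕ.+ j →
                     shiftedRow d p i j ≈ coeff (shift a p) k
  shiftedRow≈coeff a d p i j k p< eq with i ℕ.≤ᵇ j in i≤j | (j ∸ i) ℕ.≤ᵇ d in j∸i≤d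
  ... | true | true with ℕ.m≤n⇒∃[o]m+o≡n (≤ᵇ-true i j i≤j)
  ...   | o , ≡.refl with ℕ.m≤n⇒∃[o]m+o≡n (≤ᵇ-true (i ℕ.+ o ∸ i) d j∸i≤d)
  ...     | t , ≡.refl rewrite ℕ.m+n∸m≡n i o | ℕ.m+n∸m≡n o t =
    reflexive (≡.sym (≡.trans (≡.cong (coeff (shift a p)) k≡) (coeff-shift-+ a p t)))
    where
    k≡ : k ≡ a ℕ.+ t
    k≡ = ℕ.+-cancelʳ-≡ (i ℕ.+ o) k (a ℕ.+ t) (≡.trans (≡.sym eq)
      (solveℕ 4 (λ a i o t → a :⊹ i :⊹ (o :⊹ t) :≡ a :⊹ t :⊹ (i :⊹ o)) ≡.refl a i o t))
  shiftedRow≈coeff a d p i j k p< eq | true | false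
    with ℕ.m≤n⇒∃[o]m+o≡n (≤ᵇ-true i j i≤j)
  ... | o , ≡.refl with ℕ.m≤n⇒∃[o]m+o≡n (≤ᵇ-false (i ℕ.+ o ∸ i) d j∸i≤d)
  ...   | t , d+t≡ = reflexive (≡.sym (coeff-shift-< a p (≡.subst (k ℕ.<_) (≡.sym a≡) (ℕ.m<m+n k (s≤s z≤n)))))
    where
    a≡ : a ≡ k ℕ.+ suc t
    a≡ = ℕ.+-cancelʳ-≡ (i ℕ.+ d) a (k ℕ.+ suc t) (≡.trans (≡.sym (ℕ.+-assoc a i d)) (≡.trans eq
      (≡.trans (≡.cong (λ o → k ℕ.+ (i ℕ.+ o)) (≡.trans (≡.sym (ℕ.m+n∸m≡n i o)) (≡.sym d+t≡)))
      (solveℕ 4 (λ k i d t → k :⊹ (i :⊹ (conℕ 1 :⊹ d :⊹ t)) :≡ k :⊹ (conℕ 1 :⊹ t) :⊹ (i :⊹ d)) ≡.refl k i d t))))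
  shiftedRow≈coeff a d p i j k p< eq | false | _
    with ℕ.m≤n⇒∃[o]m+o≡n (≤ᵇ-false i j i≤j)
  ... | o , ≡.refl = sym (trans
      (reflexive (≡.trans (≡.cong (coeff (shift a p)) k≡) (coeff-shift-+ a p (suc d ℕ.+ o))))
      (p< (suc d ℕ.+ o) (ℕ.m≤m+n (suc d) o)))
    where
    k≡ : k ≡ a ℕ.+ (suc d ℕ.+ o)
    k≡ = ℕ.+-cancelʳ-≡ j k (a ℕ.+ (suc d ℕ.+ o)) (≡.trans (≡.sym eq)
      (solveℕ 4 (λ a j o d → a :⊹ (conℕ 1 :⊹ j :⊹ o) :⊹ d :≡ a :⊹ (conℕ 1 :⊹ d :⊹ o) :⊹ j) ≡.refl a j o d))

  -- In the basis of the nodes polynomials the Sylvester matrix becomes block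
  -- triangular, with an identity block from the rows of p.
  module _ (d e : ℕ) (β : ℕ → Carrier) (p q : List Carrier)
           (p≋ : p ≋ nodes β d) (q< : Below (suc e) q) (β≈0 : ∀ k → β (d ℕ.+ k) ≈ 0#) where
    private
      n : ℕ
      n = e ℕ.+ d

      row : ℕ → List Carrier
      row = select e (λ i → shift (e ∸ suc i) p) (λ i → shift (d ∸ suc i) q)

      -- Columns descend in degree, hence the indices `n ∸ suc j`. `S` is the Sylvester matrix, `H`
      -- expresses the monomials in the Newton basis and is unitriangular, and `S′` is S H.
      S H S′ : Matrix
      S i j  = coeff (row i) (n ∸ suc j)
      H k l  = newton β (n ∸ suc l) (monomial (n ∸ suc k))
      S′ i l = newton β (n ∸ suc l) (row i)

      Below-nodes : ∀ k → Below (suc k) (nodes β k)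
      Below-nodes zero    = Below-cong (P.trans (P.sym 𝟙≋C) (P.sym (FiniteSums.∏-zero polyRing λ i → X-C (β i)))) (Below-C 1#)
      Below-nodes (suc k) =
        Below-cong (P.trans (P.*-comm _ _) (P.sym (FiniteSums.∏-last polyRing k λ i → X-C (β i))))
          (Below-⊛ 1 k (X-C (β k)) (nodes β k)
            (Below-⊕ X (⊖ C (β k)) Below-X (Below-⊖ (C (β k)) (Below-≤ (C (β k)) (s≤s z≤n) (Below-C (β k)))))
            (Below-nodes k))

      p< : Below (suc d) p
      p< = Below-cong (P.sym p≋) (Below-nodes d)

      row-p : ∀ {i} → i ℕ.< e → row i ≡ shift (e ∸ suc i) p
      row-p i<e = select-< e _ _ i<e

      row-q : ∀ i → row (e ℕ.+ i) ≡ shift (d ∸ suc i) q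
      row-q i = select-+ e _ _ i

      Below-row : ∀ i → i ℕ.< n → Below n (row i)
      Below-row i i<n with i ℕ.<? e
      ... | yes i<e = ≡.subst (Below n) (≡.sym (row-p i<e))
        (≡.subst (λ k → Below k (shift (e ∸ suc i) p)) eq
          (Below-shift (e ∸ suc i) (Below-≤ p (s≤s (ℕ.m≤m+n d i)) p<)))
        where
        eq : e ∸ suc i ℕ.+ suc (d ℕ.+ i) ≡ n
        eq = ≡.trans (solveℕ 3 (λ x d i → x :⊹ (conℕ 1 :⊹ (d :⊹ i)) :≡ x :⊹ (conℕ 1 :⊹ i) :⊹ d) ≡.refl (e ∸ suc i) d i)
                     (≡.cong (ℕ._+ d) (ℕ.m∸n+n≡m i<e))
      ... | no  i≮e with ℕ.m≤n⇒∃[o]m+o≡n (ℕ.≮⇒≥ i≮e)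
      ...   | o , ≡.refl = ≡.subst (Below n) (≡.sym (row-q o))
        (≡.subst (λ k → Below k (shift (d ∸ suc o) q)) eq
          (Below-shift (d ∸ suc o) (Below-≤ q (s≤s (ℕ.m≤m+n e o)) q<)))
        where
        eq : d ∸ suc o ℕ.+ suc (e ℕ.+ o) ≡ n
        eq = ≡.trans (solveℕ 3 (λ x e o → x :⊹ (conℕ 1 :⊹ (e :⊹ o)) :≡ e :⊹ (x :⊹ (conℕ 1 :⊹ o))) ≡.refl (d ∸ suc o) e o)
                     (≡.cong (e ℕ.+_) (ℕ.m∸n+n≡m (ℕ.+-cancelˡ-< e o d i<n)))

      sylvester≈S : ∀ r j → sylvester d e p q r j ≈ S (toℕ r) (toℕ j)
      sylvester≈S r j = trans
        (reflexive (select-splitAt e (λ i → shiftedRow d p i (toℕ j)) (λ i → shiftedRow e q i (toℕ j)) r))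
        (lemma (toℕ r) (Fin.toℕ<n r))
        where
        k+j : n ∸ suc (toℕ j) ℕ.+ suc (toℕ j) ≡ n
        k+j = ℕ.m∸n+n≡m (Fin.toℕ<n j)

        position : ∀ m x i y → m ∸ suc i ℕ.+ suc i ≡ m → x ∸ suc y ℕ.+ suc y ≡ x →
                   ∀ b → m ℕ.+ b ≡ x → m ∸ suc i ℕ.+ i ℕ.+ b ≡ x ∸ suc y ℕ.+ y
        position m x i y eqm eqx b eq = ℕ.suc-injective (≡.trans
          (solveℕ 3 (λ u i b → conℕ 1 :⊹ (u :⊹ i :⊹ b) :≡ u :⊹ (conℕ 1 :⊹ i) :⊹ b) ≡.refl (m ∸ suc i) i b)
          (≡.trans (≡.cong (ℕ._+ b) eqm) (≡.trans eq (≡.trans (≡.sym eqx)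
          (solveℕ 2 (λ u y → u :⊹ (conℕ 1 :⊹ y) :≡ conℕ 1 :⊹ (u :⊹ y)) ≡.refl (x ∸ suc y) y)))))

        lemma : ∀ i → i ℕ.< n →
          select e (λ i → shiftedRow d p i (toℕ j)) (λ i → shiftedRow e q i (toℕ j)) i ≈ S i (toℕ j)
        lemma i i<n with i ℕ.<? e
        ... | yes i<e = begin
          select e _ _ i ≡⟨ select-< e _ _ i<e ⟩
          shiftedRow d p i (toℕ j)
            ≈⟨ shiftedRow≈coeff (e ∸ suc i) d p i (toℕ j) _ p<
                 (position e n i (toℕ j) (ℕ.m∸n+n≡m i<e) k+j d ≡.refl) ⟩
          coeff (shift (e ∸ suc i) p) (n ∸ suc (toℕ j))
            ≡⟨ ≡.cong (λ g → coeff g (n ∸ suc (toℕ j))) (row-p i<e) ⟨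
          S i (toℕ j) ∎
        ... | no  i≮e with ℕ.m≤n⇒∃[o]m+o≡n (ℕ.≮⇒≥ i≮e)
        ...   | o , ≡.refl = begin
          select e _ _ (e ℕ.+ o) ≡⟨ select-+ e _ _ o ⟩
          shiftedRow e q o (toℕ j)
            ≈⟨ shiftedRow≈coeff (d ∸ suc o) e q o (toℕ j) _ q<
                 (position d n o (toℕ j) (ℕ.m∸n+n≡m (ℕ.+-cancelˡ-< e o d i<n)) k+j e (ℕ.+-comm d e)) ⟩
          coeff (shift (d ∸ suc o) q) (n ∸ suc (toℕ j))
            ≡⟨ ≡.cong (λ g → coeff g (n ∸ suc (toℕ j))) (row-q o) ⟨
          S (e ℕ.+ o) (toℕ j) ∎

      S′≈SH : ∀ i l → i ℕ.< n → S′ i l ≈ mulMatrix n S H i l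
      S′≈SH i l i<n = begin
        newton β (n ∸ suc l) (row i)
          ≈⟨ newton-∑ β n (n ∸ suc l) (row i) (Below-row i i<n) ⟩
        ∑< n (λ k → coeff (row i) k * newton β (n ∸ suc l) (monomial k))
          ≈⟨ ∑-reverse n (λ k → coeff (row i) k * newton β (n ∸ suc l) (monomial k)) ⟨
        mulMatrix n S H i l ∎

      detH : ∏< n (λ l → H l l) ≈ 1#
      detH = ∏-1 n λ l _ → newton-monomial-diagonal β (n ∸ suc l)

      detS≈detS′ : detℕ n S ≈ detℕ n S′
      detS≈detS′ = sym (begin
        detℕ n S′ ≈⟨ detℕ-cong n (λ i l i<n _ → S′≈SH i l i<n) ⟩
        detℕ n (mulMatrix n S H)
          ≈⟨ detℕ-mul-upper n S H (λ k l k<n l<k → newton-monomial-< β _ _ (∸-suc-mono l<k k<n)) ⟩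
        ∏< n (λ l → H l l) * detℕ n S ≈⟨ trans (*-congʳ detH) (*-identityˡ _) ⟩
        detℕ n S ∎)

      -- A row of p is a monomial times all d node factors. Its Newton coefficients below d vanish;
      -- those from d on are Newton coefficients of the monomial for the nodes beyond d, which are
      -- 0, hence its ordinary coefficients.
      identityBlock : ∀ i l → i ℕ.< e → l ℕ.< n → S′ i l ≈ δ i l
      identityBlock i l i<e l<n = trans (reflexive (≡.cong (newton β (n ∸ suc l)) (row-p i<e)))
        (trans (newton-cong β (n ∸ suc l) (shift≋⊛ (e ∸ suc i) p (nodes β d) p≋)) lemma)
        where
        lemma : newton β (n ∸ suc l) (nodes β d ⊛ monomial (e ∸ suc i)) ≈ δ i l
        lemma with l ℕ.<? e
        ... | yes l<e = begin
          newton β (n ∸ suc l) (nodes β d ⊛ monomial (e ∸ suc i))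
            ≡⟨ ≡.cong (λ c → newton β c (nodes β d ⊛ monomial (e ∸ suc i))) eq ⟩
          newton β (d ℕ.+ (e ∸ suc l)) (nodes β d ⊛ monomial (e ∸ suc i))
            ≈⟨ newton-nodes-+ β d (e ∸ suc l) _ ⟩
          newton (λ j → β (d ℕ.+ j)) (e ∸ suc l) (monomial (e ∸ suc i))
            ≈⟨ newton-0-nodes β≈0 (e ∸ suc l) (monomial (e ∸ suc i)) ⟩
          coeff (monomial (e ∸ suc i)) (e ∸ suc l)
            ≡⟨ entry ⟩
          δ i l ∎
          where
          eq : n ∸ suc l ≡ d ℕ.+ (e ∸ suc l)
          eq = ≡.trans (≡.cong (_∸ suc l) (ℕ.+-comm e d)) (ℕ.+-∸-assoc d l<e)

          entry : coeff (monomial (e ∸ suc i)) (e ∸ suc l) ≡ δ i l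
          entry with i ℕ.≟ l
          ... | yes ≡.refl = ≡.trans (coeff-monomial-≡ (e ∸ suc i)) (≡.sym (δ-≡ i))
          ... | no  i≢l    = ≡.trans
            (coeff-monomial-≢ (e ∸ suc i) (e ∸ suc l) (i≢l ∘ ∸-suc-injective i<e l<e)) (≡.sym (δ-≢ i≢l))
        ... | no  l≮e = trans
          (newton-nodes-< β d (n ∸ suc l) _ small)
          (reflexive (≡.sym (δ-≢ λ i≡l → l≮e (≡.subst (ℕ._< e) i≡l i<e))))
          where
          small : n ∸ suc l ℕ.< d
          small = ≡.subst (n ∸ suc l ℕ.<_) (ℕ.m+n∸m≡n e d)
            (ℕ.∸-monoʳ-< (s≤s (ℕ.≮⇒≥ l≮e)) l<n)

      B U : Matrix
      B i k = newton β (d ∸ suc k) (monomial (d ∸ suc i))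
      U k l = newton β (d ∸ suc l) (nodes β (d ∸ suc k) ⊛ q)

      -- The Leibniz rule for a monomial times q is a matrix factorisation: `B` is unitriangular,
      -- and `U` is triangular with the values of q at the nodes on its diagonal.
      lowerBlock : ∀ i l → i ℕ.< d → S′ (e ℕ.+ i) (e ℕ.+ l) ≈ mulMatrix d B U i l
      lowerBlock i l i<d = begin
        newton β (n ∸ suc (e ℕ.+ l)) (row (e ℕ.+ i))
          ≡⟨ ≡.cong₂ (newton β) (≡.trans (≡.cong (n ∸_) (≡.sym (ℕ.+-suc e l))) (ℕ.[m+n]∸[m+o]≡n∸o e d (suc l))) (row-q i) ⟩
        newton β (d ∸ suc l) (shift (d ∸ suc i) q)
          ≈⟨ newton-cong β (d ∸ suc l) (P.trans (shift≋⊛ (d ∸ suc i) q q P.refl) (P.*-comm q _)) ⟩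
        newton β (d ∸ suc l) (monomial (d ∸ suc i) ⊛ q)
          ≈⟨ newton-⊛ β (d ∸ suc l) d (monomial (d ∸ suc i)) q
               (≡.subst (ℕ._≤ d) (≡.sym (length-monomial (d ∸ suc i))) (∸-suc-< i<d)) ⟩
        ∑< d (λ k → newton β k (monomial (d ∸ suc i)) * newton β (d ∸ suc l) (nodes β k ⊛ q))
          ≈⟨ ∑-reverse d (λ k → newton β k (monomial (d ∸ suc i)) * newton β (d ∸ suc l) (nodes β k ⊛ q)) ⟨
        mulMatrix d B U i l ∎

    Res-nodes : Res d e p q ≈ ∏< d (λ k → eval q (β k))
    Res-nodes = begin
      Res d e p q ≈⟨ det≈detℕ n _ S sylvester≈S ⟩
      detℕ n S ≈⟨ detS≈detS′ ⟩
      detℕ n S′ ≈⟨ detℕ-block e d identityBlock ⟩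
      detℕ d (λ i l → S′ (e ℕ.+ i) (e ℕ.+ l)) ≈⟨ detℕ-cong d (λ i l i<d _ → lowerBlock i l i<d) ⟩
      detℕ d (mulMatrix d B U)
        ≈⟨ detℕ-mul-lower d B U (λ k l l<d k<l → newton-nodes-< β _ _ q (∸-suc-mono k<l l<d)) ⟩
      ∏< d (λ l → U l l) * detℕ d B
        ≈⟨ *-congˡ (trans (detℕ-upper d B (λ k l k<d l<k → newton-monomial-< β _ _ (∸-suc-mono l<k k<d)))
                          (∏-1 d λ l _ → newton-monomial-diagonal β (d ∸ suc l))) ⟩
      ∏< d (λ l → U l l) * 1# ≈⟨ *-identityʳ _ ⟩
      ∏< d (λ l → U l l) ≈⟨ ∏-cong d (λ l _ → newton-nodes-diagonal β (d ∸ suc l) q) ⟩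
      ∏< d (λ l → eval q (β (d ∸ suc l))) ≈⟨ ∏-reverse d (λ k → eval q (β k)) ⟩
      ∏< d (λ k → eval q (β k)) ∎

  opaque
    resultant : ℕ → ℕ → List Carrier → List Carrier → Carrier
    resultant = Res

    resultant≡Res : ∀ d e p q → resultant d e p q ≡ Res d e p q
    resultant≡Res d e p q = ≡.refl

  resultant-∏ : ∀ d e β p q → p ≋ P.∏< d (λ k → X-C (β k)) → Below (suc e) q →
                resultant d e p q ≈ ∏< d (λ k → eval q (β k))
  resultant-∏ d e β p q p≋ q< = trans (reflexive (resultant≡Res d e p q)) (trans
    (Res-nodes d e β′ p q (P.trans p≋ (P.∏-cong d λ k k<d → X-C-cong (sym (β′-< k k<d)))) q< β′-≥)
    (∏-cong d λ k k<d → eval-congʳ q (β′-< k k<d)))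
    where
    -- Beyond d the nodes are free, since p involves only the first d. The value 0 makes the
    -- identity block come out exactly.
    β′ : ℕ → Carrier
    β′ = select d β (λ _ → 0#)

    β′-< : ∀ k → k ℕ.< d → β′ k ≈ β k
    β′-< k k<d = reflexive (select-< d β _ k<d)

    β′-≥ : ∀ k → β′ (d ℕ.+ k) ≈ 0#
    β′-≥ k = reflexive (select-+ d β _ k)

-- Limits in ℝ

module RealField (ℝ : Reals) where
  open Reals ℝ hiding (_-_; zero)
  open RingNotation rawRing
  open FiniteSums commutativeRing
  open Solver commutativeRing
  open SetoidReasoning setoid

  module < = IsStrictTotalOrder isStrictTotalOrder
  module ≤ = IsTotalOrder (StrictToNonStrict.isTotalOrder _≈_ _<_ isStrictTotalOrder)

  <-respˡ : ∀ {x y z} → x ≈ y → x < z → y < z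
  <-respˡ = <.<-respˡ-≈

  <-respʳ : ∀ {x y z} → y ≈ z → x < y → x < z
  <-respʳ = <.<-respʳ-≈

  ≤-respˡ : ∀ {x y z} → x ≈ y → x ≤ z → y ≤ z
  ≤-respˡ x≈y x≤z = ≤.trans (≤.reflexive (sym x≈y)) x≤z

  ≤-respʳ : ∀ {x y z} → y ≈ z → x ≤ y → x ≤ z
  ≤-respʳ y≈z x≤y = ≤.trans x≤y (≤.reflexive y≈z)

  <⇒≤ : ∀ {x y} → x < y → x ≤ y
  <⇒≤ = inj₁

  <-≤-trans : ∀ {x y z} → x < y → y ≤ z → x < z
  <-≤-trans x<y (inj₁ y<z) = <.trans x<y y<z
  <-≤-trans x<y (inj₂ y≈z) = <-respʳ y≈z x<y

  ≤-<-trans : ∀ {x y z} → x ≤ y → y < z → x < z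
  ≤-<-trans (inj₁ x<y) y<z = <.trans x<y y<z
  ≤-<-trans (inj₂ x≈y) y<z = <-respˡ (sym x≈y) y<z

  <⇒≱ : ∀ {x y} → x < y → ¬ (y ≤ x)
  <⇒≱ x<y y≤x = <.irrefl refl (<-≤-trans x<y y≤x)

  ≮⇒≥ : ∀ {x y} → ¬ (x < y) → y ≤ x
  ≮⇒≥ {x} {y} x≮y with <.compare x y
  ... | tri< x<y _ _ = contradiction x<y x≮y
  ... | tri≈ _ x≈y _ = inj₂ (sym x≈y)
  ... | tri> _ _ y<x = inj₁ y<x

  ≈-stable : ∀ {x y} → ¬ ¬ (x ≈ y) → x ≈ y
  ≈-stable {x} {y} ¬¬x≈y with x <.≟ y
  ... | yes x≈y = x≈y
  ... | no  x≉y = contradiction x≉y ¬¬x≈y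

  x<y⇒0<y-x : ∀ {x y} → x < y → 0# < y - x
  x<y⇒0<y-x {x} {y} x<y =
    <-respˡ (-‿inverseˡ x) (<-respʳ (+-comm (- x) y) (+-monoʳ-< (- x) x<y))

  0<y-x⇒x<y : ∀ {x y} → 0# < y - x → x < y
  0<y-x⇒x<y {x} {y} 0<y-x = <-respˡ (+-identityʳ x)
    (<-respʳ (solve 2 (λ x y → x :+ (y :- x) := y) refl x y) (+-monoʳ-< x 0<y-x))

  x≤y⇒0≤y-x : ∀ {x y} → x ≤ y → 0# ≤ y - x
  x≤y⇒0≤y-x (inj₁ x<y) = inj₁ (x<y⇒0<y-x x<y)
  x≤y⇒0≤y-x (inj₂ x≈y) = inj₂ (sym (trans (+-congˡ (-‿cong x≈y)) (-‿inverseʳ _)))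

  0≤y-x⇒x≤y : ∀ {x y} → 0# ≤ y - x → x ≤ y
  0≤y-x⇒x≤y (inj₁ 0<y-x) = inj₁ (0<y-x⇒x<y 0<y-x)
  0≤y-x⇒x≤y {x} {y} (inj₂ 0≈y-x) = inj₂ (sym (begin
    y ≈⟨ solve 2 (λ x y → y := y :- x :+ x) refl x y ⟩
    y - x + x ≈⟨ +-congʳ 0≈y-x ⟨
    0# + x ≈⟨ +-identityˡ x ⟩
    x ∎))

  +-mono-≤ : ∀ {w x y z} → w ≤ x → y ≤ z → w + y ≤ x + z
  +-mono-≤ {w} {x} {y} {z} w≤x y≤z = ≤.trans (mono y w≤x) (≤-respˡ (+-comm y x) (≤-respʳ (+-comm z x) (mono x y≤z)))
    where
    mono : ∀ {x y} z → x ≤ y → x + z ≤ y + z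
    mono {x} {y} z (inj₁ x<y) = inj₁ (<-respˡ (+-comm z x) (<-respʳ (+-comm z y) (+-monoʳ-< z x<y)))
    mono         z (inj₂ x≈y) = inj₂ (+-congʳ x≈y)

  0≤+ : ∀ {x y} → 0# ≤ x → 0# ≤ y → 0# ≤ x + y
  0≤+ 0≤x 0≤y = ≤-respˡ (+-identityˡ 0#) (+-mono-≤ 0≤x 0≤y)

  0≤* : ∀ {x y} → 0# ≤ x → 0# ≤ y → 0# ≤ x * y
  0≤* (inj₁ 0<x) (inj₁ 0<y) = inj₁ (*-pos 0<x 0<y)
  0≤* (inj₁ _)   (inj₂ 0≈y) = inj₂ (sym (trans (*-congˡ (sym 0≈y)) (zeroʳ _)))
  0≤* (inj₂ 0≈x) _          = inj₂ (sym (trans (*-congʳ (sym 0≈x)) (zeroˡ _)))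

  *-monoˡ-≤ : ∀ {x y} z → 0# ≤ z → x ≤ y → z * x ≤ z * y
  *-monoˡ-≤ {x} {y} z 0≤z x≤y = 0≤y-x⇒x≤y
    (≤-respʳ (solve 3 (λ x y z → z :* (y :- x) := z :* y :- z :* x) refl x y z) (0≤* 0≤z (x≤y⇒0≤y-x x≤y)))

  *-monoˡ-< : ∀ {x y} z → 0# < z → x < y → z * x < z * y
  *-monoˡ-< {x} {y} z 0<z x<y = 0<y-x⇒x<y
    (<-respʳ (solve 3 (λ x y z → z :* (y :- x) := z :* y :- z :* x) refl x y z) (*-pos 0<z (x<y⇒0<y-x x<y)))

  *-mono-≤ : ∀ {w x y z} → 0# ≤ w → 0# ≤ z → w ≤ x → y ≤ z → w * y ≤ x * z
  *-mono-≤ {w} {x} {y} {z} 0≤w 0≤z w≤x y≤z = ≤.trans (*-monoˡ-≤ w 0≤w y≤z)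
    (≤-respˡ (*-comm z w) (≤-respʳ (*-comm z x) (*-monoˡ-≤ z 0≤z w≤x)))

  *-cancelˡ-≤ : ∀ {x y} z → 0# < z → z * x ≤ z * y → x ≤ y
  *-cancelˡ-≤ z 0<z zx≤zy = ≮⇒≥ λ y<x → <⇒≱ (*-monoˡ-< z 0<z y<x) zx≤zy

  x<0⇒0<-x : ∀ {x} → x < 0# → 0# < - x
  x<0⇒0<-x {x} x<0 = <-respʳ (+-identityˡ (- x)) (x<y⇒0<y-x x<0)

  x≉0⇒0<x*x : ∀ {x} → x ≉ 0# → 0# < x * x
  x≉0⇒0<x*x {x} x≉0 with <.compare x 0#
  ... | tri< x<0 _ _ = <-respʳ (solve 1 (λ x → :- x :* :- x := x :* x) refl x)
                               (*-pos (x<0⇒0<-x x<0) (x<0⇒0<-x x<0))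
  ... | tri≈ _ x≈0 _ = contradiction x≈0 x≉0
  ... | tri> _ _ 0<x = *-pos 0<x 0<x

  0≤x*x : ∀ x → 0# ≤ x * x
  0≤x*x x with x <.≟ 0#
  ... | yes x≈0 = inj₂ (sym (trans (*-congʳ x≈0) (zeroˡ x)))
  ... | no  x≉0 = inj₁ (x≉0⇒0<x*x x≉0)

  0<1 : 0# < 1#
  0<1 = <-respʳ (*-identityˡ 1#) (x≉0⇒0<x*x 1≉0)

  0≤fromℕ : ∀ n → 0# ≤ fromℕ n
  0≤fromℕ zero    = ≤.refl
  0≤fromℕ (suc n) = 0≤+ (<⇒≤ 0<1) (0≤fromℕ n)

  0<fromℕ : ∀ n → 0# < fromℕ (suc n)
  0<fromℕ n = <-≤-trans 0<1 (≤-respˡ (+-identityʳ 1#) (+-mono-≤ ≤.refl (0≤fromℕ n)))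

  >⇒≉ : ∀ {x} → 0# < x → x ≉ 0#
  >⇒≉ 0<x x≈0 = <.irrefl (sym x≈0) 0<x

  fromℕ≉0 : ∀ n → fromℕ (suc n) ≉ 0#
  fromℕ≉0 n = >⇒≉ (0<fromℕ n)

  fromℕ-mono : ∀ {m n} → m ℕ.≤ n → fromℕ m ≤ fromℕ n
  fromℕ-mono {n = n} z≤n = 0≤fromℕ n
  fromℕ-mono (s≤s m≤n) = +-mono-≤ ≤.refl (fromℕ-mono m≤n)

  *-cancelˡ : ∀ {x y z} → x ≉ 0# → x * y ≈ x * z → y ≈ z
  *-cancelˡ {x} {y} {z} x≉0 xy≈xz = begin
    y ≈⟨ unit y ⟨
    x ⁻¹ * (x * y) ≈⟨ *-congˡ xy≈xz ⟩
    x ⁻¹ * (x * z) ≈⟨ unit z ⟩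
    z ∎
    where
    unit : ∀ y → x ⁻¹ * (x * y) ≈ y
    unit y = trans (sym (*-assoc _ _ _)) (trans (*-congʳ (trans (*-comm _ _) (⁻¹-inverseʳ x≉0))) (*-identityˡ y))

  *-≉0 : ∀ {x y} → x ≉ 0# → y ≉ 0# → x * y ≉ 0#
  *-≉0 x≉0 y≉0 xy≈0 = y≉0 (*-cancelˡ x≉0 (trans xy≈0 (sym (zeroʳ _))))

  ⁻¹-unique : ∀ {x y} → x * y ≈ 1# → y ≈ x ⁻¹
  ⁻¹-unique {x} {y} xy≈1 = *-cancelˡ x≉0 (trans xy≈1 (sym (⁻¹-inverseʳ x≉0)))
    where
    x≉0 : x ≉ 0#
    x≉0 x≈0 = 1≉0 (trans (sym xy≈1) (trans (*-congʳ x≈0) (zeroˡ y)))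

  0<⁻¹ : ∀ {x} → 0# < x → 0# < x ⁻¹
  0<⁻¹ {x} 0<x with <.compare (x ⁻¹) 0#
  ... | tri> _ _ 0<x⁻¹ = 0<x⁻¹
  ... | tri≈ _ x⁻¹≈0 _ = contradiction
    (trans (sym (⁻¹-inverseʳ (>⇒≉ 0<x))) (trans (*-congˡ x⁻¹≈0) (zeroʳ x))) 1≉0
  ... | tri< x⁻¹<0 _ _ = contradiction (≤.trans (≤-respˡ (⁻¹-inverseʳ (>⇒≉ 0<x)) (<⇒≤ (*-monoˡ-< x 0<x x⁻¹<0)))
                                                (≤.reflexive (zeroʳ x))) (<⇒≱ 0<1)

  half : ∀ ε → 0# < ε → Σ Carrier λ δ → 0# < δ × δ + δ ≈ ε
  half ε 0<ε = ε * 2# ⁻¹ , *-pos 0<ε (0<⁻¹ 0<2) , (begin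
    ε * 2# ⁻¹ + ε * 2# ⁻¹ ≈⟨ solve 2 (λ ε x → ε :* x :+ ε :* x := ε :* ((:1 :+ :1) :* x)) refl ε _ ⟩
    ε * (2# * 2# ⁻¹) ≈⟨ *-congˡ (⁻¹-inverseʳ (>⇒≉ 0<2)) ⟩
    ε * 1# ≈⟨ *-identityʳ ε ⟩
    ε ∎)
    where
    2# : Carrier
    2# = 1# + 1#

    0<2 : 0# < 2#
    0<2 = <-respʳ (+-congˡ (+-identityʳ 1#)) (0<fromℕ 1)

  0≤2x⇒0≤x : ∀ {x} → 0# ≤ x + x → 0# ≤ x
  0≤2x⇒0≤x {x} 0≤2x = ≮⇒≥ λ x<0 → <⇒≱
    (<.trans (<-respʳ (+-identityʳ x) (+-monoʳ-< x x<0)) x<0) 0≤2x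

  -- If no multiple of y exceeds x, the multiples have a supremum s; but then s - y bounds them too,
  -- since the next multiple is at most s.
  archimedean : ∀ x y → 0# < y → ¬ ¬ (∃ λ n → x < fromℕ n * y)
  archimedean x y 0<y none = <⇒≱ s-y<s (least (s - y) s-y-bound)
    where
    Multiple : Carrier → Set
    Multiple z = ∃ λ n → z ≈ fromℕ n * y

    supremum : Σ Carrier λ s →
      IsUpperBound Multiple s × (∀ u → IsUpperBound Multiple u → s ≤ u)
    supremum = complete Multiple (0# , 0 , sym (zeroˡ y))
      (x , λ z (n , z≈ny) → ≤-respˡ (sym z≈ny) (≮⇒≥ λ x<ny → none (n , x<ny)))

    s : Carrier
    s = proj₁ supremum

    bound : IsUpperBound Multiple s
    bound = proj₁ (proj₂ supremum)

    least : ∀ u → IsUpperBound Multiple u → s ≤ u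
    least = proj₂ (proj₂ supremum)

    s-y<s : s - y < s
    s-y<s = 0<y-x⇒x<y (<-respʳ (solve 2 (λ s y → y := s :- (s :- y)) refl s y) 0<y)

    s-y-bound : IsUpperBound Multiple (s - y)
    s-y-bound z (n , z≈ny) = ≤-respˡ (sym z≈ny) (0≤y-x⇒x≤y
      (≤-respʳ (solve 3 (λ s y n → s :- (:1 :+ n) :* y := (s :- y) :- n :* y) refl s y (fromℕ n))
        (x≤y⇒0≤y-x (bound _ (suc n , refl)))))

  -- |x| ≤ X
  Bounded : Carrier → Carrier → Set
  Bounded X x = - X ≤ x × x ≤ X

  bounded-cong : ∀ {X Y x y} → X ≈ Y → x ≈ y → Bounded X x → Bounded Y y
  bounded-cong X≈Y x≈y (l , u) = ≤-respˡ (-‿cong X≈Y) (≤-respʳ x≈y l) , ≤-respˡ x≈y (≤-respʳ X≈Y u)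

  bounded-≤ : ∀ {X Y x} → X ≤ Y → Bounded X x → Bounded Y x
  bounded-≤ {X} {Y} X≤Y (l , u) = ≤.trans (0≤y-x⇒x≤y (≤-respʳ
    (solve 2 (λ X Y → Y :- X := :- X :- :- Y) refl X Y) (x≤y⇒0≤y-x X≤Y))) l , ≤.trans u X≤Y

  bounded-nonneg : ∀ {x} → 0# ≤ x → Bounded x x
  bounded-nonneg {x} 0≤x = 0≤y-x⇒x≤y (≤-respʳ (solve 1 (λ x → x :+ x := x :- :- x) refl x) (0≤+ 0≤x 0≤x)) , ≤.refl

  bounded-0 : ∀ {X} → 0# ≤ X → Bounded X 0#
  bounded-0 {X} 0≤X = 0≤y-x⇒x≤y (≤-respʳ (solve 1 (λ X → X := :0 :- :- X) refl X) 0≤X) , 0≤X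

  bounded-neg : ∀ {X x} → Bounded X x → Bounded X (- x)
  bounded-neg {X} {x} (l , u) =
      0≤y-x⇒x≤y (≤-respʳ (solve 2 (λ X x → X :- x := :- x :- :- X) refl X x) (x≤y⇒0≤y-x u))
    , 0≤y-x⇒x≤y (≤-respʳ (solve 2 (λ X x → x :- :- X := X :- :- x) refl X x) (x≤y⇒0≤y-x l))

  bounded-+ : ∀ {X Y x y} → Bounded X x → Bounded Y y → Bounded (X + Y) (x + y)
  bounded-+ {X} {Y} (lx , ux) (ly , uy) =
    ≤-respˡ (solve 2 (λ X Y → :- X :+ :- Y := :- (X :+ Y)) refl X Y) (+-mono-≤ lx ly) , +-mono-≤ ux uy

  -- No distinction of signs is necessary: 2 (X Y - x y) = (X - x)(Y + y) + (X + x)(Y - y).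
  bounded-* : ∀ {X Y x y} → Bounded X x → Bounded Y y → Bounded (X * Y) (x * y)
  bounded-* {X} {Y} {x} {y} bx by = lower , upper bx by
    where
    upper : ∀ {x y} → Bounded X x → Bounded Y y → x * y ≤ X * Y
    upper {x} {y} (lx , ux) (ly , uy) = 0≤y-x⇒x≤y (0≤2x⇒0≤x (≤-respʳ
      (solve 4 (λ X Y x y → (X :- x) :* (y :- :- Y) :+ (x :- :- X) :* (Y :- y)
                            := (X :* Y :- x :* y) :+ (X :* Y :- x :* y)) refl X Y x y)
      (0≤+ (0≤* (x≤y⇒0≤y-x ux) (x≤y⇒0≤y-x ly)) (0≤* (x≤y⇒0≤y-x lx) (x≤y⇒0≤y-x uy)))))

    lower : - (X * Y) ≤ x * y
    lower = 0≤y-x⇒x≤y (≤-respʳ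
      (solve 4 (λ X Y x y → X :* Y :- :- x :* y := x :* y :- :- (X :* Y)) refl X Y x y)
      (x≤y⇒0≤y-x (upper (bounded-neg bx) by)))

  bounded-cancel : ∀ {h F ε g} → 0# < h → 0# ≤ ε → h ≤ F → Bounded (h * ε) (F * g) → Bounded ε g
  bounded-cancel {h} {F} {ε} {g} 0<h 0≤ε h≤F (l , u) =
    0≤y-x⇒x≤y (≤-respʳ (solve 2 (λ ε g → ε :- :- g := g :- :- ε) refl ε g)
      (x≤y⇒0≤y-x (upper (0≤y-x⇒x≤y (≤-respʳ
        (solve 3 (λ Y F g → F :* g :- :- Y := Y :- F :* :- g) refl (h * ε) F g) (x≤y⇒0≤y-x l)))))) ,
    upper u
    where
    upper : ∀ {g} → F * g ≤ h * ε → g ≤ ε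
    upper Fg≤hε = *-cancelˡ-≤ F (<-≤-trans 0<h h≤F)
      (≤.trans Fg≤hε (*-mono-≤ (<⇒≤ 0<h) 0≤ε h≤F ≤.refl))

  magnitude : ∀ x → Σ Carrier λ X → 0# ≤ X × Bounded X x
  magnitude x with ≤.total 0# x
  ... | inj₁ 0≤x = x , 0≤x , bounded-nonneg 0≤x
  ... | inj₂ x≤0 = - x , 0≤-x ,
    bounded-cong refl (solve 1 (λ x → :- :- x := x) refl x) (bounded-neg (bounded-nonneg 0≤-x))
    where
    0≤-x : 0# ≤ - x
    0≤-x = ≤-respʳ (+-identityˡ (- x)) (x≤y⇒0≤y-x x≤0)

  0≤∑ : ∀ n {f} → (∀ k → k ℕ.< n → 0# ≤ f k) → 0# ≤ ∑< n f
  0≤∑ zero    {f} _   = ≤.reflexive (sym (∑-zero f))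
  0≤∑ (suc n) {f} 0≤f = ≤-respʳ (sym (∑-suc n f))
    (0≤+ (0≤f 0 (s≤s z≤n)) (0≤∑ n λ k k<n → 0≤f (suc k) (s≤s k<n)))

  ∑-mono-≤ : ∀ n {f g} → (∀ k → k ℕ.< n → f k ≤ g k) → ∑< n f ≤ ∑< n g
  ∑-mono-≤ zero    {f} {g} _   = ≤.reflexive (trans (∑-zero f) (sym (∑-zero g)))
  ∑-mono-≤ (suc n) {f} {g} f≤g = ≤-respˡ (sym (∑-suc n f)) (≤-respʳ (sym (∑-suc n g))
    (+-mono-≤ (f≤g 0 (s≤s z≤n)) (∑-mono-≤ n λ k k<n → f≤g (suc k) (s≤s k<n))))

  -- Limits are stated up to double negation: archimedean yields no witness, and
  -- all conclusions drawn from them are stable equations.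
  Eventually : (ℕ → Set) → Set
  Eventually P = ¬ ¬ (∃ λ N → ∀ n → N ℕ.≤ n → P n)

  eventually-map : ∀ {P Q : ℕ → Set} → (∀ n → P n → Q n) → Eventually P → Eventually Q
  eventually-map f ¬¬p ¬q = ¬¬p λ (N , p) → ¬q (N , λ n N≤n → f n (p n N≤n))

  eventually-zip : ∀ {P Q S : ℕ → Set} → (∀ n → P n → Q n → S n) →
                   Eventually P → Eventually Q → Eventually S
  eventually-zip f ¬¬p ¬¬q ¬s = ¬¬p λ (M , p) → ¬¬q λ (N , q) →
    ¬s (M ℕ.⊔ N , λ n M⊔N≤n →
      f n (p n (ℕ.≤-trans (ℕ.m≤m⊔n M N) M⊔N≤n)) (q n (ℕ.≤-trans (ℕ.m≤n⊔m M N) M⊔N≤n)))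

  Null : (ℕ → Carrier) → Set
  Null f = ∀ ε → 0# < ε → Eventually λ n → Bounded ε (f n)

  infix 4 _⟶_
  _⟶_ : (ℕ → Carrier) → Carrier → Set
  f ⟶ l = Null λ n → f n - l

  null-cong : ∀ {f g} → (∀ n → f n ≈ g n) → Null f → Null g
  null-cong f≈g f⟶0 ε 0<ε = eventually-map (λ n → bounded-cong refl (f≈g n)) (f⟶0 ε 0<ε)

  null-bounded : ∀ {F f} → (∀ n → Bounded (F n) (f n)) → Null F → Null f
  null-bounded b F⟶0 ε 0<ε = eventually-map (λ n (_ , Fn≤ε) → bounded-≤ Fn≤ε (b n)) (F⟶0 ε 0<ε)

  null-+ : ∀ {f g} → Null f → Null g → Null λ n → f n + g n
  null-+ f⟶0 g⟶0 ε 0<ε = let δ , 0<δ , δ+δ≈ε = half ε 0<ε in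
    eventually-zip (λ n bf bg → bounded-cong δ+δ≈ε refl (bounded-+ bf bg)) (f⟶0 δ 0<δ) (g⟶0 δ 0<δ)

  null-neg : ∀ {f} → Null f → Null λ n → - f n
  null-neg f⟶0 ε 0<ε = eventually-map (λ n → bounded-neg) (f⟶0 ε 0<ε)

  null-* : ∀ {f g} → Null f → Null g → Null λ n → f n * g n
  null-* f⟶0 g⟶0 ε 0<ε = eventually-zip
    (λ n bf bg → bounded-cong (*-identityˡ ε) refl (bounded-* bf bg)) (f⟶0 1# 0<1) (g⟶0 ε 0<ε)

  null-scale : ∀ {f} c → Null f → Null λ n → c * f n
  null-scale {f} c f⟶0 ε 0<ε with magnitude c
  ... | C , 0≤C , bc = eventually-map
      (λ n bf → bounded-≤ (≤-respʳ D*δ≈ε (*-mono-≤ 0≤C (<⇒≤ 0<δ) C≤D ≤.refl)) (bounded-* bc bf))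
      (f⟶0 δ 0<δ)
    where
    -- 1 + C instead of C, which might be 0.
    D δ : Carrier
    D = 1# + C
    δ = ε * D ⁻¹

    0<D : 0# < D
    0<D = <-≤-trans 0<1 (≤-respˡ (+-identityʳ 1#) (+-mono-≤ ≤.refl 0≤C))

    C≤D : C ≤ D
    C≤D = ≤-respˡ (+-identityˡ C) (+-mono-≤ (<⇒≤ 0<1) ≤.refl)

    0<δ : 0# < δ
    0<δ = *-pos 0<ε (0<⁻¹ 0<D)

    D*δ≈ε : D * δ ≈ ε
    D*δ≈ε = begin
      D * (ε * D ⁻¹) ≈⟨ solve 3 (λ D ε d → D :* (ε :* d) := ε :* (D :* d)) refl D ε _ ⟩
      ε * (D * D ⁻¹) ≈⟨ *-congˡ (⁻¹-inverseʳ (>⇒≉ 0<D)) ⟩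
      ε * 1# ≈⟨ *-identityʳ ε ⟩
      ε ∎

  -- If c is nonzero, c² is positive, and the null sequence with constant value c² would have to get
  -- below half of it. Squaring avoids the sign of c.
  null-const : ∀ {c} → Null (λ _ → c) → c ≈ 0#
  null-const {c} c⟶0 = ≈-stable λ c≉0 →
    let ε , 0<ε , ε+ε≈c² = half (c * c) (x≉0⇒0<x*x c≉0)
    in null-* c⟶0 c⟶0 ε 0<ε λ (N , b) → <⇒≱ (<-respʳ ε+ε≈c² (<-respˡ (+-identityʳ ε) (+-monoʳ-< ε 0<ε)))
         (proj₂ (b N ℕ.≤-refl))

  null-subsequence : ∀ {f} (φ : ℕ → ℕ) → (∀ n → n ℕ.≤ φ n) → Null f → Null (f ∘ φ)
  null-subsequence φ n≤φn f⟶0 ε 0<ε ¬b = f⟶0 ε 0<ε λ (N , b) →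
    ¬b (N , λ n N≤n → b (φ n) (ℕ.≤-trans N≤n (n≤φn n)))

  ⟶-cong : ∀ {f g l m} → (∀ n → f n ≈ g n) → l ≈ m → f ⟶ l → g ⟶ m
  ⟶-cong f≈g l≈m = null-cong λ n → +-cong (f≈g n) (-‿cong l≈m)

  ⟶-unique : ∀ {f l m} → f ⟶ l → f ⟶ m → l ≈ m
  ⟶-unique {f} {l} {m} f⟶l f⟶m = sym (begin
    m ≈⟨ solve 2 (λ l m → m := m :- l :+ l) refl l m ⟩
    m - l + l ≈⟨ +-congʳ (null-const (null-cong
                       (λ n → solve 3 (λ x l m → (x :- l) :+ :- (x :- m) := m :- l) refl (f n) l m)
                       (null-+ f⟶l (null-neg f⟶m)))) ⟩
    0# + l ≈⟨ +-identityˡ l ⟩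
    l ∎)

  ⟶-+null : ∀ {f g l} → f ⟶ l → Null (λ n → g n - f n) → g ⟶ l
  ⟶-+null {f} {g} {l} f⟶l g-f⟶0 = null-cong
    (λ n → solve 3 (λ x y l → (x :- l) :+ (y :- x) := y :- l) refl (f n) (g n) l) (null-+ f⟶l g-f⟶0)

  ⟶-+ : ∀ {f g l m} → f ⟶ l → g ⟶ m → (λ n → f n + g n) ⟶ l + m
  ⟶-+ {f} {g} {l} {m} f⟶l g⟶m = null-cong
    (λ n → solve 4 (λ x y l m → (x :- l) :+ (y :- m) := (x :+ y) :- (l :+ m)) refl (f n) (g n) l m)
    (null-+ f⟶l g⟶m)

  ⟶-neg : ∀ {f l} → f ⟶ l → (λ n → - f n) ⟶ - l
  ⟶-neg {f} {l} f⟶l = null-cong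
    (λ n → solve 2 (λ x l → :- (x :- l) := :- x :- :- l) refl (f n) l) (null-neg f⟶l)

  ⟶-* : ∀ {f g l m} → f ⟶ l → g ⟶ m → (λ n → f n * g n) ⟶ l * m
  ⟶-* {f} {g} {l} {m} f⟶l g⟶m = null-cong
    (λ n → solve 4 (λ x y l m → (x :- l) :* (y :- m) :+ (l :* (y :- m) :+ m :* (x :- l))
                                := x :* y :- l :* m) refl (f n) (g n) l m)
    (null-+ (null-* f⟶l g⟶m) (null-+ (null-scale l g⟶m) (null-scale m f⟶l)))

  -- A sequence with a nonzero limit stays away from zero: eventually l f ≥ l²/2. Multiplying by l
  -- takes care of the sign.
  null-cancel : ∀ {f g l} → l ≉ 0# → f ⟶ l → Null (λ n → f n * g n) → Null g
  null-cancel {f} {g} {l} l≉0 f⟶l fg⟶0 ε 0<ε =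
    let h , 0<h , h+h≈l² = half (l * l) (x≉0⇒0<x*x l≉0) in
    eventually-zip
      (λ n bf bfg → bounded-cancel 0<h (<⇒≤ 0<ε)
        (0≤y-x⇒x≤y (≤-respʳ (large n h h+h≈l²) (x≤y⇒0≤y-x (proj₁ bf))))
        (bounded-cong refl (sym (*-assoc l (f n) (g n))) bfg))
      (null-scale l f⟶l h 0<h) (null-scale l fg⟶0 (h * ε) (*-pos 0<h 0<ε))
    where
    large : ∀ n h → h + h ≈ l * l → l * (f n - l) - - h ≈ l * f n - h
    large n h h+h≈l² = begin
      l * (f n - l) - - h
        ≈⟨ solve 3 (λ l x h → l :* (x :- l) :- :- h := l :* x :- l :* l :+ h) refl l (f n) h ⟩
      l * f n - l * l + h ≈⟨ +-congʳ (+-congˡ (-‿cong h+h≈l²)) ⟨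
      l * f n - (h + h) + h ≈⟨ solve 2 (λ x h → x :- (h :+ h) :+ h := x :- h) refl (l * f n) h ⟩
      l * f n - h ∎

-- Complex numbers

module ComplexField (ℝ : Reals) where
  private
    module R where
      open Reals ℝ public hiding (_-_; zero)
      open RingNotation rawRing public using (_-_; fromℕ; _^_)
      open RealField ℝ public
      open Solver commutativeRing public
  open Complex ℝ public using (𝕚; fromℝ; _⁻¹ᶜ)

  private
    ℂ : Set
    ℂ = R.Carrier × R.Carrier

    module Raw = RawRing (Complex.ℂ ℝ)

  re im : ℂ → R.Carrier
  re = proj₁
  im = proj₂

  -- The operations of ℂ, made opaque so that implicit arguments can be inferred.
  opaque
    infix  4 _≈ᶜ_
    infixl 6 _+ᶜ_
    infixl 7 _*ᶜ_
    infix  8 -ᶜ_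

    _≈ᶜ_ : ℂ → ℂ → Set
    _≈ᶜ_ = Raw._≈_

    _+ᶜ_ _*ᶜ_ : ℂ → ℂ → ℂ
    _+ᶜ_ = Raw._+_
    _*ᶜ_ = Raw._*_

    -ᶜ_ : ℂ → ℂ
    -ᶜ_ = Raw.-_

    0ᶜ 1ᶜ : ℂ
    0ᶜ = Raw.0#
    1ᶜ = Raw.1#

    ≈ᶜ-intro : ∀ {z w} → re z R.≈ re w → im z R.≈ im w → z ≈ᶜ w
    ≈ᶜ-intro = _,_

    re-cong : ∀ {z w} → z ≈ᶜ w → re z R.≈ re w
    re-cong = proj₁

    im-cong : ∀ {z w} → z ≈ᶜ w → im z R.≈ im w
    im-cong = proj₂

    re-+ : ∀ z w → re (z +ᶜ w) ≡ re z R.+ re w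
    re-+ z w = ≡.refl

    im-+ : ∀ z w → im (z +ᶜ w) ≡ im z R.+ im w
    im-+ z w = ≡.refl

    re-* : ∀ z w → re (z *ᶜ w) ≡ re z R.* re w R.- im z R.* im w
    re-* z w = ≡.refl

    im-* : ∀ z w → im (z *ᶜ w) ≡ re z R.* im w R.+ im z R.* re w
    im-* z w = ≡.refl

    re-neg : ∀ z → re (-ᶜ z) ≡ R.- re z
    re-neg z = ≡.refl

    im-neg : ∀ z → im (-ᶜ z) ≡ R.- im z
    im-neg z = ≡.refl

    0ᶜ≡ : 0ᶜ ≡ fromℝ R.0#
    0ᶜ≡ = ≡.refl

    1ᶜ≡ : 1ᶜ ≡ fromℝ R.1#
    1ᶜ≡ = ≡.refl

    private
      *ᶜ-assoc : ∀ z w v → z *ᶜ w *ᶜ v ≈ᶜ z *ᶜ (w *ᶜ v)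
      *ᶜ-assoc (x , y) (x′ , y′) (x″ , y″) =
          R.solve 6 (λ x y x′ y′ x″ y″ →
            (x R.:* x′ R.:- y R.:* y′) R.:* x″ R.:- (x R.:* y′ R.:+ y R.:* x′) R.:* y″ R.:=
            x R.:* (x′ R.:* x″ R.:- y′ R.:* y″) R.:- y R.:* (x′ R.:* y″ R.:+ y′ R.:* x″))
            R.refl x y x′ y′ x″ y″
        , R.solve 6 (λ x y x′ y′ x″ y″ →
            (x R.:* x′ R.:- y R.:* y′) R.:* y″ R.:+ (x R.:* y′ R.:+ y R.:* x′) R.:* x″ R.:=
            x R.:* (x′ R.:* y″ R.:+ y′ R.:* x″) R.:+ y R.:* (x′ R.:* x″ R.:- y′ R.:* y″))
            R.refl x y x′ y′ x″ y″

      *ᶜ-comm : ∀ z w → z *ᶜ w ≈ᶜ w *ᶜ z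
      *ᶜ-comm (x , y) (x′ , y′) =
          R.solve 4 (λ x y x′ y′ → x R.:* x′ R.:- y R.:* y′ R.:= x′ R.:* x R.:- y′ R.:* y) R.refl x y x′ y′
        , R.solve 4 (λ x y x′ y′ → x R.:* y′ R.:+ y R.:* x′ R.:= x′ R.:* y R.:+ y′ R.:* x) R.refl x y x′ y′

      *ᶜ-identityˡ : ∀ z → 1ᶜ *ᶜ z ≈ᶜ z
      *ᶜ-identityˡ (x , y) =
          R.solve 2 (λ x y → R.:1 R.:* x R.:- R.:0 R.:* y R.:= x) R.refl x y
        , R.solve 2 (λ x y → R.:1 R.:* y R.:+ R.:0 R.:* x R.:= y) R.refl x y

      *ᶜ-distribˡ : ∀ z w v → z *ᶜ (w +ᶜ v) ≈ᶜ z *ᶜ w +ᶜ z *ᶜ v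
      *ᶜ-distribˡ (x , y) (x′ , y′) (x″ , y″) =
          R.solve 6 (λ x y x′ y′ x″ y″ → x R.:* (x′ R.:+ x″) R.:- y R.:* (y′ R.:+ y″) R.:=
            (x R.:* x′ R.:- y R.:* y′) R.:+ (x R.:* x″ R.:- y R.:* y″)) R.refl x y x′ y′ x″ y″
        , R.solve 6 (λ x y x′ y′ x″ y″ → x R.:* (y′ R.:+ y″) R.:+ y R.:* (x′ R.:+ x″) R.:=
            (x R.:* y′ R.:+ y R.:* x′) R.:+ (x R.:* y″ R.:+ y R.:* x″)) R.refl x y x′ y′ x″ y″

      ≈ᶜ-trans : ∀ {z w v} → z ≈ᶜ w → w ≈ᶜ v → z ≈ᶜ v
      ≈ᶜ-trans (p , q) (p′ , q′) = R.trans p p′ , R.trans q q′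

      +ᶜ-cong : ∀ {z z′ w w′} → z ≈ᶜ z′ → w ≈ᶜ w′ → z +ᶜ w ≈ᶜ z′ +ᶜ w′
      +ᶜ-cong (p , q) (p′ , q′) = R.+-cong p p′ , R.+-cong q q′

      *ᶜ-cong : ∀ {z z′ w w′} → z ≈ᶜ z′ → w ≈ᶜ w′ → z *ᶜ w ≈ᶜ z′ *ᶜ w′
      *ᶜ-cong (p , q) (p′ , q′) =
        R.+-cong (R.*-cong p p′) (R.-‿cong (R.*-cong q q′)) , R.+-cong (R.*-cong p q′) (R.*-cong q p′)

    isCommutativeRingᶜ : IsCommutativeRing _≈ᶜ_ _+ᶜ_ _*ᶜ_ -ᶜ_ 0ᶜ 1ᶜ
    isCommutativeRingᶜ = record
      { isRing = record
        { +-isAbelianGroup = record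
          { isGroup = record
            { isMonoid = record
              { isSemigroup = record
                { isMagma = record
                  { isEquivalence = record
                    { refl  = R.refl , R.refl
                    ; sym   = λ (p , q) → R.sym p , R.sym q
                    ; trans = ≈ᶜ-trans
                    }
                  ; ∙-cong = +ᶜ-cong
                  }
                ; assoc = λ z w v → R.+-assoc _ _ _ , R.+-assoc _ _ _
                }
              ; identity = (λ z → R.+-identityˡ _ , R.+-identityˡ _) , λ z → R.+-identityʳ _ , R.+-identityʳ _
              }
            ; inverse = (λ z → R.-‿inverseˡ _ , R.-‿inverseˡ _) , λ z → R.-‿inverseʳ _ , R.-‿inverseʳ _
            ; ⁻¹-cong = λ (p , q) → R.-‿cong p , R.-‿cong q
            }
          ; comm = λ z w → R.+-comm _ _ , R.+-comm _ _
          }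
        ; *-cong     = *ᶜ-cong
        ; *-assoc    = *ᶜ-assoc
        ; *-identity = *ᶜ-identityˡ , λ z → ≈ᶜ-trans (*ᶜ-comm z 1ᶜ) (*ᶜ-identityˡ z)
        ; distrib    = *ᶜ-distribˡ , λ z w v → ≈ᶜ-trans (*ᶜ-comm (w +ᶜ v) z)
                         (≈ᶜ-trans (*ᶜ-distribˡ z w v) (+ᶜ-cong (*ᶜ-comm z w) (*ᶜ-comm z v)))
        }
      ; *-comm = *ᶜ-comm
      }

  complexRing : CommutativeRing 0ℓ 0ℓ
  complexRing = record { isCommutativeRing = isCommutativeRingᶜ }

  open CommutativeRing complexRing hiding (_-_; zero)
  open RingNotation rawRing
  open FiniteSums complexRing
  open Solver complexRing
  open SetoidReasoning setoid

  _≟_ : ∀ z w → Dec (z ≈ w)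
  z ≟ w with re z R.<.≟ re w | im z R.<.≟ im w
  ... | yes p | yes q = yes (≈ᶜ-intro p q)
  ... | no ¬p | _     = no (¬p ∘ re-cong)
  ... | yes _ | no ¬q = no (¬q ∘ im-cong)

  fromℝ-cong : ∀ {x y} → x R.≈ y → fromℝ x ≈ fromℝ y
  fromℝ-cong x≈y = ≈ᶜ-intro x≈y R.refl

  fromℝ-+ : ∀ x y → fromℝ (x R.+ y) ≈ fromℝ x + fromℝ y
  fromℝ-+ x y = ≈ᶜ-intro (R.reflexive (≡.sym (re-+ (fromℝ x) (fromℝ y))))
    (R.trans (R.sym (R.+-identityʳ R.0#)) (R.reflexive (≡.sym (im-+ (fromℝ x) (fromℝ y)))))

  fromℝ-neg : ∀ x → fromℝ (R.- x) ≈ - fromℝ x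
  fromℝ-neg x = ≈ᶜ-intro (R.reflexive (≡.sym (re-neg (fromℝ x))))
    (R.trans (R.solve 0 (R.:0 R.:= R.:- R.:0) R.refl) (R.reflexive (≡.sym (im-neg (fromℝ x)))))

  fromℝ-* : ∀ x y → fromℝ (x R.* y) ≈ fromℝ x * fromℝ y
  fromℝ-* x y = ≈ᶜ-intro
    (R.trans (R.solve 2 (λ x y → x R.:* y R.:= x R.:* y R.:- R.:0 R.:* R.:0) R.refl x y)
             (R.reflexive (≡.sym (re-* (fromℝ x) (fromℝ y)))))
    (R.trans (R.solve 2 (λ x y → R.:0 R.:= x R.:* R.:0 R.:+ R.:0 R.:* y) R.refl x y)
             (R.reflexive (≡.sym (im-* (fromℝ x) (fromℝ y)))))

  fromℝ-0 : fromℝ R.0# ≈ 0#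
  fromℝ-0 = reflexive (≡.sym 0ᶜ≡)

  fromℝ-1 : fromℝ R.1# ≈ 1#
  fromℝ-1 = reflexive (≡.sym 1ᶜ≡)

  fromℝ-fromℕ : ∀ n → fromℝ (R.fromℕ n) ≈ fromℕ n
  fromℝ-fromℕ zero    = fromℝ-0
  fromℝ-fromℕ (suc n) = trans (fromℝ-+ R.1# (R.fromℕ n)) (+-cong fromℝ-1 (fromℝ-fromℕ n))

  fromℝ-^ : ∀ x n → fromℝ (x R.^ n) ≈ fromℝ x ^ n
  fromℝ-^ x zero    = fromℝ-1
  fromℝ-^ x (suc n) = trans (fromℝ-* x _) (*-congˡ (fromℝ-^ x n))

  fromℝ-injective : ∀ {x y} → fromℝ x ≈ fromℝ y → x R.≈ y
  fromℝ-injective = re-cong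

  𝕚²≈-1 : 𝕚 * 𝕚 ≈ - 1#
  𝕚²≈-1 = ≈ᶜ-intro
    (R.trans (R.reflexive (re-* 𝕚 𝕚)) (R.trans
      (R.solve 0 (R.:0 R.:* R.:0 R.:- R.:1 R.:* R.:1 R.:= R.:- R.:1) R.refl)
      (R.reflexive (≡.sym (≡.trans (re-neg 1#) (≡.cong (λ z → R.- re z) 1ᶜ≡))))))
    (R.trans (R.reflexive (im-* 𝕚 𝕚)) (R.trans
      (R.solve 0 (R.:0 R.:* R.:1 R.:+ R.:1 R.:* R.:0 R.:= R.:- R.:0) R.refl)
      (R.reflexive (≡.sym (≡.trans (im-neg 1#) (≡.cong (λ z → R.- im z) 1ᶜ≡))))))

  cartesian : ∀ z → z ≈ fromℝ (re z) + 𝕚 * fromℝ (im z)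
  cartesian z = ≈ᶜ-intro
    (R.sym (R.trans (R.reflexive (≡.trans (re-+ _ _) (≡.cong (re z R.+_) (re-* 𝕚 (fromℝ (im z))))))
      (R.solve 2 (λ x y → x R.:+ (R.:0 R.:* y R.:- R.:1 R.:* R.:0) R.:= x) R.refl (re z) (im z))))
    (R.sym (R.trans (R.reflexive (≡.trans (im-+ _ _) (≡.cong (R.0# R.+_) (im-* 𝕚 (fromℝ (im z))))))
      (R.solve 1 (λ y → R.:0 R.:+ (R.:0 R.:* R.:0 R.:+ R.:1 R.:* y) R.:= y) R.refl (im z))))

  conj : ℂ → ℂ
  conj (x , y) = x , R.- y

  conj-cong : ∀ {z w} → z ≈ w → conj z ≈ conj w
  conj-cong z≈w = ≈ᶜ-intro (re-cong z≈w) (R.-‿cong (im-cong z≈w))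

  conj-* : ∀ z w → conj (z * w) ≈ conj z * conj w
  conj-* z w = ≈ᶜ-intro
    (R.trans (R.reflexive (re-* z w)) (R.trans
      (R.solve 4 (λ x y x′ y′ → x R.:* x′ R.:- y R.:* y′ R.:= x R.:* x′ R.:- (R.:- y) R.:* (R.:- y′))
        R.refl (re z) (im z) (re w) (im w))
      (R.reflexive (≡.sym (re-* (conj z) (conj w))))))
    (R.trans (R.-‿cong (R.reflexive (im-* z w))) (R.trans
      (R.solve 4 (λ x y x′ y′ → R.:- (x R.:* y′ R.:+ y R.:* x′) R.:= x R.:* (R.:- y′) R.:+ (R.:- y) R.:* x′)
        R.refl (re z) (im z) (re w) (im w))
      (R.reflexive (≡.sym (im-* (conj z) (conj w))))))

  conj-+ : ∀ z w → conj (z + w) ≈ conj z + conj w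
  conj-+ z w = ≈ᶜ-intro
    (R.reflexive (≡.trans (re-+ z w) (≡.sym (re-+ (conj z) (conj w)))))
    (R.trans (R.-‿cong (R.reflexive (im-+ z w))) (R.trans
      (R.solve 2 (λ y y′ → R.:- (y R.:+ y′) R.:= (R.:- y) R.:+ (R.:- y′)) R.refl (im z) (im w))
      (R.reflexive (≡.sym (im-+ (conj z) (conj w))))))

  conj-1 : conj 1# ≈ 1#
  conj-1 = ≈ᶜ-intro R.refl (R.trans (R.-‿cong (R.reflexive (≡.cong im 1ᶜ≡)))
    (R.trans (R.solve 0 (R.:- R.:0 R.:= R.:0) R.refl) (R.reflexive (≡.sym (≡.cong im 1ᶜ≡)))))

  conj-^ : ∀ z n → conj (z ^ n) ≈ conj z ^ n
  conj-^ z zero    = conj-1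
  conj-^ z (suc n) = trans (conj-* z (z ^ n)) (*-congˡ (conj-^ z n))

  conj-real : ∀ z → im z R.≈ R.0# → conj z ≈ z
  conj-real z imz≈0 = ≈ᶜ-intro R.refl (R.trans (R.-‿cong imz≈0)
    (R.trans (R.solve 0 (R.:- R.:0 R.:= R.:0) R.refl) (R.sym imz≈0)))

  z-conj : ∀ z → z - conj z ≈ fromℕ 2 * 𝕚 * fromℝ (im z)
  z-conj z = begin
    z + - conj z
      ≈⟨ +-cong (cartesian z) (-‿cong (trans (cartesian (conj z)) (+-congˡ (*-congˡ (fromℝ-neg (im z)))))) ⟩
    (fromℝ (re z) + 𝕚 * fromℝ (im z)) - (fromℝ (re z) + 𝕚 * - fromℝ (im z))
      ≈⟨ solve 3 (λ x i y → (x :+ i :* y) :- (x :+ i :* (:- y)) := :fromℕ 2 :* i :* y) refl _ _ _ ⟩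
    fromℕ 2 * 𝕚 * fromℝ (im z) ∎

  ⁻¹ᶜ-cong : ∀ {z w} → z ≈ w → z ⁻¹ᶜ ≈ w ⁻¹ᶜ
  ⁻¹ᶜ-cong z≈w = ≈ᶜ-intro (R.*-cong (re-cong z≈w) N⁻¹) (R.*-cong (R.-‿cong (im-cong z≈w)) N⁻¹)
    where N⁻¹ = R.⁻¹-cong (R.+-cong (R.*-cong (re-cong z≈w) (re-cong z≈w)) (R.*-cong (im-cong z≈w) (im-cong z≈w)))

  ⁻¹ᶜ-inverseʳ : ∀ {z} → z ≉ 0# → z * z ⁻¹ᶜ ≈ 1#
  ⁻¹ᶜ-inverseʳ {z} z≉0 = ≈ᶜ-intro
    (R.trans (R.reflexive (re-* z (z ⁻¹ᶜ))) (R.trans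
      (R.solve 3 (λ x y n → x R.:* (x R.:* n) R.:- y R.:* ((R.:- y) R.:* n) R.:= (x R.:* x R.:+ y R.:* y) R.:* n)
        R.refl (re z) (im z) _)
      (R.trans (R.⁻¹-inverseʳ N≉0) (R.reflexive (≡.sym (≡.cong re 1ᶜ≡))))))
    (R.trans (R.reflexive (im-* z (z ⁻¹ᶜ))) (R.trans
      (R.solve 3 (λ x y n → x R.:* ((R.:- y) R.:* n) R.:+ y R.:* (x R.:* n) R.:= R.:0) R.refl (re z) (im z) _)
      (R.reflexive (≡.sym (≡.cong im 1ᶜ≡)))))
    where
    N≉0 : re z R.* re z R.+ im z R.* im z R.≉ R.0#
    N≉0 N≈0 with re z R.<.≟ R.0# | im z R.<.≟ R.0#
    ... | yes x≈0 | yes y≈0 =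
      z≉0 (trans (≈ᶜ-intro {z} {fromℝ R.0#} x≈0 y≈0) fromℝ-0)
    ... | no x≉0  | _       = R.>⇒≉ (R.<-≤-trans (R.x≉0⇒0<x*x x≉0)
      (R.≤-respˡ (R.+-identityʳ _) (R.+-mono-≤ R.≤.refl (R.0≤x*x (im z))))) N≈0
    ... | yes _   | no y≉0  = R.>⇒≉ (R.<-≤-trans (R.x≉0⇒0<x*x y≉0)
      (R.≤-respˡ (R.+-identityˡ _) (R.+-mono-≤ (R.0≤x*x (re z)) R.≤.refl))) N≈0

  *-cancelˡ : ∀ {x y z} → x ≉ 0# → x * y ≈ x * z → y ≈ z
  *-cancelˡ {x} {y} {z} x≉0 xy≈xz = trans (sym (unit y)) (trans (*-congˡ xy≈xz) (unit z))
    where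
    unit : ∀ y → x ⁻¹ᶜ * (x * y) ≈ y
    unit y = trans (sym (*-assoc _ _ _))
      (trans (*-congʳ (trans (*-comm _ _) (⁻¹ᶜ-inverseʳ x≉0))) (*-identityˡ y))

  *-≉0 : ∀ {x y} → x ≉ 0# → y ≉ 0# → x * y ≉ 0#
  *-≉0 x≉0 y≉0 xy≈0 = y≉0 (*-cancelˡ x≉0 (trans xy≈0 (sym (zeroʳ _))))

  1≉0 : 1# ≉ 0#
  1≉0 1≈0 = R.1≉0 (fromℝ-injective (trans fromℝ-1 (trans 1≈0 (sym fromℝ-0))))

  ^-≉0 : ∀ {x} n → x ≉ 0# → x ^ n ≉ 0#
  ^-≉0 zero    x≉0 = 1≉0
  ^-≉0 (suc n) x≉0 = *-≉0 x≉0 (^-≉0 n x≉0)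

  fromℝ-≉0 : ∀ {x} → x R.≉ R.0# → fromℝ x ≉ 0#
  fromℝ-≉0 x≉0 x≈0 = x≉0 (fromℝ-injective (trans x≈0 (sym fromℝ-0)))

  fromℕ≉0 : ∀ n → fromℕ (suc n) ≉ 0#
  fromℕ≉0 n n≈0 = fromℝ-≉0 (R.fromℕ≉0 n) (trans (fromℝ-fromℕ (suc n)) n≈0)

  fromℝ-⁻¹ : ∀ {x} → x R.≉ R.0# → fromℝ x ⁻¹ᶜ ≈ fromℝ (x R.⁻¹)
  fromℝ-⁻¹ {x} x≉0 = *-cancelˡ (fromℝ-≉0 x≉0) (begin
    fromℝ x * fromℝ x ⁻¹ᶜ ≈⟨ ⁻¹ᶜ-inverseʳ (fromℝ-≉0 x≉0) ⟩
    1# ≈⟨ fromℝ-1 ⟨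
    fromℝ R.1# ≈⟨ fromℝ-cong (R.⁻¹-inverseʳ x≉0) ⟨
    fromℝ (x R.* x R.⁻¹) ≈⟨ fromℝ-* x (x R.⁻¹) ⟩
    fromℝ x * fromℝ (x R.⁻¹) ∎)

-- The exponential series

module CauchyProduct (R : CommutativeRing c ℓ) where
  open CommutativeRing R hiding (_-_; zero)
  open RingNotation rawRing
  open FiniteSums R
  open Convolution R
  open Solver R
  open SetoidReasoning setoid

  -- The convolutions of index below n cover the triangle a + b < n, which the right-hand side sums
  -- row by row.
  ∑-conv : ∀ n u v → ∑< n (conv u v) ≈ ∑< n (λ a → u a * ∑< (n ∸ a) v)
  ∑-conv zero    u v = trans (∑-zero _) (sym (∑-zero _))
  ∑-conv (suc n) u v = begin
    ∑< (suc n) (conv u v)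
      ≈⟨ ∑-suc n _ ⟩
    u 0 * v 0 + ∑< n (λ k → u 0 * v (suc k) + conv (u ∘ suc) v k)
      ≈⟨ +-congˡ (trans (∑-+ n _ _) (+-cong (∑-*ˡ n (u 0) (v ∘ suc)) (∑-conv n (u ∘ suc) v))) ⟩
    u 0 * v 0 + (u 0 * ∑< n (v ∘ suc) + ∑< n (λ a → u (suc a) * ∑< (n ∸ a) v))
      ≈⟨ solve 4 (λ x y s t → x :* y :+ (x :* s :+ t) := x :* (y :+ s) :+ t) refl _ _ _ _ ⟩
    u 0 * (v 0 + ∑< n (v ∘ suc)) + ∑< n (λ a → u (suc a) * ∑< (n ∸ a) v)
      ≈⟨ +-congʳ (*-congˡ (∑-suc n v)) ⟨
    u 0 * ∑< (suc n) v + ∑< n (λ a → u (suc a) * ∑< (n ∸ a) v)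
      ≈⟨ ∑-suc n (λ a → u a * ∑< (suc n ∸ a) v) ⟨
    ∑< (suc n) (λ a → u a * ∑< (suc n ∸ a) v) ∎

  -- The part of the square a, b < n that lies outside the triangle, that is, with a + b ≥ n.
  excess : ℕ → (ℕ → Carrier) → (ℕ → Carrier) → Carrier
  excess n u v = ∑< n λ a → u a * ∑< a (λ j → v (n ∸ a ℕ.+ j))

  ∑-*-∑ : ∀ n u v → ∑< n u * ∑< n v ≈ ∑< n (conv u v) + excess n u v
  ∑-*-∑ n u v = begin
    ∑< n u * ∑< n v ≈⟨ ∑-*ʳ n u _ ⟨
    ∑< n (λ a → u a * ∑< n v) ≈⟨ ∑-cong n (λ a a<n → trans (*-congˡ (split a (ℕ.<⇒≤ a<n))) (distribˡ _ _ _)) ⟩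
    ∑< n (λ a → u a * ∑< (n ∸ a) v + u a * ∑< a (λ j → v (n ∸ a ℕ.+ j))) ≈⟨ ∑-+ n _ _ ⟩
    ∑< n (λ a → u a * ∑< (n ∸ a) v) + excess n u v ≈⟨ +-congʳ (∑-conv n u v) ⟨
    ∑< n (conv u v) + excess n u v ∎
    where
    split : ∀ a → a ℕ.≤ n → ∑< n v ≈ ∑< (n ∸ a) v + ∑< a (λ j → v (n ∸ a ℕ.+ j))
    split a a≤n = begin
      ∑< n v ≡⟨ ≡.cong (λ k → ∑< k v) (ℕ.m∸n+n≡m a≤n) ⟨
      ∑< (n ∸ a ℕ.+ a) v ≈⟨ ∑-++ (n ∸ a) a v ⟩
      ∑< (n ∸ a) v + ∑< a (λ j → v (n ∸ a ℕ.+ j)) ∎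

  -- The operator x d/dx multiplies coefficient k by k, and it is a derivation of power series.
  euler-conv : ∀ f g k → fromℕ k * conv f g k ≈
               conv (λ i → fromℕ i * f i) g k + conv f (λ i → fromℕ i * g i) k
  euler-conv f g zero    = solve 2 (λ x y → :0 :* (x :* y) := (:0 :* x) :* y :+ x :* (:0 :* y)) refl _ _
  euler-conv f g (suc k) = begin
    fromℕ (suc k) * (f 0 * g (suc k) + conv (f ∘ suc) g k)
      ≈⟨ solve 4 (λ n x y z → (:1 :+ n) :* (x :* y :+ z) := (:0 :* x) :* y :+ (n :* z :+ z) :+ x :* ((:1 :+ n) :* y)) refl _ _ _ _ ⟩
    (0# * f 0) * g (suc k) + (fromℕ k * conv (f ∘ suc) g k + conv (f ∘ suc) g k) + f 0 * (fromℕ (suc k) * g (suc k))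
      ≈⟨ +-congʳ (+-congˡ (+-congʳ (euler-conv (f ∘ suc) g k))) ⟩
    (0# * f 0) * g (suc k) + (A + B + conv (f ∘ suc) g k) + f 0 * (fromℕ (suc k) * g (suc k))
      ≈⟨ solve 5 (λ x a b c y → x :+ (a :+ b :+ c) :+ y := x :+ (c :+ a) :+ (y :+ b)) refl _ A B _ _ ⟩
    (0# * f 0) * g (suc k) + (conv (f ∘ suc) g k + A) + (f 0 * (fromℕ (suc k) * g (suc k)) + B)
      ≈⟨ +-congʳ (+-congˡ (conv-+ˡ (f ∘ suc) (λ i → fromℕ i * f (suc i)) g k)) ⟨
    (0# * f 0) * g (suc k) + conv (λ i → f (suc i) + fromℕ i * f (suc i)) g k +
    (f 0 * (fromℕ (suc k) * g (suc k)) + B)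
      ≈⟨ +-congʳ (+-congˡ (conv-cong (λ i → solve 2 (λ x n → x :+ n :* x := (:1 :+ n) :* x) refl _ _) (λ _ → refl) k)) ⟩
    (0# * f 0) * g (suc k) + conv (λ i → fromℕ (suc i) * f (suc i)) g k +
    (f 0 * (fromℕ (suc k) * g (suc k)) + B) ∎
    where
    A B : Carrier
    A = conv (λ i → fromℕ i * f (suc i)) g k
    B = conv (f ∘ suc) (λ i → fromℕ i * g i) k

  delay : (ℕ → Carrier) → ℕ → Carrier
  delay f zero    = 0#
  delay f (suc k) = f k

  conv-delay : ∀ f g k → conv (delay f) g (suc k) ≈ conv f g k
  conv-delay f g k = trans (+-congʳ (zeroˡ _)) (+-identityˡ _)

module ExponentialSeries (ℝ : Reals) where
  private
    module ℂ where
      open ComplexField ℝ public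
      open CommutativeRing complexRing public hiding (_-_; zero)
      open RingNotation rawRing public
      open FiniteSums complexRing public
      open Convolution complexRing public
      open CauchyProduct complexRing public
      open Solver complexRing public
  open ComplexField ℝ using (𝕚; fromℝ; re; im)
  open Reals ℝ hiding (_-_; zero)
  open RingNotation rawRing
  open FiniteSums commutativeRing
  open Convolution commutativeRing
  open CauchyProduct commutativeRing
  open RealField ℝ
  open Sine ℝ
  open Solver commutativeRing
  open SetoidReasoning setoid

  term : Carrier → ℕ → Carrier
  term x k = x ^ k * fromℕ (k !) ⁻¹

  factorial≉0 : ∀ k → fromℕ (k !) ≉ 0#
  factorial≉0 zero    = fromℕ≉0 0
  factorial≉0 (suc k) k!≈0 = *-≉0 (fromℕ≉0 k) (factorial≉0 k)
    (trans (sym (SemiringMultProperties.×1-homo-* semiring (suc k) (k !))) k!≈0)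

  term-zero : ∀ x → term x 0 ≈ 1#
  term-zero x = trans (*-identityˡ _) (sym (⁻¹-unique (trans (*-identityʳ _) (+-identityʳ 1#))))

  term-suc : ∀ x k → fromℕ (suc k) * term x (suc k) ≈ x * term x k
  term-suc x k = begin
    fromℕ (suc k) * (x * x ^ k * fromℕ (suc k !) ⁻¹)
      ≈⟨ solve 4 (λ n x p i → n :* (x :* p :* i) := x :* (p :* (n :* i))) refl _ _ _ _ ⟩
    x * (x ^ k * (fromℕ (suc k) * fromℕ (suc k !) ⁻¹))
      ≈⟨ *-congˡ (*-congˡ (⁻¹-unique (begin
           fromℕ (k !) * (fromℕ (suc k) * fromℕ (suc k !) ⁻¹)
             ≈⟨ solve 3 (λ f n i → f :* (n :* i) := (n :* f) :* i) refl _ _ _ ⟩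
           fromℕ (suc k) * fromℕ (k !) * fromℕ (suc k !) ⁻¹
             ≈⟨ *-congʳ (SemiringMultProperties.×1-homo-* semiring (suc k) (k !)) ⟨
           fromℕ (suc k !) * fromℕ (suc k !) ⁻¹
             ≈⟨ ⁻¹-inverseʳ (factorial≉0 (suc k)) ⟩
           1# ∎))) ⟩
    x * (x ^ k * fromℕ (k !) ⁻¹) ∎

  term-cong : ∀ {x y} → x ≈ y → ∀ k → term x k ≈ term y k
  term-cong x≈y k = *-congʳ (Exp.^-congˡ semiring k x≈y)

  term-bounded : ∀ {X x} → Bounded X x → ∀ k → Bounded (term X k) (term x k)
  term-bounded {X} {x} b k = bounded-* (power k) (bounded-nonneg (<⇒≤ (0<⁻¹ (0<factorial k))))
    where
    0<factorial : ∀ k → 0# < fromℕ (k !)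
    0<factorial zero    = 0<fromℕ 0
    0<factorial (suc k) = <-respʳ (sym (SemiringMultProperties.×1-homo-* semiring (suc k) (k !)))
      (*-pos (0<fromℕ k) (0<factorial k))

    power : ∀ k → Bounded (X ^ k) (x ^ k)
    power zero    = bounded-nonneg (<⇒≤ 0<1)
    power (suc k) = bounded-* b (power k)

  bounded⇒0≤ : ∀ {X x} → Bounded X x → 0# ≤ X
  bounded⇒0≤ {X} (l , u) = 0≤2x⇒0≤x
    (≤-respʳ (solve 1 (λ X → X :- :- X := X :+ X) refl X) (x≤y⇒0≤y-x (≤.trans l u)))

  0≤term : ∀ {X} → 0# ≤ X → ∀ k → 0# ≤ term X k
  0≤term 0≤X k = bounded⇒0≤ (term-bounded (bounded-nonneg 0≤X) k)

  -- The binomial theorem without binomial coefficients. The terms are determined by (k + 1) tₖ₊₁ =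
  -- x tₖ, and by the product rule `euler-conv` the convolution satisfies this recursion with x + y.
  conv-term : ∀ x y k → conv (term x) (term y) k ≈ term (x + y) k
  conv-term x y zero    = trans (*-cong (term-zero x) (term-zero y))
    (trans (*-identityˡ 1#) (sym (term-zero (x + y))))
  conv-term x y (suc k) = *-cancelˡ (fromℕ≉0 k) (begin
    fromℕ (suc k) * conv (term x) (term y) (suc k)
      ≈⟨ euler-conv (term x) (term y) (suc k) ⟩
    conv (λ i → fromℕ i * term x i) (term y) (suc k) + conv (term x) (λ i → fromℕ i * term y i) (suc k)
      ≈⟨ +-cong (factor x y) (trans (conv-comm (term x) (λ i → fromℕ i * term y i) (suc k))
                                    (trans (factor y x) (*-congˡ (conv-comm (term y) (term x) k)))) ⟩
    x * conv (term x) (term y) k + y * conv (term x) (term y) k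
      ≈⟨ distribʳ _ _ _ ⟨
    (x + y) * conv (term x) (term y) k
      ≈⟨ *-congˡ (conv-term x y k) ⟩
    (x + y) * term (x + y) k
      ≈⟨ term-suc (x + y) k ⟨
    fromℕ (suc k) * term (x + y) (suc k) ∎)
    where
    euler : ∀ z i → fromℕ i * term z i ≈ z * delay (term z) i
    euler z zero    = trans (zeroˡ _) (sym (zeroʳ z))
    euler z (suc i) = term-suc z i

    factor : ∀ z w → conv (λ i → fromℕ i * term z i) (term w) (suc k) ≈ z * conv (term z) (term w) k
    factor z w = begin
      conv (λ i → fromℕ i * term z i) (term w) (suc k) ≈⟨ conv-cong (euler z) (λ _ → refl) (suc k) ⟩
      conv (λ i → z * delay (term z) i) (term w) (suc k) ≈⟨ conv-*ˡ z (delay (term z)) (term w) (suc k) ⟩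
      z * conv (delay (term z)) (term w) (suc k) ≈⟨ *-congˡ (conv-delay (term z) (term w) k) ⟩
      z * conv (term z) (term w) k ∎

  module _ {X : Carrier} (0≤X : 0# ≤ X) where
    tail : ℕ → ℕ → Carrier
    tail p q = ∑< q (λ j → term X (p ℕ.+ j))

    private
      term-halves : ∀ k → X + X ≤ fromℕ (suc k) → term X (suc k) + term X (suc k) ≤ term X k
      term-halves k 2X≤k = *-cancelˡ-≤ (fromℕ (suc k)) (0<fromℕ k)
        (≤-respˡ (trans (solve 2 (λ X t → (X :+ X) :* t := X :* t :+ X :* t) refl X (term X k))
                 (trans (sym (+-cong (term-suc X k) (term-suc X k))) (sym (distribˡ _ _ _))))
          (*-mono-≤ (0≤+ 0≤X 0≤X) (0≤term 0≤X k) 2X≤k ≤.refl))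

      -- Once the terms at least halve at each step, a geometric majorant bounds any stretch by
      -- twice its first term.
      tail-bound : ∀ q p → X + X ≤ fromℕ (suc p) → tail p q ≤ term X p + term X p
      tail-bound zero    p 2X≤p = ≤-respˡ (sym (∑-zero _)) (0≤+ (0≤term 0≤X p) (0≤term 0≤X p))
      tail-bound (suc q) p 2X≤p = ≤-respˡ (sym (trans (∑-suc q _)
          (+-cong (reflexive (≡.cong (term X) (ℕ.+-identityʳ p)))
                  (∑-cong q λ j _ → reflexive (≡.cong (term X) (ℕ.+-suc p j))))))
        (+-mono-≤ ≤.refl (≤.trans (tail-bound q (suc p) (≤.trans 2X≤p (fromℕ-mono (ℕ.n≤1+n (suc p)))))
                                  (term-halves p 2X≤p)))

      -- Halving gives (j + 2) tⱼ₊₁ ≤ 2 (j + 1) tⱼ₊₁ ≤ (j + 1) tⱼ. Decay like 1/(j + 1) is weaker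
      -- than geometric decay, but the Archimedean property applies to it directly.
      term-decay : ∀ K → X + X ≤ fromℕ K → ∀ j → fromℕ (suc j) * term X (K ℕ.+ j) ≤ term X K
      term-decay K 2X≤K zero    = ≤.reflexive (trans (*-congʳ (+-identityʳ 1#))
        (trans (*-identityˡ _) (reflexive (≡.cong (term X) (ℕ.+-identityʳ K)))))
      term-decay K 2X≤K (suc j) rewrite ℕ.+-suc K j = ≤.trans (≤.trans
        (0≤y-x⇒x≤y (≤-respʳ
          (solve 2 (λ n t → n :* t := (:1 :+ n) :* (t :+ t) :- (:1 :+ (:1 :+ n)) :* t) refl (fromℕ j) t′)
          (0≤* (0≤fromℕ j) (0≤term 0≤X (suc (K ℕ.+ j))))))
        (*-monoˡ-≤ (fromℕ (suc j)) (0≤fromℕ (suc j))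
          (term-halves (K ℕ.+ j) (≤.trans 2X≤K (fromℕ-mono (ℕ.m≤n⇒m≤1+n (ℕ.m≤m+n K j)))))))
        (term-decay K 2X≤K j)
        where
        t′ : Carrier
        t′ = term X (suc (K ℕ.+ j))

    null-tail : Null λ n → tail n n
    null-tail ε 0<ε ¬small =
      -- From K on the terms halve; n₀ then makes the bound 2 t_K / (j + 1) smaller than ε.
      archimedean (X + X) 1# 0<1 λ (K , 2X<K′) →
      let 2X≤K = ≤-respʳ (*-identityʳ (fromℕ K)) (<⇒≤ 2X<K′) in
      archimedean (term X K + term X K) ε 0<ε λ (n₀ , 2t<n₀ε) →
      ¬small (K ℕ.+ n₀ , λ n K+n₀≤n → small K 2X≤K n₀ 2t<n₀ε n (ℕ.m≤n⇒∃[o]m+o≡n K+n₀≤n))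
      where
      small : ∀ K → X + X ≤ fromℕ K → ∀ n₀ → term X K + term X K < fromℕ n₀ * ε →
              ∀ n → (∃ λ o → K ℕ.+ n₀ ℕ.+ o ≡ n) → Bounded ε (tail n n)
      small K 2X≤K n₀ 2t<n₀ε n (o , eq) = bounded-≤ tail≤ε (bounded-nonneg (0≤∑ n λ j _ → 0≤term 0≤X (n ℕ.+ j)))
        where
        j : ℕ
        j = n₀ ℕ.+ o

        K+j≡n : K ℕ.+ j ≡ n
        K+j≡n = ≡.trans (≡.sym (ℕ.+-assoc K n₀ o)) eq

        tail≤ε : tail n n ≤ ε
        tail≤ε = ≤.trans
          (tail-bound n n (≤.trans 2X≤K (fromℕ-mono (ℕ.m≤n⇒m≤1+n (≡.subst (K ℕ.≤_) K+j≡n (ℕ.m≤m+n K j))))))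
          (*-cancelˡ-≤ (fromℕ (suc j)) (0<fromℕ j) (≤.trans
            (≤-respˡ (trans (sym (distribˡ _ _ _)) (reflexive (≡.cong (λ n → fromℕ (suc j) * (term X n + term X n)) K+j≡n)))
              (+-mono-≤ (term-decay K 2X≤K j) (term-decay K 2X≤K j)))
            (≤.trans (<⇒≤ 2t<n₀ε) (*-mono-≤ (0≤fromℕ n₀) (<⇒≤ 0<ε)
              (fromℕ-mono (ℕ.m≤n⇒m≤1+n (ℕ.m≤m+n n₀ o))) ≤.refl))))

  -- The square a, b < n is contained in the triangle a + b < 2n. As all terms are nonnegative, the
  -- product of the partial sums of length n is at most the partial sum of length 2n for X + Y;
  -- subtracting the triangle a + b < n from both leaves the claim.
  excess-term≤tail : ∀ {X Y} → 0# ≤ X → (0≤Y : 0# ≤ Y) → (0≤X+Y : 0# ≤ X + Y) → ∀ n →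
                     excess n (term X) (term Y) ≤ tail 0≤X+Y n n
  excess-term≤tail {X} {Y} 0≤X 0≤Y 0≤X+Y n = 0≤y-x⇒x≤y (≤-respʳ
      (begin
        s₂ - u * v
          ≈⟨ +-cong (∑-cong (n ℕ.+ n) λ k _ → conv-term X Y k) (-‿cong (∑-*-∑ n (term X) (term Y))) ⟩
        ∑< (n ℕ.+ n) (term (X + Y)) - (∑< n (conv (term X) (term Y)) + excess n (term X) (term Y))
          ≈⟨ +-cong (∑-++ n n _) (-‿cong (+-congʳ (∑-cong n λ k _ → conv-term X Y k))) ⟩
        (∑< n (term (X + Y)) + tail 0≤X+Y n n) - (∑< n (term (X + Y)) + excess n (term X) (term Y))
          ≈⟨ solve 3 (λ s t e → (s :+ t) :- (s :+ e) := t :- e) refl _ _ _ ⟩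
        tail 0≤X+Y n n - excess n (term X) (term Y) ∎)
      (x≤y⇒0≤y-x product≤))
    where
    u v s₂ : Carrier
    u  = ∑< n (term X)
    v  = ∑< n (term Y)
    s₂ = ∑< (n ℕ.+ n) (conv (term X) (term Y))

    0≤∑Y : ∀ k → 0# ≤ ∑< k (term Y)
    0≤∑Y k = 0≤∑ k λ j _ → 0≤term 0≤Y j

    product≤ : u * v ≤ s₂
    product≤ = ≤-respˡ (∑-*ʳ n (term X) v)
      (≤-respʳ (sym (trans (∑-conv (n ℕ.+ n) (term X) (term Y)) (∑-++ n n _)))
        (≤-respˡ (+-identityʳ _) (+-mono-≤
          (∑-mono-≤ n λ a a<n → *-monoˡ-≤ (term X a) (0≤term 0≤X a) (v≤ a (ℕ.<⇒≤ a<n)))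
          (0≤∑ n λ a _ → 0≤* (0≤term 0≤X (n ℕ.+ a)) (0≤∑Y (n ℕ.+ n ∸ (n ℕ.+ a)))))))
      where
      v≤ : ∀ a → a ℕ.≤ n → v ≤ ∑< (n ℕ.+ n ∸ a) (term Y)
      v≤ a a≤n = ≤-respʳ (trans (sym (∑-++ n (n ∸ a) (term Y)))
                                (reflexive (≡.cong (λ k → ∑< k (term Y)) (≡.sym (ℕ.+-∸-assoc n a≤n)))))
        (≤-respˡ (+-identityʳ v) (+-mono-≤ ≤.refl (0≤∑ (n ∸ a) λ j _ → 0≤term 0≤Y (n ℕ.+ j))))

  -- Componentwise bounds replace the modulus. They suffice because the terms of the series are real
  -- multiples of powers of i, and multiplication by i merely exchanges the components up to sign.
  Boundedᶜ : Carrier → Carrier × Carrier → Set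
  Boundedᶜ X z = Bounded X (re z) × Bounded X (im z)

  boundedᶜ-cong : ∀ {X z w} → z ℂ.≈ w → Boundedᶜ X z → Boundedᶜ X w
  boundedᶜ-cong z≈w (b , b′) = bounded-cong refl (ℂ.re-cong z≈w) b , bounded-cong refl (ℂ.im-cong z≈w) b′

  boundedᶜ-+ : ∀ {X Y z w} → Boundedᶜ X z → Boundedᶜ Y w → Boundedᶜ (X + Y) (z ℂ.+ w)
  boundedᶜ-+ {z = z} {w} (bx , by) (bx′ , by′) =
      bounded-cong refl (reflexive (≡.sym (ℂ.re-+ z w))) (bounded-+ bx bx′)
    , bounded-cong refl (reflexive (≡.sym (ℂ.im-+ z w))) (bounded-+ by by′)

  boundedᶜ-0 : Boundedᶜ 0# ℂ.0#
  boundedᶜ-0 = boundedᶜ-cong ℂ.fromℝ-0 (bounded-0 ≤.refl , bounded-0 ≤.refl)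

  boundedᶜ-∑ : ∀ n {F f} → (∀ k → k ℕ.< n → Boundedᶜ (F k) (f k)) → Boundedᶜ (∑< n F) (ℂ.∑< n f)
  boundedᶜ-∑ zero    {F} {f} _ = boundedᶜ-cong (ℂ.sym (ℂ.∑-zero f))
    (bounded-cong (sym (∑-zero F)) refl (proj₁ boundedᶜ-0) , bounded-cong (sym (∑-zero F)) refl (proj₂ boundedᶜ-0))
  boundedᶜ-∑ (suc n) {F} {f} b = boundedᶜ-cong (ℂ.sym (ℂ.∑-suc n f))
    (bounded-cong (sym (∑-suc n F)) refl (proj₁ step) , bounded-cong (sym (∑-suc n F)) refl (proj₂ step))
    where
    step : Boundedᶜ (F 0 + ∑< n (F ∘ suc)) (f 0 ℂ.+ ℂ.∑< n (f ∘ suc))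
    step = boundedᶜ-+ (b 0 (s≤s z≤n)) (boundedᶜ-∑ n λ k k<n → b (suc k) (s≤s k<n))

  boundedᶜ-𝕚^ : ∀ {X z} k → Boundedᶜ X z → Boundedᶜ X (𝕚 ℂ.^ k ℂ.* z)
  boundedᶜ-𝕚^ {z = z} zero    b = boundedᶜ-cong (ℂ.sym (ℂ.*-identityˡ z)) b
  boundedᶜ-𝕚^ {X} {z} (suc k) b = boundedᶜ-cong (ℂ.sym (ℂ.*-assoc 𝕚 (𝕚 ℂ.^ k) z)) (rotate (boundedᶜ-𝕚^ k b))
    where
    rotate : ∀ {w} → Boundedᶜ X w → Boundedᶜ X (𝕚 ℂ.* w)
    rotate {w} (bx , by) =
        bounded-cong refl (trans (solve 2 (λ x y → :- y := :0 :* x :- :1 :* y) refl (re w) (im w))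
                                 (reflexive (≡.sym (ℂ.re-* 𝕚 w)))) (bounded-neg by)
      , bounded-cong refl (trans (solve 2 (λ x y → x := :0 :* y :+ :1 :* x) refl (re w) (im w))
                                 (reflexive (≡.sym (ℂ.im-* 𝕚 w)))) bx

  boundedᶜ-fromℝ* : ∀ {X Y x w} → Bounded X x → Boundedᶜ Y w → Boundedᶜ (X * Y) (fromℝ x ℂ.* w)
  boundedᶜ-fromℝ* {x = x} {w} bx (b , b′) =
      bounded-cong refl (trans (solve 3 (λ x u v → x :* u := x :* u :- :0 :* v) refl x (re w) (im w))
                               (reflexive (≡.sym (ℂ.re-* (fromℝ x) w)))) (bounded-* bx b)
    , bounded-cong refl (trans (solve 3 (λ x u v → x :* v := x :* v :+ :0 :* u) refl x (re w) (im w))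
                               (reflexive (≡.sym (ℂ.im-* (fromℝ x) w)))) (bounded-* bx b′)

  -- The k-th term (ix)ᵏ / k! of the series of exp (ix).
  expTerm : Carrier → ℕ → Carrier × Carrier
  expTerm x k = 𝕚 ℂ.^ k ℂ.* fromℝ (term x k)

  expSum : Carrier → ℕ → Carrier × Carrier
  expSum x n = ℂ.∑< n (expTerm x)

  conv-fromℝ : ∀ f g k → ℂ.conv (fromℝ ∘ f) (fromℝ ∘ g) k ℂ.≈ fromℝ (conv f g k)
  conv-fromℝ f g zero    = ℂ.sym (ℂ.fromℝ-* _ _)
  conv-fromℝ f g (suc k) =
    ℂ.trans (ℂ.+-cong (ℂ.sym (ℂ.fromℝ-* _ _)) (conv-fromℝ (f ∘ suc) g k)) (ℂ.sym (ℂ.fromℝ-+ _ _))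

  conv-powers : ∀ z f g k → ℂ.conv (λ i → z ℂ.^ i ℂ.* f i) (λ i → z ℂ.^ i ℂ.* g i) k ℂ.≈
                z ℂ.^ k ℂ.* ℂ.conv f g k
  conv-powers z f g zero    =
    ℂ.solve 2 (λ x y → (ℂ.:1 ℂ.:* x) ℂ.:* (ℂ.:1 ℂ.:* y) ℂ.:= ℂ.:1 ℂ.:* (x ℂ.:* y)) ℂ.refl _ _
  conv-powers z f g (suc k) = ℂ.trans
    (ℂ.+-congˡ (ℂ.trans (ℂ.conv-cong {g = λ i → z ℂ.^ i ℂ.* g i} (λ i → ℂ.*-assoc z (z ℂ.^ i) (f (suc i))) (λ _ → ℂ.refl) k)
      (ℂ.trans (ℂ.conv-*ˡ z (λ i → z ℂ.^ i ℂ.* f (suc i)) _ k) (ℂ.*-congˡ (conv-powers z (f ∘ suc) g k)))))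
    (ℂ.solve 5 (λ z p x y c → (ℂ.:1 ℂ.:* x) ℂ.:* (z ℂ.:* p ℂ.:* y) ℂ.:+ z ℂ.:* (p ℂ.:* c)
                              ℂ.:= z ℂ.:* p ℂ.:* (x ℂ.:* y ℂ.:+ c)) ℂ.refl z _ _ _ _)

  conv-expTerm : ∀ x y k → ℂ.conv (expTerm x) (expTerm y) k ℂ.≈ expTerm (x + y) k
  conv-expTerm x y k = ℂ.trans (conv-powers 𝕚 (fromℝ ∘ term x) (fromℝ ∘ term y) k)
    (ℂ.*-congˡ (ℂ.trans (conv-fromℝ (term x) (term y) k) (ℂ.fromℝ-cong (conv-term x y k))))

  expSum-* : ∀ x y n → expSum x n ℂ.* expSum y n ℂ.≈ expSum (x + y) n ℂ.+ ℂ.excess n (expTerm x) (expTerm y)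
  expSum-* x y n = ℂ.trans (ℂ.∑-*-∑ n (expTerm x) (expTerm y)) (ℂ.+-congʳ (ℂ.∑-cong n λ k _ → conv-expTerm x y k))

  excess-bounded : ∀ {X Y x y} → Bounded X x → Bounded Y y → ∀ n →
                   Boundedᶜ (excess n (term X) (term Y)) (ℂ.excess n (expTerm x) (expTerm y))
  excess-bounded {X} {Y} {x} {y} bx by n = boundedᶜ-∑ n λ a _ →
    boundedᶜ-cong (ℂ.sym (ℂ.*-assoc _ _ _)) (boundedᶜ-𝕚^ a (boundedᶜ-fromℝ* (term-bounded bx a)
      (boundedᶜ-∑ a λ j _ → boundedᶜ-𝕚^ (n ∸ a ℕ.+ j)
        (term-bounded by (n ∸ a ℕ.+ j) , bounded-0 (bounded⇒0≤ (term-bounded by (n ∸ a ℕ.+ j)))))))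

  null-excess : ∀ x y → Null (λ n → re (ℂ.excess n (expTerm x) (expTerm y))) ×
                        Null (λ n → im (ℂ.excess n (expTerm x) (expTerm y)))
  null-excess x y with magnitude x | magnitude y
  ... | X , 0≤X , bx | Y , 0≤Y , by =
      null-bounded (λ n → bounded-≤ (excess≤ n) (proj₁ (excess-bounded bx by n))) (null-tail 0≤X+Y)
    , null-bounded (λ n → bounded-≤ (excess≤ n) (proj₂ (excess-bounded bx by n))) (null-tail 0≤X+Y)
    where
    0≤X+Y : 0# ≤ X + Y
    0≤X+Y = 0≤+ 0≤X 0≤Y

    excess≤ : ∀ n → excess n (term X) (term Y) ≤ tail 0≤X+Y n n
    excess≤ = excess-term≤tail 0≤X 0≤Y 0≤X+Y

-- Sines from the exponential series

module Trigonometry (ℝ : Reals) where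
  private
    module ℂ where
      open ComplexField ℝ public
      open CommutativeRing complexRing public hiding (_-_; zero)
      open RingNotation rawRing public
      open FiniteSums complexRing public
      open CauchyProduct complexRing public
      open Solver complexRing public
  open ComplexField ℝ using (𝕚; fromℝ; re; im; conj)
  open Reals ℝ hiding (_-_; zero)
  open RingNotation rawRing
  open FiniteSums commutativeRing
  open RealField ℝ
  open ExponentialSeries ℝ
  open Sine ℝ
  open Solver commutativeRing
  open SetoidReasoning setoid

  private
    -- The sine series consists of the odd terms of exp (ix) only: its partial sum of length n is
    -- the imaginary part of the one of length 2n. All limits are therefore taken along even
    -- lengths.
    double : ℕ → ℕ
    double n = n ℕ.+ n

    n≤double : ∀ n → n ℕ.≤ double n
    n≤double n = ℕ.m≤m+n n n

  -- z is the limit of the series of exp (ix).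
  ExpLimit : Carrier → Carrier × Carrier → Set
  ExpLimit x z = (λ n → re (expSum x (double n))) ⟶ re z × (λ n → im (expSum x (double n))) ⟶ im z

  hasSum⇒⟶ : ∀ {f s} → HasSum f s → (λ n → ∑< n f) ⟶ s
  hasSum⇒⟶ {f} {s} hasSum ε 0<ε ¬b = let N , b = hasSum ε 0<ε in
    ¬b (N , λ n N≤n → bounded-cong refl (+-congʳ (sum≈∑ n f))
      (<⇒≤ (proj₁ (b n N≤n)) , <⇒≤ (proj₂ (b n N≤n))))

  ∑-double : ∀ n f → ℂ.∑< (double n) f ℂ.≈ ℂ.∑< n (λ k → f (double k) ℂ.+ f (suc (double k)))
  ∑-double zero    f = ℂ.trans (ℂ.∑-zero f) (ℂ.sym (ℂ.∑-zero _))
  ∑-double (suc n) f = ℂ.trans (ℂ.reflexive (≡.cong (λ k → ℂ.∑< k f) (≡.cong suc (ℕ.+-suc n n))))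
    (ℂ.trans (ℂ.∑-last (suc (double n)) f) (ℂ.trans (ℂ.+-congʳ (ℂ.∑-last (double n) f))
    (ℂ.trans (ℂ.+-assoc _ _ _) (ℂ.trans (ℂ.+-congʳ (∑-double n f))
    (ℂ.sym (ℂ.∑-last n λ k → f (double k) ℂ.+ f (suc (double k))))))))

  𝕚^double : ∀ k → 𝕚 ℂ.^ double k ℂ.≈ fromℝ ((- 1#) ^ k)
  𝕚^double zero    = ℂ.sym ℂ.fromℝ-1
  𝕚^double (suc k) = ℂ.trans (ℂ.reflexive (≡.cong (λ j → 𝕚 ℂ.* 𝕚 ℂ.^ j) (ℕ.+-suc k k)))
    (ℂ.trans (ℂ.sym (ℂ.*-assoc 𝕚 𝕚 _))
    (ℂ.trans (ℂ.*-cong (ℂ.trans ℂ.𝕚²≈-1 (ℂ.trans (ℂ.-‿cong (ℂ.sym ℂ.fromℝ-1)) (ℂ.sym (ℂ.fromℝ-neg 1#)))) (𝕚^double k))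
             (ℂ.sym (ℂ.fromℝ-* (- 1#) ((- 1#) ^ k)))))

  im-∑ : ∀ n f → im (ℂ.∑< n f) ≈ ∑< n (im ∘ f)
  im-∑ zero    f = trans (ℂ.im-cong (ℂ.trans (ℂ.∑-zero f) (ℂ.sym ℂ.fromℝ-0))) (sym (∑-zero _))
  im-∑ (suc n) f = trans (ℂ.im-cong (ℂ.∑-suc n f)) (trans (reflexive (ℂ.im-+ _ _))
    (trans (+-congˡ (im-∑ n (f ∘ suc))) (sym (∑-suc n _))))

  im-expSum : ∀ x n → im (expSum x (double n)) ≈ ∑< n (sineTerm x)
  im-expSum x n = trans (ℂ.im-cong (∑-double n (expTerm x))) (trans (im-∑ n _) (∑-cong n λ k _ → step k))
    where
    step : ∀ k → im (expTerm x (double k) ℂ.+ expTerm x (suc (double k))) ≈ sineTerm x k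
    step k = begin
      im (expTerm x (double k) ℂ.+ expTerm x (suc (double k)))
        ≈⟨ ℂ.im-cong (ℂ.+-cong even odd) ⟩
      im (fromℝ (σ * term x (double k)) ℂ.+ 𝕚 ℂ.* fromℝ (σ * t))
        ≡⟨ ≡.trans (ℂ.im-+ _ _) (≡.cong (0# +_) (ℂ.im-* 𝕚 (fromℝ (σ * t)))) ⟩
      0# + (0# * 0# + 1# * (σ * t))
        ≈⟨ solve 1 (λ y → :0 :+ (:0 :* :0 :+ :1 :* y) := y) refl _ ⟩
      σ * t
        ≈⟨ *-assoc _ _ _ ⟨
      σ * x ^ suc (double k) * fromℕ (suc (double k) !) ⁻¹
        ≡⟨ ≡.cong (λ j → σ * x ^ j * fromℕ (j !) ⁻¹)
             (≡.trans (≡.cong (λ j → suc (k ℕ.+ j)) (≡.sym (ℕ.+-identityʳ k))) (≡.sym (ℕ.+-comm (2 ℕ.* k) 1))) ⟩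
      sineTerm x k ∎
      where
      σ t : Carrier
      σ = (- 1#) ^ k
      t = term x (suc (double k))

      even : expTerm x (double k) ℂ.≈ fromℝ (σ * term x (double k))
      even = ℂ.trans (ℂ.*-congʳ (𝕚^double k)) (ℂ.sym (ℂ.fromℝ-* σ _))

      odd : expTerm x (suc (double k)) ℂ.≈ 𝕚 ℂ.* fromℝ (σ * t)
      odd = ℂ.trans (ℂ.*-congʳ (ℂ.*-congˡ (𝕚^double k)))
        (ℂ.trans (ℂ.*-assoc 𝕚 _ _) (ℂ.*-congˡ (ℂ.sym (ℂ.fromℝ-* σ t))))

  expLimit-cong : ∀ {x y z w} → x ≈ y → z ℂ.≈ w → ExpLimit x z → ExpLimit y w
  expLimit-cong {x} {y} x≈y z≈w (c , s) =
      ⟶-cong (ℂ.re-cong ∘ same) (ℂ.re-cong z≈w) c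
    , ⟶-cong (ℂ.im-cong ∘ same) (ℂ.im-cong z≈w) s
    where
    same : ∀ n → expSum x (double n) ℂ.≈ expSum y (double n)
    same n = ℂ.∑-cong (double n) λ k _ → ℂ.*-congˡ (ℂ.fromℝ-cong (term-cong x≈y k))

  expLimit-unique : ∀ {x z w} → ExpLimit x z → ExpLimit x w → z ℂ.≈ w
  expLimit-unique (c , s) (c′ , s′) = ℂ.≈ᶜ-intro (⟶-unique c c′) (⟶-unique s s′)

  expLimit-+ : ∀ {x y z w} → ExpLimit x z → ExpLimit y w → ExpLimit (x + y) (z ℂ.* w)
  expLimit-+ {x} {y} {z} {w} (cx , sx) (cy , sy) =
      ⟶-cong (λ _ → refl) (reflexive (≡.sym (ℂ.re-* z w)))
        (⟶-+null (⟶-+ (⟶-* cx cy) (⟶-neg (⟶-* sx sy)))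
          (null-cong (λ n → re-excess (double n)) (null-neg (null-subsequence double n≤double (proj₁ (null-excess x y))))))
    , ⟶-cong (λ _ → refl) (reflexive (≡.sym (ℂ.im-* z w)))
        (⟶-+null (⟶-+ (⟶-* cx sy) (⟶-* sx cy))
          (null-cong (λ n → im-excess (double n)) (null-neg (null-subsequence double n≤double (proj₂ (null-excess x y))))))
    where
    e : ℕ → Carrier × Carrier
    e n = ℂ.excess n (expTerm x) (expTerm y)

    re-excess : ∀ n → - re (e n) ≈ re (expSum (x + y) n) -
                (re (expSum x n) * re (expSum y n) - im (expSum x n) * im (expSum y n))
    re-excess n = begin
      - re (e n)
        ≈⟨ solve 2 (λ a b → :- b := a :- (a :+ b)) refl (re (expSum (x + y) n)) _ ⟩
      re (expSum (x + y) n) - (re (expSum (x + y) n) + re (e n))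
        ≈⟨ +-congˡ (-‿cong (trans (reflexive (≡.sym (ℂ.re-+ _ _))) (trans (ℂ.re-cong (ℂ.sym (expSum-* x y n)))
             (reflexive (ℂ.re-* (expSum x n) (expSum y n)))))) ⟩
      re (expSum (x + y) n) - (re (expSum x n) * re (expSum y n) - im (expSum x n) * im (expSum y n)) ∎

    im-excess : ∀ n → - im (e n) ≈ im (expSum (x + y) n) -
                (re (expSum x n) * im (expSum y n) + im (expSum x n) * re (expSum y n))
    im-excess n = begin
      - im (e n)
        ≈⟨ solve 2 (λ a b → :- b := a :- (a :+ b)) refl (im (expSum (x + y) n)) _ ⟩
      im (expSum (x + y) n) - (im (expSum (x + y) n) + im (e n))
        ≈⟨ +-congˡ (-‿cong (trans (reflexive (≡.sym (ℂ.im-+ _ _))) (trans (ℂ.im-cong (ℂ.sym (expSum-* x y n)))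
             (reflexive (ℂ.im-* (expSum x n) (expSum y n)))))) ⟩
      im (expSum (x + y) n) - (re (expSum x n) * im (expSum y n) + im (expSum x n) * re (expSum y n)) ∎

  expLimit-0 : ExpLimit 0# ℂ.1#
  expLimit-0 = limit re ℂ.re-cong , limit im ℂ.im-cong
    where
    expTerm-suc≈0 : ∀ k → expTerm 0# (suc k) ℂ.≈ ℂ.0#
    expTerm-suc≈0 k = ℂ.trans (ℂ.*-congˡ (ℂ.trans (ℂ.fromℝ-cong
      (trans (*-congʳ (zeroˡ _)) (zeroˡ _))) ℂ.fromℝ-0)) (ℂ.zeroʳ _)

    expSum≈1 : ∀ n → expSum 0# (suc n) ℂ.≈ ℂ.1#
    expSum≈1 n = ℂ.trans (ℂ.∑-pick (suc n) 0 _ (s≤s z≤n) λ where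
        zero    _ 0≢0 → contradiction ≡.refl 0≢0
        (suc k) _ _   → expTerm-suc≈0 k)
      (ℂ.trans (ℂ.*-identityˡ _) (ℂ.trans (ℂ.fromℝ-cong (term-zero 0#)) ℂ.fromℝ-1))

    limit : (part : Carrier × Carrier → Carrier) → (∀ {z w} → z ℂ.≈ w → part z ≈ part w) →
            (λ n → part (expSum 0# (double n))) ⟶ part ℂ.1#
    limit part part-cong ε 0<ε ¬b = ¬b (1 , λ where
      (suc n) _ → bounded-cong refl
        (sym (trans (+-congʳ (part-cong (expSum≈1 (n ℕ.+ suc n)))) (-‿inverseʳ _))) (bounded-0 (<⇒≤ 0<ε)))

  conj-∑ : ∀ n f → conj (ℂ.∑< n f) ℂ.≈ ℂ.∑< n (conj ∘ f)
  conj-∑ zero    f = ℂ.trans (ℂ.conj-cong (ℂ.∑-zero f)) (ℂ.trans (ℂ.trans (ℂ.conj-cong (ℂ.sym ℂ.fromℝ-0))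
    (ℂ.trans (ℂ.conj-real (fromℝ 0#) refl) ℂ.fromℝ-0)) (ℂ.sym (ℂ.∑-zero _)))
  conj-∑ (suc n) f = ℂ.trans (ℂ.conj-cong (ℂ.∑-suc n f)) (ℂ.trans (ℂ.conj-+ _ _)
    (ℂ.trans (ℂ.+-congˡ (conj-∑ n (f ∘ suc))) (ℂ.sym (ℂ.∑-suc n _))))

  expTerm-neg : ∀ x k → expTerm (- x) k ℂ.≈ conj (expTerm x k)
  expTerm-neg x k = ℂ.trans (asPower (- x)) (ℂ.trans (ℂ.*-congʳ (ℂ.trans (Exp.^-congˡ ℂ.semiring k base) (ℂ.sym (ℂ.conj-^ _ k))))
    (ℂ.trans (ℂ.*-congˡ (ℂ.sym (ℂ.conj-real (fromℝ (fromℕ (k !) ⁻¹)) refl)))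
    (ℂ.trans (ℂ.sym (ℂ.conj-* _ _)) (ℂ.conj-cong (ℂ.sym (asPower x))))))
    where
    asPower : ∀ x → expTerm x k ℂ.≈ (𝕚 ℂ.* fromℝ x) ℂ.^ k ℂ.* fromℝ (fromℕ (k !) ⁻¹)
    asPower x = ℂ.trans (ℂ.*-congˡ (ℂ.trans (ℂ.fromℝ-* _ _) (ℂ.*-congʳ (ℂ.fromℝ-^ x k))))
      (ℂ.trans (ℂ.sym (ℂ.*-assoc _ _ _)) (ℂ.*-congʳ (ℂ.sym (CommutativeExp.^-distrib-* ℂ.commutativeSemiring 𝕚 (fromℝ x) k))))

    conj𝕚 : conj 𝕚 ℂ.≈ ℂ.- 𝕚
    conj𝕚 = ℂ.≈ᶜ-intro
      (trans (solve 0 (:0 := :- :0) refl) (reflexive (≡.sym (ℂ.re-neg 𝕚))))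
      (reflexive (≡.sym (ℂ.im-neg 𝕚)))

    base : 𝕚 ℂ.* fromℝ (- x) ℂ.≈ conj (𝕚 ℂ.* fromℝ x)
    base = ℂ.trans (ℂ.*-congˡ (ℂ.fromℝ-neg x)) (ℂ.trans
      (ℂ.solve 2 (λ i x → i ℂ.:* (ℂ.:- x) ℂ.:= (ℂ.:- i) ℂ.:* x) ℂ.refl 𝕚 (fromℝ x))
      (ℂ.trans (ℂ.*-cong (ℂ.sym conj𝕚) (ℂ.sym (ℂ.conj-real (fromℝ x) refl))) (ℂ.sym (ℂ.conj-* 𝕚 (fromℝ x)))))

  expLimit-neg : ∀ {x z} → ExpLimit x z → ExpLimit (- x) (conj z)
  expLimit-neg {x} {z} (c , s) =
      ⟶-cong (λ n → sym (ℂ.re-cong (expSum-neg (double n)))) refl c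
    , ⟶-cong (λ n → sym (ℂ.im-cong (expSum-neg (double n)))) refl (⟶-neg s)
    where
    expSum-neg : ∀ n → expSum (- x) n ℂ.≈ conj (expSum x n)
    expSum-neg n = ℂ.trans (ℂ.∑-cong n λ k _ → expTerm-neg x k) (ℂ.sym (conj-∑ n (expTerm x)))

  module _ {sin : Carrier → Carrier} (isSine : IsSine sin) where

    sin-limit : ∀ x → (λ n → im (expSum x (double n))) ⟶ sin x
    sin-limit x = ⟶-cong (λ n → sym (im-expSum x n)) refl (hasSum⇒⟶ (isSine x))

    -- No cosine is given: cos x is recovered from sin 2x = 2 sin x cos x.
    expLimit-exists : ∀ x → sin x ≉ 0# → Σ (Carrier × Carrier) (ExpLimit x)
    -- With S and C the imaginary and real parts of the partial sums, S (C - cos) is null and S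
    -- tends to sin x, which is nonzero; hence C - cos is null.
    expLimit-exists x sinx≉0 = (cos , sin x) , null-cancel sinx≉0 (sin-limit x) S[C-cos] , sin-limit x
      where
      ½ cos : Carrier
      ½   = (1# + 1#) ⁻¹
      cos = ½ * sin (x + x) * sin x ⁻¹

      S C : ℕ → Carrier
      S n = im (expSum x (double n))
      C n = re (expSum x (double n))

      2½≈1 : (1# + 1#) * ½ ≈ 1#
      2½≈1 = ⁻¹-inverseʳ λ 2≈0 → fromℕ≉0 1 (trans (+-congˡ (+-identityʳ 1#)) 2≈0)

      doubling : ∀ n → im (ℂ.excess (double n) (expTerm x) (expTerm x)) ≈
                       (S n * C n + S n * C n) - im (expSum (x + x) (double n))
      doubling n = begin
        im e
          ≈⟨ solve 2 (λ a b → b := (a :+ b) :- a) refl (im (expSum (x + x) (double n))) _ ⟩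
        (im (expSum (x + x) (double n)) + im e) - im (expSum (x + x) (double n))
          ≈⟨ +-congʳ (trans (reflexive (≡.sym (ℂ.im-+ _ e))) (trans (ℂ.im-cong (ℂ.sym (expSum-* x x (double n))))
               (trans (reflexive (ℂ.im-* (expSum x (double n)) (expSum x (double n)))) (+-congʳ (*-comm _ _))))) ⟩
        (S n * C n + S n * C n) - im (expSum (x + x) (double n)) ∎
        where
        e : Carrier × Carrier
        e = ℂ.excess (double n) (expTerm x) (expTerm x)

      2SC : (λ n → S n * C n + S n * C n) ⟶ sin (x + x)
      2SC = ⟶-+null (sin-limit (x + x))
        (null-cong doubling (null-subsequence double n≤double (proj₂ (null-excess x x))))

      S[C-cos] : Null λ n → S n * (C n - cos)
      S[C-cos] = null-cong eq (null-+ (null-scale ½ 2SC) (null-neg (null-scale cos (sin-limit x))))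
        where
        ½sin2x : ½ * sin (x + x) ≈ cos * sin x
        ½sin2x = sym (trans (*-assoc _ _ _) (trans (*-congˡ (trans (*-comm _ _) (⁻¹-inverseʳ sinx≉0))) (*-identityʳ _)))

        eq : ∀ n → ½ * ((S n * C n + S n * C n) - sin (x + x)) + - (cos * (S n - sin x)) ≈ S n * (C n - cos)
        eq n = begin
          ½ * ((S n * C n + S n * C n) - sin (x + x)) + - (cos * (S n - sin x))
            ≈⟨ solve 6 (λ h s c d k t → h :* ((s :* c :+ s :* c) :- d) :+ :- (k :* (s :- t)) :=
                 ((:1 :+ :1) :* h) :* (s :* c) :- k :* s :+ (k :* t :- h :* d))
                 refl ½ (S n) (C n) (sin (x + x)) cos (sin x) ⟩
          ((1# + 1#) * ½) * (S n * C n) - cos * S n + (cos * sin x - ½ * sin (x + x))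
            ≈⟨ +-cong (+-congʳ (*-congʳ 2½≈1)) (trans (+-congˡ (-‿cong ½sin2x)) (-‿inverseʳ _)) ⟩
          1# * (S n * C n) - cos * S n + 0#
            ≈⟨ solve 3 (λ s c k → :1 :* (s :* c) :- k :* s :+ :0 := s :* (c :- k)) refl (S n) (C n) cos ⟩
          S n * (C n - cos) ∎

    expLimit-multiple : ∀ {x z} → ExpLimit x z → ∀ j → ExpLimit (fromℕ j * x) (z ℂ.^ j)
    expLimit-multiple {x} lim zero    = expLimit-cong (sym (zeroˡ x)) ℂ.refl expLimit-0
    expLimit-multiple {x} lim (suc j) = expLimit-cong
      (solve 2 (λ x n → x :+ n :* x := (:1 :+ n) :* x) refl x (fromℕ j)) ℂ.refl
      (expLimit-+ lim (expLimit-multiple lim j))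

    expLimit-unit : ∀ {x z} → ExpLimit x z → z ℂ.* conj z ℂ.≈ ℂ.1#
    expLimit-unit {x} lim = expLimit-unique
      (expLimit-cong (-‿inverseʳ x) ℂ.refl (expLimit-+ lim (expLimit-neg lim))) expLimit-0

    -- The argument y is arbitrary up to equality of reals because `sin` comes without a congruence
    -- law; uniqueness of limits supplies it.
    sin-multiple : ∀ {x z} → ExpLimit x z → ∀ j {y} → y ≈ fromℕ j * x → sin y ≈ im (z ℂ.^ j)
    sin-multiple lim j {y} y≈jx = ⟶-unique (sin-limit y)
      (proj₂ (expLimit-cong (sym y≈jx) ℂ.refl (expLimit-multiple lim j)))

    module _ {π : Carrier} (isPi : IsPi sin π) (n : ℕ) where
      private
        m : ℕ
        m = suc (suc n)

        x : Carrier
        x = π * fromℕ m ⁻¹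

        0<π : 0# < π
        0<π = proj₁ isPi

        0<x : 0# < x
        0<x = *-pos 0<π (0<⁻¹ (0<fromℕ (suc n)))

        mx≈π : fromℕ m * x ≈ π
        mx≈π = trans (solve 3 (λ m p i → m :* (p :* i) := p :* (m :* i)) refl _ π _)
          (trans (*-congˡ (⁻¹-inverseʳ (fromℕ≉0 (suc n)))) (*-identityʳ π))

        fromℕ-mono-< : ∀ {i j} → i ℕ.< j → fromℕ i < fromℕ j
        fromℕ-mono-< {i} i<j = <-≤-trans (0<y-x⇒x<y
          (<-respʳ (solve 1 (λ i → :1 := (:1 :+ i) :- i) refl (fromℕ i)) 0<1)) (fromℕ-mono i<j)

        sin-jx≉0 : ∀ j → 0 ℕ.< j → j ℕ.< m → sin (fromℕ j * x) ≉ 0#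
        sin-jx≉0 (suc j) _ j<m = proj₂ (proj₂ isPi) (fromℕ (suc j) * x)
          (*-pos (0<fromℕ j) 0<x)
          (<-respˡ (*-comm x _) (<-respʳ (trans (*-comm x _) mx≈π) (*-monoˡ-< x 0<x (fromℕ-mono-< j<m))))

        x≈1x : x ≈ fromℕ 1 * x
        x≈1x = sym (trans (*-congʳ (+-identityʳ 1#)) (*-identityˡ x))

        -- Here m ≥ 2 enters: π/m lies strictly below π, the least positive zero.
        sin-x≉0 : sin x ≉ 0#
        sin-x≉0 sinx≈0 = sin-jx≉0 1 (s≤s z≤n) (s≤s (s≤s z≤n))
          (trans (⟶-unique (sin-limit (fromℕ 1 * x))
            (⟶-cong (λ k → ℂ.im-cong (ℂ.∑-cong (double k) λ i _ → ℂ.*-congˡ (ℂ.fromℝ-cong (term-cong x≈1x i)))) refl (sin-limit x)))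
            sinx≈0)

        η-limit : Σ (Carrier × Carrier) (ExpLimit x)
        η-limit = expLimit-exists x sin-x≉0

      -- η = exp (iπ / m)
      η : Carrier × Carrier
      η = proj₁ η-limit

      η-unit : η ℂ.* conj η ℂ.≈ ℂ.1#
      η-unit = expLimit-unit (proj₂ η-limit)

      sin-jπ/m : ∀ j → sin (π * fromℕ j * fromℕ m ⁻¹) ≈ im (η ℂ.^ j)
      sin-jπ/m j = sin-multiple (proj₂ η-limit) j (solve 3 (λ p j i → p :* j :* i := j :* (p :* i)) refl π _ _)

      im-η^m : im (η ℂ.^ m) ≈ 0#
      im-η^m = trans (sym (sin-multiple (proj₂ η-limit) m (sym mx≈π))) (proj₁ (proj₂ isPi))

      im-η^j≉0 : ∀ j → 0 ℕ.< j → j ℕ.< m → im (η ℂ.^ j) ≉ 0#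
      im-η^j≉0 j 0<j j<m im≈0 = sin-jx≉0 j 0<j j<m (trans (sin-multiple (proj₂ η-limit) j refl) im≈0)

-- Multiplicities of roots

module RootMultiplicity (ℝ : Reals) where
  open ComplexField ℝ
  open CommutativeRing complexRing hiding (_-_; zero)
  open RingNotation rawRing
  open Polynomials complexRing
  open RingProperties ring using () renaming (x∙y⁻¹≈ε⇒x≈y to x-y≈0⇒x≈y)
  open Solver complexRing
  open SetoidReasoning setoid

  private
    module P where
      open CommutativeRing polyRing public
      open RingNotation (CommutativeRing.rawRing polyRing) public using (_^_)
      open Solver polyRing public

  linearProduct : List Carrier → List Carrier
  linearProduct = foldr (λ a p → X-C a ⊛ p) 𝟙

  eval-X-C⊛ : ∀ a p x → eval (X-C a ⊛ p) x ≈ (x - a) * eval p x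
  eval-X-C⊛ a p x = trans (eval-⊛ (X-C a) p x) (*-congʳ (eval-X-C a x))

  eval-X-C⊛-root : ∀ a p → eval (X-C a ⊛ p) a ≈ 0#
  eval-X-C⊛-root a p = trans (eval-X-C⊛ a p a) (trans (*-congʳ (-‿inverseʳ a)) (zeroˡ _))

  private
    X-C-suc* : ∀ a i g → X-C a P.^ suc i ⊛ g ≋ X-C a ⊛ (X-C a P.^ i ⊛ g)
    X-C-suc* a i g = P.*-assoc (X-C a) (X-C a P.^ i) g

    root-of-power : ∀ a i g → eval (X-C a P.^ suc i ⊛ g) a ≈ 0#
    root-of-power a i g = trans (eval-cong a (X-C-suc* a i g)) (eval-X-C⊛-root a (X-C a P.^ i ⊛ g))

  -- The order of vanishing at a is well defined: common factors x - a are cancelled until one side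
  -- is free of them and hence nonzero at a.
  exponent-unique : ∀ a i j {g h} → eval g a ≉ 0# → eval h a ≉ 0# →
                    X-C a P.^ i ⊛ g ≋ X-C a P.^ j ⊛ h → i ≡ j
  exponent-unique a zero    zero    g≉0 h≉0 eq = ≡.refl
  exponent-unique a zero    (suc j) {g} {h} g≉0 h≉0 eq = contradiction
    (trans (eval-cong a (P.trans (P.sym (P.*-identityˡ g)) eq)) (root-of-power a j h)) g≉0
  exponent-unique a (suc i) zero    {g} {h} g≉0 h≉0 eq = contradiction
    (trans (eval-cong a (P.trans (P.sym (P.*-identityˡ h)) (P.sym eq))) (root-of-power a i g)) h≉0
  exponent-unique a (suc i) (suc j) g≉0 h≉0 eq = ≡.cong suc (exponent-unique a i j g≉0 h≉0
    (X-C-cancel a (P.trans (P.sym (X-C-suc* a i _)) (P.trans eq (X-C-suc* a j _)))))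

  count : Carrier → List Carrier → ℕ
  count a []      = 0
  count a (b ∷ L) = choose (b ≟ a) (suc (count a L)) (count a L)

  factor-count : ∀ a L → Σ (List Carrier) λ h →
                 eval h a ≉ 0# × linearProduct L ≋ X-C a P.^ count a L ⊛ h
  factor-count a []      = 𝟙 , (λ 1≈0 → 1≉0 (trans (sym (eval-𝟙 a)) 1≈0)) , P.sym (P.*-identityˡ 𝟙)
  factor-count a (b ∷ L) with b ≟ a | factor-count a L
  ... | yes b≈a | h , h≉0 , eq =
    h , h≉0 , P.trans (P.*-cong (X-C-cong b≈a) eq) (P.sym (X-C-suc* a (count a L) h))
  ... | no  b≉a | h , h≉0 , eq =
    X-C b ⊛ h ,
    (λ bh≈0 → *-≉0 (λ a-b≈0 → b≉a (sym (x-y≈0⇒x≈y _ _ a-b≈0))) h≉0 (trans (sym (eval-X-C⊛ b h a)) bh≈0)) ,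
    P.trans (P.*-congˡ eq) (P.solve 3 (λ x y z → x P.:* (y P.:* z) P.:= y P.:* (x P.:* z)) P.refl _ _ _)

  ∑-cong-All : ∀ {g h : Carrier → Carrier} {L} → All (λ a → g a ≈ h a) L → ∑ L g ≈ ∑ L h
  ∑-cong-All []        = refl
  ∑-cong-All (eq ∷ eqs) = +-cong eq (∑-cong-All eqs)

  ∑-zero : ∀ {g : Carrier → Carrier} {L} → All (λ a → g a ≈ 0#) L → ∑ L g ≈ 0#
  ∑-zero []         = refl
  ∑-zero (eq ∷ eqs) = trans (+-cong eq (∑-zero eqs)) (+-identityˡ 0#)

  ∑-+ : ∀ (g h : Carrier → Carrier) L → ∑ L (λ a → g a + h a) ≈ ∑ L g + ∑ L h
  ∑-+ g h []      = sym (+-identityˡ 0#)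
  ∑-+ g h (a ∷ L) = trans (+-congˡ (∑-+ g h L))
    (solve 4 (λ x y s t → x :+ y :+ (s :+ t) := x :+ s :+ (y :+ t)) refl _ _ _ _)

  ∑-* : ∀ x (g : Carrier → Carrier) L → ∑ L (λ a → x * g a) ≈ x * ∑ L g
  ∑-* x g []      = sym (zeroʳ x)
  ∑-* x g (a ∷ L) = trans (+-congˡ (∑-* x g L)) (sym (distribˡ _ _ _))

  member-root : ∀ b L → Any (b ≈_) L → eval (linearProduct L) b ≈ 0#
  member-root b (a ∷ L) (here b≈a)  = trans (eval-X-C⊛ a _ b)
    (trans (*-congʳ (trans (+-congʳ b≈a) (-‿inverseʳ a))) (zeroˡ _))
  member-root b (a ∷ L) (there b∈L) = trans (eval-X-C⊛ a _ b)
    (trans (*-congˡ (member-root b L b∈L)) (zeroʳ _))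

  module _ (f : Carrier → Carrier) (f-cong : ∀ {x y} → x ≈ y → f x ≈ f y) where

    remove-root : ∀ a L → eval (linearProduct L) a ≈ 0# → Σ (List Carrier) λ L′ →
                  linearProduct L ≋ X-C a ⊛ linearProduct L′ × ∑ L f ≈ f a + ∑ L′ f
    remove-root a []      root = contradiction (trans (sym (eval-𝟙 a)) root) 1≉0
    remove-root a (b ∷ L) root with b ≟ a
    ... | yes b≈a = L , P.*-congʳ (X-C-cong b≈a) , +-congʳ (f-cong b≈a)
    ... | no  b≉a with remove-root a L (*-cancelˡ (λ a-b≈0 → b≉a (sym (x-y≈0⇒x≈y _ _ a-b≈0)))
                         (trans (sym (eval-X-C⊛ b _ a)) (trans root (sym (zeroʳ _)))))
    ...   | L′ , eq , sum = b ∷ L′ ,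
      P.trans (P.*-congˡ eq) (P.solve 3 (λ x y z → x P.:* (y P.:* z) P.:= y P.:* (x P.:* z)) P.refl _ _ _) ,
      trans (+-congˡ sum) (solve 3 (λ x y z → x :+ (y :+ z) := y :+ (x :+ z)) refl _ _ _)

    indicator : Carrier → Carrier → Carrier
    indicator b a = choose (b ≟ a) (f a) 0#

    indicator-≉ : ∀ {b a} → b ≉ a → indicator b a ≈ 0#
    indicator-≉ {b} {a} b≉a with b ≟ a
    ... | yes b≈a = contradiction b≈a b≉a
    ... | no  _   = refl

    ∑-indicator : ∀ b {L} → Any (b ≈_) L → AllPairs _≉_ L → ∑ L (indicator b) ≈ f b
    ∑-indicator b {a ∷ L} (here b≈a)  (a≉L ∷ _)    with b ≟ a
    ... | yes _   = trans (+-cong (f-cong (sym b≈a))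
      (∑-zero (All.map (λ a≉c → indicator-≉ λ b≈c → a≉c (trans (sym b≈a) b≈c)) a≉L))) (+-identityʳ _)
    ... | no  b≉a = contradiction b≈a b≉a
    ∑-indicator b {a ∷ L} (there b∈L) (a≉L ∷ L≉) with b ≟ a
    ... | no  _   = trans (+-identityˡ _) (∑-indicator b b∈L L≉)
    ... | yes b≈a = contradiction b∈L (disjoint a≉L)
      where
      disjoint : ∀ {L} → All (a ≉_) L → ¬ Any (b ≈_) L
      disjoint (a≉c ∷ _) (here b≈c)  = a≉c (trans (sym b≈a) b≈c)
      disjoint (_ ∷ a≉L) (there b∈L) = disjoint a≉L b∈L

    -- Regroups the sum by value. Each entry b of `L` is charged, through `indicator b`, to the one
    -- element of `roots` equal to it.
    ∑-count : ∀ {roots} → AllPairs _≉_ roots → ∀ L → (∀ b → Any (b ≈_) L → Any (b ≈_) roots) →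
              ∑ L f ≈ ∑ roots (λ a → fromℕ (count a L) * f a)
    ∑-count {roots} distinct []      L⊆ = sym (∑-zero (All.universal (λ a → zeroˡ (f a)) roots))
    ∑-count {roots} distinct (b ∷ L) L⊆ = begin
      f b + ∑ L f
        ≈⟨ +-cong (sym (∑-indicator b (L⊆ b (here refl)) distinct)) (∑-count distinct L λ c c∈L → L⊆ c (there c∈L)) ⟩
      ∑ roots (indicator b) + ∑ roots (λ a → fromℕ (count a L) * f a)
        ≈⟨ ∑-+ (indicator b) _ roots ⟨
      ∑ roots (λ a → indicator b a + fromℕ (count a L) * f a)
        ≈⟨ ∑-cong-All (All.universal step roots) ⟩
      ∑ roots (λ a → fromℕ (count a (b ∷ L)) * f a) ∎
      where
      step : ∀ a → indicator b a + fromℕ (count a L) * f a ≈ fromℕ (count a (b ∷ L)) * f a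
      step a with b ≟ a
      ... | yes _ = solve 2 (λ x n → x :+ n :* x := (:1 :+ n) :* x) refl (f a) (fromℕ (count a L))
      ... | no  _ = +-identityˡ _

    -- Both sides sum f over the roots of E³, with multiplicity.
    ∑-roots-of-cube : ∀ E L roots (μ : Carrier → ℕ) → linearProduct L ≋ E P.^ 3 →
      AllPairs _≉_ roots → (∀ a → eval E a ≈ 0# → Any (a ≈_) roots) →
      All (λ a → Σ (List Carrier) (λ q → q ⊛ X-C a P.^ μ a ≋ E) ×
                 ¬ Σ (List Carrier) (λ q → q ⊛ X-C a P.^ suc (μ a) ≋ E)) roots →
      ∑ L f ≈ fromℕ 3 * ∑ roots (λ a → fromℕ (μ a) * f a)
    ∑-roots-of-cube E L roots μ eq distinct complete multiplicity = begin
      ∑ L f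
        ≈⟨ ∑-count distinct L L⊆roots ⟩
      ∑ roots (λ a → fromℕ (count a L) * f a)
        ≈⟨ ∑-cong-All (All.map (λ {a} mult → trans (*-congʳ (trans (reflexive (≡.cong fromℕ (count≡3μ a mult)))
             (SemiringMultProperties.×1-homo-* semiring 3 (μ a)))) (*-assoc _ _ _)) multiplicity) ⟩
      ∑ roots (λ a → fromℕ 3 * (fromℕ (μ a) * f a))
        ≈⟨ ∑-* (fromℕ 3) _ roots ⟩
      fromℕ 3 * ∑ roots (λ a → fromℕ (μ a) * f a) ∎
      where
      eval-cube : ∀ p x → eval (p P.^ 3) x ≈ eval p x ^ 3
      eval-cube p x = eval-^ p 3 x

      L⊆roots : ∀ b → Any (b ≈_) L → Any (b ≈_) roots
      L⊆roots b b∈L = complete b (cube≈0 (trans (sym (eval-cube E b))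
        (trans (sym (eval-cong b eq)) (member-root b L b∈L))))
        where
        cube≈0 : ∀ {x} → x ^ 3 ≈ 0# → x ≈ 0#
        cube≈0 {x} x³≈0 with x ≟ 0#
        ... | yes x≈0 = x≈0
        ... | no  x≉0 = contradiction x³≈0 (^-≉0 3 x≉0)

      count≡3μ : ∀ a → Σ (List Carrier) (λ q → q ⊛ X-C a P.^ μ a ≋ E) ×
                       ¬ Σ (List Carrier) (λ q → q ⊛ X-C a P.^ suc (μ a) ≋ E) → count a L ≡ 3 ℕ.* μ a
      count≡3μ a ((q , q*≋E) , maximal) with factor-count a L
      ... | h , h≉0 , L≋ = ≡.trans
        (exponent-unique a (count a L) (μ a ℕ.* 3) h≉0 q³≉0
          (P.trans (P.sym L≋) (P.trans eq (P.trans cube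
            (P.*-congʳ (Exp.^-assocʳ P.semiring (X-C a) (μ a) 3))))))
        (ℕ.*-comm (μ a) 3)
        where
        -- If q vanished at a, a further factor x - a would split off from E, against the maximality
        -- of `μ a`. So both sides compared above exhibit the order of vanishing of E³ at a.
        q≉0 : eval q a ≉ 0#
        q≉0 qa≈0 = maximal (quot a q , P.trans
          (P.solve 3 (λ x y z → x P.:* (y P.:* z) P.:= (y P.:* x) P.:* z) P.refl (quot a q) (X-C a) (X-C a P.^ μ a))
          (P.trans (P.*-congʳ (P.sym (factor-root a q qa≈0))) q*≋E))

        q³≉0 : eval (q P.^ 3) a ≉ 0#
        q³≉0 q³≈0 = ^-≉0 3 q≉0 (trans (sym (eval-cube q a)) q³≈0)

        cube : E P.^ 3 ≋ (X-C a P.^ μ a) P.^ 3 ⊛ q P.^ 3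
        cube = P.trans (Exp.^-congˡ P.semiring 3 (P.trans (P.sym q*≋E) (P.*-comm q _)))
          (CommutativeExp.^-distrib-* P.commutativeSemiring (X-C a P.^ μ a) q 3)

-- The resultants of W

module WForm (R : CommutativeRing c ℓ) where
  open CommutativeRing R hiding (_-_; zero)
  open RingNotation rawRing
  open Solver R
  open SetoidReasoning setoid

  opaque
    -- W over an arbitrary ring: it occurs as a polynomial in v, as one in u with v replaced by a
    -- node, and with both replaced.
    form : Carrier → Carrier → Carrier → Carrier → Carrier
    form i w u v = i * u ^ 2 * v ^ 2 + u ^ 2 * v + u * v ^ 2 - fromℕ 2 * w * u * v + u + v - i

  private
    :form : ∀ {n} → Polynomial n → Polynomial n → Polynomial n → Polynomial n → Polynomial n
    :form i w u v =
      i :* :² u :* :² v :+ :² u :* v :+ u :* :² v :- :fromℕ 2 :* w :* u :* v :+ u :+ v :- i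
      where
      :² : ∀ {n} → Polynomial n → Polynomial n
      :² x = x :* (x :* :1)

  opaque
    unfolding form

    form-cong : ∀ {i i′ w w′ u u′ v v′} → i ≈ i′ → w ≈ w′ → u ≈ u′ → v ≈ v′ →
                form i w u v ≈ form i′ w′ u′ v′
    form-cong i≈ w≈ u≈ v≈ =
      +-cong (+-cong (+-cong (+-cong (+-cong (+-cong
        (*-cong (*-cong i≈ (^2 u≈)) (^2 v≈)) (*-cong (^2 u≈) v≈)) (*-cong u≈ (^2 v≈)))
        (-‿cong (*-cong (*-cong (*-congˡ w≈) u≈) v≈))) u≈) v≈) (-‿cong i≈)
      where
      ^2 : ∀ {x y} → x ≈ y → x ^ 2 ≈ y ^ 2
      ^2 = Exp.^-congˡ semiring 2

    form-quadratic : ∀ i w u v → form i w u v ≈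
      (i * (u * u) + u) * (v * v) + (u * u + - (fromℕ 2 * w * u) + 1#) * v + (u + - i)
    form-quadratic = solve 4 (λ i w u v → :form i w u v :=
      (i :* (u :* u) :+ u) :* (v :* v) :+ (u :* u :+ :- (:fromℕ 2 :* w :* u) :+ :1) :* v :+ (u :+ :- i)) refl

    form-sym : ∀ i w u v → form i w u v ≈ form i w v u
    form-sym = solve 4 (λ i w u v → :form i w u v := :form i w v u) refl

    -- An identity for an indeterminate i. As a ring identity it cannot use i² = -1, so the
    -- discrepancy is exhibited as a multiple of i² + 1; likewise in `form-rotated`.
    form-degenerate′ : ∀ i w u →
      form i w u i ≈ - (fromℕ 2 * w * i) * u + (i * i + 1#) * (i * u * u + u)
    form-degenerate′ = solve 3 (λ i w u → :form i w u i :=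
      :- (:fromℕ 2 :* w :* i) :* u :+ (i :* i :+ :1) :* (i :* u :* u :+ u)) refl

    form-rotated : ∀ i w α β → form i w (i * α) (i * β) ≈
      fromℕ 2 * w * (α * β) + i * (α * β * (α * β) - α * (α * β) - (α * β) * β + α + β - 1#) +
      (i * i + 1#) * (i * ((i * i - 1#) * (α * β) * (α * β) + α * α * β + α * β * β) - fromℕ 2 * w * α * β)
    form-rotated = solve 4 (λ i w a b → :form i w (i :* a) (i :* b) :=
      :fromℕ 2 :* w :* (a :* b) :+ i :* (a :* b :* (a :* b) :- a :* (a :* b) :- (a :* b) :* b :+ a :+ b :- :1)
      :+ (i :* i :+ :1) :* (i :* ((i :* i :- :1) :* (a :* b) :* (a :* b) :+ a :* a :* b :+ a :* b :* b)
                            :- :fromℕ 2 :* w :* a :* b)) refl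

  -- At v = i the leading coefficient i (i² + 1) in u vanishes. This is the drop by one in the
  -- degree of the inner resultant.
  form-degenerate : ∀ i w u → i * i ≈ - 1# → form i w u i ≈ - (fromℕ 2 * w * i) * u
  form-degenerate i w u i²≈-1 = begin
    form i w u i
      ≈⟨ form-degenerate′ i w u ⟩
    - (fromℕ 2 * w * i) * u + (i * i + 1#) * (i * u * u + u)
      ≈⟨ +-congˡ (trans (*-congʳ (trans (+-congʳ i²≈-1) (-‿inverseˡ 1#))) (zeroˡ _)) ⟩
    - (fromℕ 2 * w * i) * u + 0#
      ≈⟨ +-identityʳ _ ⟩
    - (fromℕ 2 * w * i) * u ∎

  -- With α = e^{iθ}, β = e^{iφ} the bracket is 2i (sin (θ + φ) - sin θ - sin φ).
  bracket : (α α⁻ β β⁻ : Carrier) → Carrier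
  bracket α α⁻ β β⁻ = α * β - α - β + α⁻ + β⁻ - α⁻ * β⁻

  form-factors : ∀ {i w α α⁻ β β⁻ r} → i * i ≈ - 1# → α * α⁻ ≈ 1# → β * β⁻ ≈ 1# →
    r + r ≈ - (i * bracket α α⁻ β β⁻) →
    form i w (i * α) (i * β) ≈ fromℕ 2 * (α * β) * (w - r)
  form-factors {i} {w} {α} {α⁻} {β} {β⁻} {r} i²≈-1 αα⁻≈1 ββ⁻≈1 2r≈ = begin
    form i w (i * α) (i * β)
      ≈⟨ form-rotated i w α β ⟩
    fromℕ 2 * w * (α * β) + i * (α * β * (α * β) - α * (α * β) - (α * β) * β + α + β - 1#) + (i * i + 1#) * _
      ≈⟨ trans (+-congˡ (trans (*-congʳ (trans (+-congʳ i²≈-1) (-‿inverseˡ 1#))) (zeroˡ _))) (+-identityʳ _) ⟩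
    fromℕ 2 * w * (α * β) + i * (α * β * (α * β) - α * (α * β) - (α * β) * β + α + β - 1#)
      -- The terms not divisible by α β are multiplied by the ones `α * α⁻` and `β * β⁻`, which
      -- makes α β a common factor.
      ≈⟨ +-congˡ (*-congˡ (+-cong (+-cong (+-congˡ (trans (sym (*-identityʳ α)) (*-congˡ (sym ββ⁻≈1))))
           (trans (sym (*-identityˡ β)) (*-congʳ (sym αα⁻≈1))))
           (-‿cong (trans (sym (*-identityˡ 1#)) (*-cong (sym αα⁻≈1) (sym ββ⁻≈1)))))) ⟩
    fromℕ 2 * w * (α * β) + i * (α * β * (α * β) - α * (α * β) - (α * β) * β + α * (β * β⁻) + α * α⁻ * β
                                  - α * α⁻ * (β * β⁻))
      ≈⟨ solve 6 (λ i w a a′ b b′ →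
           :fromℕ 2 :* w :* (a :* b) :+ i :* (a :* b :* (a :* b) :- a :* (a :* b) :- (a :* b) :* b :+ a :* (b :* b′)
             :+ a :* a′ :* b :- a :* a′ :* (b :* b′)) :=
           :fromℕ 2 :* w :* (a :* b) :- (a :* b) :* :- (i :* (a :* b :- a :- b :+ a′ :+ b′ :- a′ :* b′)))
           refl i w α α⁻ β β⁻ ⟩
    fromℕ 2 * w * (α * β) - (α * β) * - (i * bracket α α⁻ β β⁻)
      ≈⟨ +-congˡ (-‿cong (*-congˡ 2r≈)) ⟨
    fromℕ 2 * w * (α * β) - (α * β) * (r + r)
      ≈⟨ solve 3 (λ w p r → :fromℕ 2 :* w :* p :- p :* (r :+ r) := :fromℕ 2 :* p :* (w :- r)) refl w (α * β) r ⟩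
    fromℕ 2 * (α * β) * (w - r) ∎

module PolynomialForms (R : CommutativeRing c ℓ) where
  open CommutativeRing R hiding (_-_; zero)
  open RingNotation rawRing
  open FiniteSums R
  open Polynomials R
  open WForm R
  open SetoidReasoning setoid

  private
    module P where
      open CommutativeRing polyRing public hiding (_-_)
      open RingNotation (CommutativeRing.rawRing polyRing) public using (_^_; _-_; fromℕ)
      open FiniteSums polyRing public
      open WForm polyRing public

  opaque
    unfolding WForm.form

    eval-form : ∀ i w u v x → eval (P.form i w u v) x ≈ form (eval i x) (eval w x) (eval u x) (eval v x)
    eval-form i w u v x =
      sub (add (add (sub (add (add
        (mul (mul refl (eval-^ u 2 x)) (eval-^ v 2 x))
        (mul (eval-^ u 2 x) refl))
        (mul refl (eval-^ v 2 x)))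
        (mul (mul (mul (eval-fromℕ 2 x) refl) refl) refl))
        refl) refl) refl
      where
      add : ∀ {p q y z} → eval p x ≈ y → eval q x ≈ z → eval (p ⊕ q) x ≈ y + z
      add {p} {q} p≈ q≈ = trans (eval-⊕ p q x) (+-cong p≈ q≈)

      mul : ∀ {p q y z} → eval p x ≈ y → eval q x ≈ z → eval (p ⊛ q) x ≈ y * z
      mul {p} {q} p≈ q≈ = trans (eval-⊛ p q x) (*-cong p≈ q≈)

      sub : ∀ {p q y z} → eval p x ≈ y → eval q x ≈ z → eval (p P.- q) x ≈ y - z
      sub {p} {q} p≈ q≈ = add p≈ (trans (eval-⊖ q x) (-‿cong q≈))

  private
    Below-⊛₀ : ∀ p q → Below 1 p → Below 1 q → Below 1 (p ⊛ q)
    Below-⊛₀ = Below-⊛ 0 0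

    Below-𝟙 : Below 1 𝟙
    Below-𝟙 = Below-cong (P.sym 𝟙≋C) (Below-C 1#)

    Below-fromℕ : ∀ n → Below 1 (P.fromℕ n)
    Below-fromℕ n = Below-cong (C-fromℕ n) (Below-C _)

  Below-form : ∀ i w u → Below 1 i → Below 1 w → Below 1 u → Below 3 (P.form i w u X)
  Below-form i w u i< w< u< = Below-cong (P.sym (P.form-quadratic i w u X))
    (Below-⊕ _ _ (Below-⊕ _ _
      (Below-⊛ 0 2 _ _ (Below-⊕ _ _ (Below-⊛₀ i _ i< (Below-⊛₀ u u u< u<)) u<) (Below-⊛ 1 1 X X Below-X Below-X))
      (Below-≤ ((u ⊛ u ⊕ ⊖ (P.fromℕ 2 ⊛ w ⊛ u) ⊕ 𝟙) ⊛ X) (s≤s (s≤s z≤n)) (Below-⊛ 0 1 _ X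
        (Below-⊕ _ _ (Below-⊕ _ _ (Below-⊛₀ u u u< u<)
          (Below-⊖ _ (Below-⊛₀ _ u (Below-⊛₀ _ w (Below-fromℕ 2) w<) u<))) Below-𝟙) Below-X)))
      (Below-≤ (u ⊕ ⊖ i) (s≤s z≤n) (Below-⊕ u _ u< (Below-⊖ i i<))))

  Below-form-degenerate : ∀ i w → Below 1 i → Below 1 w → i ⊛ i ≋ ⊖ 𝟙 → Below 2 (P.form i w X i)
  Below-form-degenerate i w i< w< i²≋-1 = Below-cong (P.sym (P.form-degenerate i w X i²≋-1))
    (Below-⊛ 0 1 _ X (Below-⊖ _ (Below-⊛₀ _ i (Below-⊛₀ _ w (Below-fromℕ 2) w<) i<)) Below-X)

  Below-∏ : ∀ n f → (∀ k → k ℕ.< n → Below 3 (f k)) → Below (suc (2 ℕ.* n)) (P.∏< n f)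
  Below-∏ zero    f f< = Below-cong (P.sym (P.∏-zero f)) Below-𝟙
  Below-∏ (suc n) f f< = Below-cong (P.sym (P.∏-suc n f))
    (≡.subst (λ k → Below (suc k) (f 0 ⊛ P.∏< n (f ∘ suc))) (≡.sym (ℕ.*-suc 2 n))
      (Below-⊛ 2 (2 ℕ.* n) (f 0) _ (f< 0 (s≤s z≤n)) (Below-∏ n (f ∘ suc) λ k k<n → f< (suc k) (s≤s k<n))))

  binomial : Carrier → ℕ → List Carrier
  binomial ι m = X P.^ m P.- C (ι ^ m)

  -- The differences of the nodes are assumed to be units rather than nonzero: unlike being nonzero,
  -- this implies cancellability over any ring, and it is inherited by constant polynomials.
  binomial-factors : ∀ ι m (β : ℕ → Carrier) → 0 ℕ.< m → (∀ k → k ℕ.< m → β k ^ m ≈ ι ^ m) →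
    (∀ i j → i ℕ.< j → j ℕ.< m → ∃ λ y → (β j - β i) * y ≈ 1#) →
    binomial ι m ≋ P.∏< m (λ k → X-C (β k))
  binomial-factors ι (suc m) β _ root unit = P.trans
    (factor-roots (suc m) (binomial ι (suc m)) β degree
      (λ k k<m → trans (trans (eval-⊕ _ _ (β k)) (+-cong (trans (eval-^ X (suc m) (β k)) (Exp.^-congˡ semiring (suc m) (eval-X (β k))))
                   (trans (eval-⊖ _ (β k)) (-‿cong (eval-C _ (β k))))))
                 (trans (+-congʳ (root k k<m)) (-‿inverseʳ _)))
      (λ i j i<j j<m x yx≈0 → let y , dy≈1 = unit i j i<j j<m in begin
         x ≈⟨ trans (sym (*-identityˡ x)) (*-congʳ (trans (sym dy≈1) (*-comm _ _))) ⟩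
         y * (β j - β i) * x ≈⟨ *-assoc _ _ _ ⟩
         y * ((β j - β i) * x) ≈⟨ *-congˡ yx≈0 ⟩
         y * 0# ≈⟨ zeroʳ y ⟩
         0# ∎))
    (P.trans (P.*-congʳ (P.trans (C-cong leading) (P.sym 𝟙≋C))) (P.*-identityˡ _))
    where
    degree : Below (suc (suc m)) (binomial ι (suc m))
    degree = Below-⊕ _ _ (Below-X^ (suc m)) (Below-⊖ _ (Below-≤ (C (ι ^ suc m)) (s≤s z≤n) (Below-C _)))

    leading : coeff (binomial ι (suc m)) (suc m) ≈ 1#
    leading = trans (coeff-⊕ _ _ (suc m)) (trans (+-cong (coeff-X^ (suc m))
      (trans (coeff-⊖ _ (suc m)) (trans (-‿cong (coeff-C-suc _ m)) (RingProperties.-0#≈0# ring)))) (+-identityʳ 1#))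

-- The tower of rings: A is K[w], B is K[w][u], and V concerns polynomials in v over B. The nodes
-- are constants from K, lifted to each level.
module ResultantOfForm (K : CommutativeRing c ℓ) where
  private
    module K where
      open CommutativeRing K public hiding (_-_; zero)
      open RingNotation (CommutativeRing.rawRing K) public
      open WForm K public
    module A where
      open Polynomials K public using (C; X; C-cong; C-*; C-^; C-sub; C-neg; 𝟙≋C)
      open CommutativeRing (Polynomials.polyRing K) public hiding (_-_; zero)
      open RingNotation (CommutativeRing.rawRing (Polynomials.polyRing K)) public
      open FiniteSums (Polynomials.polyRing K) public
      open WForm (Polynomials.polyRing K) public
    ringA : CommutativeRing c ℓ
    ringA = Polynomials.polyRing K
    module B where
      open Polynomials ringA public
        using (C; X; eval; eval-cong; eval-∏; eval-C; eval-X; Below; Below-C; Below-≤; Below-cong; Below-⊛; C-cong; C-*; C-^; C-sub; C-neg; 𝟙≋C)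
      open PolynomialForms ringA public
      open CommutativeRing (Polynomials.polyRing ringA) public hiding (_-_; zero)
      open RingNotation (CommutativeRing.rawRing (Polynomials.polyRing ringA)) public
      open FiniteSums (Polynomials.polyRing ringA) public
      open WForm (Polynomials.polyRing ringA) public
    ringB : CommutativeRing c ℓ
    ringB = Polynomials.polyRing ringA
    module V where
      open Polynomials ringB public using (C; X; eval; eval-cong; eval-C; eval-X; Below; Below-C)
      open PolynomialForms ringB public
      open WForm (Polynomials.polyRing ringB) public

  module _ (i : K.Carrier) where
    formᵥ : List (List (List K.Carrier))
    formᵥ = V.form (V.C (B.C (A.C i))) (V.C (B.C A.X)) (V.C B.X) V.X

    formResᵥ : ℕ → List (List K.Carrier)
    formResᵥ m = ResultantProduct.resultant ringB m 2 (V.binomial (B.C (A.C i)) m) formᵥ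

    formResᵤ : ℕ → List K.Carrier
    formResᵤ m = ResultantProduct.resultant ringA m (2 ℕ.* m ∸ 1) (B.binomial (A.C i) m) (formResᵥ m)

    module _ (i²≈-1 : i K.* i K.≈ K.- K.1#) (m : ℕ) (β : ℕ → K.Carrier) (β₀≈i : β 0 K.≈ i)
             (root : ∀ k → β k K.^ suc m K.≈ i K.^ suc m)
             (unit : ∀ j k → j ℕ.< k → k ℕ.< suc m → ∃ λ y → (β k K.- β j) K.* y K.≈ K.1#) where
      private
        βA : ℕ → A.Carrier
        βA k = A.C (β k)

        βB : ℕ → B.Carrier
        βB k = B.C (βA k)

        iA : A.Carrier
        iA = A.C i

        rootA : ∀ k → βA k A.^ suc m A.≈ iA A.^ suc m
        rootA k = A.trans (A.sym (A.C-^ (β k) (suc m))) (A.trans (A.C-cong (root k)) (A.C-^ i (suc m)))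

        rootB : ∀ k → βB k B.^ suc m B.≈ B.C iA B.^ suc m
        rootB k = B.trans (B.sym (B.C-^ (βA k) (suc m))) (B.trans (B.C-cong (rootA k)) (B.C-^ iA (suc m)))

        unitA : ∀ j k → j ℕ.< k → k ℕ.< suc m → ∃ λ y → (βA k A.- βA j) A.* y A.≈ A.1#
        unitA j k j<k k<m = let y , eq = unit j k j<k k<m in A.C y ,
          A.trans (A.*-congʳ (A.sym (A.C-sub (β k) (β j))))
            (A.trans (A.sym (A.C-* _ y)) (A.trans (A.C-cong eq) (A.sym A.𝟙≋C)))

        unitB : ∀ j k → j ℕ.< k → k ℕ.< suc m → ∃ λ y → (βB k B.- βB j) B.* y B.≈ B.1#
        unitB j k j<k k<m = let y , eq = unitA j k j<k k<m in B.C y ,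
          B.trans (B.*-congʳ (B.sym (B.C-sub (βA k) (βA j))))
            (B.trans (B.sym (B.C-* _ y)) (B.trans (B.C-cong eq) (B.sym B.𝟙≋C)))

        formᵤ : ℕ → B.Carrier
        formᵤ k = B.form (B.C iA) (B.C A.X) B.X (βB k)

        iA²≈-1 : iA A.* iA A.≈ A.- A.1#
        iA²≈-1 = A.trans (A.sym (A.C-* i i)) (A.trans (A.C-cong i²≈-1)
          (A.trans (A.C-neg K.1#) (A.-‿cong (A.sym A.𝟙≋C))))

        iB²≈-1 : B.C iA B.* B.C iA B.≈ B.- B.1#
        iB²≈-1 = B.trans (B.sym (B.C-* iA iA)) (B.trans (B.C-cong iA²≈-1)
          (B.trans (B.C-neg A.1#) (B.-‿cong (B.sym B.𝟙≋C))))

      resᵥ-product : formResᵥ (suc m) B.≈ B.∏< (suc m) formᵤ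
      resᵥ-product = B.trans
        (ResultantProduct.resultant-∏ ringB (suc m) 2 βB (V.binomial (B.C iA) (suc m)) formᵥ
          (V.binomial-factors (B.C iA) (suc m) βB (s≤s z≤n) (λ k _ → rootB k) unitB)
          (V.Below-form (V.C (B.C iA)) (V.C (B.C A.X)) (V.C B.X)
            (V.Below-C (B.C iA)) (V.Below-C (B.C A.X)) (V.Below-C B.X)))
        (B.∏-cong (suc m) λ k _ → B.trans
          (V.eval-form (V.C (B.C iA)) (V.C (B.C A.X)) (V.C B.X) V.X (βB k))
          (B.form-cong (V.eval-C (B.C iA) (βB k)) (V.eval-C (B.C A.X) (βB k)) (V.eval-C B.X (βB k)) (V.eval-X (βB k))))

      -- W is symmetric in u and v, so the degree bound in the last argument serves for u as well.
      Below-formᵤ : ∀ k → B.Below 3 (formᵤ k)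
      Below-formᵤ k = B.Below-cong (B.form-sym _ _ (βB k) B.X)
        (B.Below-form _ _ _ (B.Below-C _) (B.Below-C _) (B.Below-C _))

      -- Among the m + 1 factors the one for β₀ = i has degree at most 1 in u and the others at most
      -- 2, in total 2m + 1 = 2 (m + 1) - 1.
      Below-resᵥ : B.Below (suc (2 ℕ.* suc m ∸ 1)) (formResᵥ (suc m))
      Below-resᵥ = B.Below-cong (B.sym (B.trans resᵥ-product (B.∏-suc m formᵤ)))
        (≡.subst (λ k → B.Below (suc k) (formᵤ 0 B.* B.∏< m (formᵤ ∘ suc)))
          (≡.sym (≡.cong (_∸ 1) (ℕ.*-suc 2 m)))
          (B.Below-⊛ 1 (2 ℕ.* m) (formᵤ 0) _
            (B.Below-cong (B.form-cong B.refl B.refl B.refl (B.C-cong (A.C-cong (K.sym β₀≈i))))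
              (B.Below-form-degenerate (B.C iA) _ (B.Below-C _) (B.Below-C _) iB²≈-1))
            (B.Below-∏ m (formᵤ ∘ suc) λ k _ → Below-formᵤ (suc k))))

      resᵤ-product : formResᵤ (suc m) A.≈
        A.∏< (suc m) (λ j → A.∏< (suc m) (λ k → A.form (A.C i) A.X (A.C (β j)) (A.C (β k))))
      resᵤ-product = A.trans
        (ResultantProduct.resultant-∏ ringA (suc m) (2 ℕ.* suc m ∸ 1) βA (B.binomial iA (suc m)) (formResᵥ (suc m))
          (B.binomial-factors iA (suc m) βA (s≤s z≤n) (λ k _ → rootA k) unitA) Below-resᵥ)
        (A.∏-cong (suc m) λ j _ → A.trans (B.eval-cong (βA j) resᵥ-product)
          (A.trans (B.eval-∏ (suc m) formᵤ (βA j)) (A.∏-cong (suc m) λ k _ →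
            A.trans (B.eval-form _ _ _ _ (βA j))
              (A.form-cong (B.eval-C _ _) (B.eval-C _ _) (B.eval-X _) (B.eval-C _ _)))))

-- Admissible triples

choose-yes : {P : Set ℓ₃} {A : Set ℓ₁} (d : Dec P) {x y : A} → P → choose d x y ≡ x
choose-yes (yes _) _ = ≡.refl
choose-yes (no ¬p) p = contradiction p ¬p

choose-no : {P : Set ℓ₃} {A : Set ℓ₁} (d : Dec P) {x y : A} → ¬ P → choose d x y ≡ y
choose-no (yes p) ¬p = contradiction p ¬p
choose-no (no _)  _  = ≡.refl

module ListProduct (M : CommutativeMonoid c ℓ) where
  open CommutativeMonoid M
  open Range M

  -- For polynomials under multiplication and `X-C` this unfolds to `linearProduct`.
  ⨀ : {A : Set ℓ₁} → List A → (A → Carrier) → Carrier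
  ⨀ xs f = foldr (λ x y → f x ∙ y) ε xs

  ⨀-cong : {A : Set ℓ₁} (xs : List A) {f g : A → Carrier} → (∀ x → f x ≈ g x) → ⨀ xs f ≈ ⨀ xs g
  ⨀-cong []       f≈g = refl
  ⨀-cong (x ∷ xs) f≈g = ∙-cong (f≈g x) (⨀-cong xs f≈g)

  ⨀-++ : {A : Set ℓ₁} (xs ys : List A) (f : A → Carrier) → ⨀ (xs ++ ys) f ≈ ⨀ xs f ∙ ⨀ ys f
  ⨀-++ []       ys f = sym (identityˡ _)
  ⨀-++ (x ∷ xs) ys f = trans (∙-congˡ (⨀-++ xs ys f)) (sym (assoc _ _ _))

  ⨀-map : {A : Set ℓ₁} {B : Set ℓ₂} (h : A → B) (xs : List A) (f : B → Carrier) → ⨀ (map h xs) f ≡ ⨀ xs (f ∘ h)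
  ⨀-map h []       f = ≡.refl
  ⨀-map h (x ∷ xs) f = ≡.cong (f (h x) ∙_) (⨀-map h xs f)

  ⨀-cartesianProduct : {A : Set ℓ₁} {B : Set ℓ₂} (xs : List A) (ys : List B) (f : A × B → Carrier) →
    ⨀ (cartesianProduct xs ys) f ≈ ⨀ xs (λ x → ⨀ ys (λ y → f (x , y)))
  ⨀-cartesianProduct []       ys f = refl
  ⨀-cartesianProduct (x ∷ xs) ys f = trans (⨀-++ (map (x ,_) ys) _ f)
    (∙-cong (reflexive (⨀-map (x ,_) ys f)) (⨀-cartesianProduct xs ys f))

  ⨀-filter : {A : Set ℓ₁} {P : Pred A ℓ₃} (P? : Decidable P) (xs : List A) (f : A → Carrier) →
    ⨀ (filter P? xs) f ≈ ⨀ xs (λ x → choose (P? x) (f x) ε)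
  ⨀-filter P? []       f = refl
  ⨀-filter P? (x ∷ xs) f with P? x
  ... | yes _ = ∙-congˡ (⨀-filter P? xs f)
  ... | no  _ = trans (⨀-filter P? xs f) (sym (identityˡ _))

  ⨀-allFin : ∀ n (f : ℕ → Carrier) → ⨀ (allFin n) (f ∘ toℕ) ≈ ⨁ n f
  ⨀-allFin n f = tabulated n id f λ _ → ≡.refl
    where
    tabulated : ∀ n {k} (h : Fin n → Fin k) (g : ℕ → Carrier) → (∀ i → f (toℕ (h i)) ≡ g (toℕ i)) →
                ⨀ (tabulate h) (f ∘ toℕ) ≈ ⨁ n g
    tabulated zero    h g eq = sym (⨁-zero g)
    tabulated (suc n) h g eq =
      trans (∙-cong (reflexive (eq zero)) (tabulated n (h ∘ suc) (g ∘ suc) (eq ∘ suc))) (sym (⨁-suc n g))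

module Admissibility (m : ℕ) where

  AdmissibleSum : ℕ → ℕ → ℕ → Set
  AdmissibleSum j l k = j ≢ 0 × l ≢ 0 × k ≢ 0 × m ∣ j ℕ.+ l ℕ.+ k

  opaque
    admissibleSum? : ∀ j l k → Dec (AdmissibleSum j l k)
    admissibleSum? j l k = ¬? (j ℕ.≟ 0) ×-dec ¬? (l ℕ.≟ 0) ×-dec ¬? (k ℕ.≟ 0) ×-dec m ∣? (j ℕ.+ l ℕ.+ k)

  private
    small-multiple : ∀ {o} → o ℕ.< m → m ∣ o → o ≡ 0
    small-multiple {zero}  _   _   = ≡.refl
    small-multiple {suc o} o<m m∣o = contradiction (ℕ.∣⇒≤ m∣o) (ℕ.<⇒≱ o<m)

    complement-unique-≤ : ∀ {s k k′} → k′ ℕ.< m → k ℕ.≤ k′ → m ∣ s ℕ.+ k → m ∣ s ℕ.+ k′ → k ≡ k′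
    complement-unique-≤ {s} {k} {k′} k′<m k≤k′ m∣s+k m∣s+k′ with ℕ.m≤n⇒∃[o]m+o≡n k≤k′
    ... | o , ≡.refl = ≡.trans (≡.sym (ℕ.+-identityʳ k)) (≡.cong (k ℕ.+_) (≡.sym o≡0))
      where
      o≡0 : o ≡ 0
      o≡0 = small-multiple (ℕ.≤-<-trans (ℕ.m≤n+m o k) k′<m)
        (ℕ.∣m+n∣m⇒∣n (≡.subst (m ∣_) (≡.sym (ℕ.+-assoc s k o)) m∣s+k′) m∣s+k)

  complement-unique : ∀ {s k k′} → k ℕ.< m → k′ ℕ.< m → m ∣ s ℕ.+ k → m ∣ s ℕ.+ k′ → k ≡ k′
  complement-unique {s} {k} {k′} k<m k′<m m∣s+k m∣s+k′ with ℕ.≤-total k k′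
  ... | inj₁ k≤k′ = complement-unique-≤ k′<m k≤k′ m∣s+k m∣s+k′
  ... | inj₂ k′≤k = ≡.sym (complement-unique-≤ k<m k′≤k m∣s+k′ m∣s+k)

  -- The third residue is m - (j + l) or 2m - (j + l), according to the side of m on which j + l
  -- lies. The excluded sum j + l = m is the one that would force it to be 0.
  complement : ∀ {j l} → j ℕ.< m → l ℕ.< m → j ≢ 0 → l ≢ 0 → j ℕ.+ l ≢ m →
               ∃ λ k → k ℕ.< m × AdmissibleSum j l k
  complement {j} {l} j<m l<m j≢0 l≢0 j+l≢m with ℕ.<-cmp (j ℕ.+ l) m
  ... | tri≈ _ eq _ = contradiction eq j+l≢m
  ... | tri< lt _ _ with ℕ.m≤n⇒∃[o]m+o≡n lt
  ...   | o , eq = suc o , k<m , j≢0 , l≢0 , (λ ()) , divides 1 (≡.trans j+l+k≡m (≡.sym (ℕ.*-identityˡ m)))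
    where
    j+l+k≡m : j ℕ.+ l ℕ.+ suc o ≡ m
    j+l+k≡m = ≡.trans (ℕ.+-suc (j ℕ.+ l) o) eq

    k<m : suc o ℕ.< m
    k<m = ≡.subst (suc o ℕ.<_) j+l+k≡m (ℕ.m<n+m (suc o) (ℕ.<-≤-trans (ℕ.n≢0⇒n>0 j≢0) (ℕ.m≤m+n j l)))
  complement {j} {l} j<m l<m j≢0 l≢0 j+l≢m | tri> _ _ gt with ℕ.m≤n⇒∃[o]m+o≡n gt
  ...   | o , eq with ℕ.m≤n⇒∃[o]m+o≡n (ℕ.+-cancelˡ-< m (suc o) m
                       (≡.subst (ℕ._< m ℕ.+ m) (≡.trans (≡.sym eq) (≡.sym (ℕ.+-suc m o))) (ℕ.+-mono-< j<m l<m)))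
  ...     | k , eq′ = suc k , k<m , j≢0 , l≢0 , (λ ()) , divides 2 j+l+k≡2m
    where
    o+k≡m : suc o ℕ.+ suc k ≡ m
    o+k≡m = ≡.trans (ℕ.+-suc (suc o) k) eq′

    k<m : suc k ℕ.< m
    k<m = ≡.subst (suc k ℕ.<_) o+k≡m (ℕ.m<n+m (suc k) (s≤s z≤n))

    j+l+k≡2m : j ℕ.+ l ℕ.+ suc k ≡ 2 ℕ.* m
    j+l+k≡2m = ≡.trans (≡.cong (ℕ._+ suc k) (≡.trans (≡.sym eq) (≡.sym (ℕ.+-suc m o))))
      (≡.trans (ℕ.+-assoc m (suc o) (suc k)) (≡.cong (m ℕ.+_) (≡.trans o+k≡m (≡.sym (ℕ.+-identityʳ m)))))

  opposite-inadmissible : ∀ {j l k} → k ℕ.< m → j ℕ.+ l ≡ m → ¬ AdmissibleSum j l k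
  opposite-inadmissible k<m ≡.refl (_ , _ , k≢0 , m∣j+l+k) =
    k≢0 (small-multiple k<m (ℕ.∣m+n∣m⇒∣n m∣j+l+k ℕ.∣-refl))

-- Products over the pairs (j , l) of residues mod m, against products over the
-- admissible triples: the 3m - 2 pairs not occurring in a triple contribute X.
module TripleProducts (R : CommutativeRing c ℓ) (m′ : ℕ) where
  open CommutativeRing R hiding (_-_; zero)
  open RingNotation rawRing
  open FiniteSums R
  open ListProduct *-commutativeMonoid
  open SetoidReasoning setoid

  private
    m : ℕ
    m = suc m′

  open Admissibility m

  module _ (X : Carrier) (q : ℕ → ℕ → Carrier) (q-0l : ∀ l → q 0 l ≈ X) (q-j0 : ∀ j → q j 0 ≈ X)
           (q-opposite : ∀ j l → j ℕ.+ l ≡ m → q j l ≈ X) where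
    private
      -- At most one k completes a pair to an admissible triple, so this product is `q j l` or 1. It
      -- converts the product over pairs into one over triples.
      thirds : ℕ → ℕ → Carrier
      thirds j l = ∏< m (λ k → choose (admissibleSum? j l k) (q j l) 1#)

      thirds-0l : ∀ l → thirds 0 l ≈ 1#
      thirds-0l l = ∏-1 m λ k _ → reflexive (choose-no (admissibleSum? 0 l k) λ (0≢0 , _) → 0≢0 ≡.refl)

      thirds-j0 : ∀ j → thirds j 0 ≈ 1#
      thirds-j0 j = ∏-1 m λ k _ → reflexive (choose-no (admissibleSum? j 0 k) λ (_ , 0≢0 , _) → 0≢0 ≡.refl)

      thirds-opposite : ∀ j l → j ℕ.+ l ≡ m → thirds j l ≈ 1#
      thirds-opposite j l eq = ∏-1 m λ k k<m →
        reflexive (choose-no (admissibleSum? j l k) (opposite-inadmissible k<m eq))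

      thirds-generic : ∀ j l → j ℕ.< m → l ℕ.< m → j ≢ 0 → l ≢ 0 → j ℕ.+ l ≢ m → thirds j l ≈ q j l
      thirds-generic j l j<m l<m j≢0 l≢0 j+l≢m with complement j<m l<m j≢0 l≢0 j+l≢m
      ... | k , k<m , adm = trans
        (∏-pick m k _ k<m λ k′ k′<m k′≢k → reflexive (choose-no (admissibleSum? j l k′)
          λ (_ , _ , _ , m∣) → k′≢k (complement-unique k′<m k<m m∣ (proj₂ (proj₂ (proj₂ adm))))))
        (reflexive (choose-yes (admissibleSum? j l k) adm))

      -- In a row other than row 0 two distinct columns are degenerate, l = 0 and the opposite of
      -- the row index. With the m entries of row 0 this makes m + 2 (m - 1) = 3m - 2 factors `X`.
      row-suc : ∀ j → suc j ℕ.< m → ∏< m (q (suc j)) ≈ X ^ 2 * ∏< m (thirds (suc j))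
      row-suc j j<m = begin
        ∏< m (q (suc j))
          ≈⟨ ∏-cong m split ⟩
        ∏< m (λ l → X₀ l * (X₁ l * thirds (suc j) l))
          ≈⟨ trans (∏-* m X₀ _) (*-congˡ (∏-* m X₁ _)) ⟩
        ∏< m X₀ * (∏< m X₁ * ∏< m (thirds (suc j)))
          ≈⟨ *-cong (trans (∏-pick m 0 X₀ (s≤s z≤n) λ l _ l≢0 → reflexive (choose-no (l ℕ.≟ 0) l≢0))
                           (reflexive (choose-yes (0 ℕ.≟ 0) {X} {1#} ≡.refl)))
                    (*-congʳ (trans (∏-pick m opp X₁ (s≤s (ℕ.m∸n≤m m′ j))
                                            λ l _ l≢ → reflexive (choose-no (l ℕ.≟ opp) l≢))
                                    (reflexive (choose-yes (opp ℕ.≟ opp) ≡.refl)))) ⟩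
        X * (X * ∏< m (thirds (suc j)))
          ≈⟨ *-assoc _ _ _ ⟨
        X * X * ∏< m (thirds (suc j))
          ≈⟨ *-congʳ (*-congˡ (*-identityʳ X)) ⟨
        X ^ 2 * ∏< m (thirds (suc j)) ∎
        where
        opp : ℕ
        opp = m ∸ suc j

        X₀ X₁ : ℕ → Carrier
        X₀ l = choose (l ℕ.≟ 0) X 1#
        X₁ l = choose (l ℕ.≟ opp) X 1#

        j+opp : suc j ℕ.+ opp ≡ m
        j+opp = ℕ.m+[n∸m]≡n (ℕ.<⇒≤ j<m)

        opp≢0 : opp ≢ 0
        opp≢0 = ℕ.m>n⇒m∸n≢0 j<m

        split : ∀ l → l ℕ.< m → q (suc j) l ≈ X₀ l * (X₁ l * thirds (suc j) l)
        split l l<m with l ℕ.≟ 0 | l ℕ.≟ opp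
        ... | yes ≡.refl | yes 0≡opp  = contradiction (≡.sym 0≡opp) opp≢0
        ... | yes ≡.refl | no  _      = trans (q-j0 (suc j)) (sym (trans
          (*-congˡ (trans (*-identityˡ _) (thirds-j0 (suc j)))) (*-identityʳ X)))
        ... | no  l≢0    | yes ≡.refl = trans (q-opposite (suc j) opp j+opp) (sym (trans (*-identityˡ _)
          (trans (*-congˡ (thirds-opposite (suc j) opp j+opp)) (*-identityʳ X))))
        ... | no  l≢0    | no  l≢opp  = sym (trans (*-identityˡ _) (trans (*-identityˡ _)
          (thirds-generic (suc j) l j<m l<m (λ ()) l≢0 λ eq →
            l≢opp (ℕ.+-cancelˡ-≡ (suc j) l opp (≡.trans eq (≡.sym j+opp))))))

    ∏-pairs : ∏< m (λ j → ∏< m (q j)) ≈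
              X ^ (3 ℕ.* m ∸ 2) * ∏< m (λ j → ∏< m (λ l → ∏< m (λ k → choose (admissibleSum? j l k) (q j l) 1#)))
    ∏-pairs = begin
      ∏< m (λ j → ∏< m (q j))
        ≈⟨ ∏-suc m′ _ ⟩
      ∏< m (q 0) * ∏< m′ (λ j → ∏< m (q (suc j)))
        ≈⟨ *-cong (trans (∏-cong m λ l _ → q-0l l) (∏-const m X))
                  (trans (∏-cong m′ λ j j<m′ → row-suc j (s≤s j<m′))
                         (trans (∏-* m′ (λ _ → X ^ 2) _) (*-congʳ (∏-const m′ (X ^ 2))))) ⟩
      X ^ m * ((X ^ 2) ^ m′ * ∏< m′ (λ j → ∏< m (thirds (suc j))))
        ≈⟨ *-assoc _ _ _ ⟨
      X ^ m * (X ^ 2) ^ m′ * ∏< m′ (λ j → ∏< m (thirds (suc j)))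
        ≈⟨ *-cong exponent (sym (trans (*-congʳ (∏-1 m λ l _ → thirds-0l l)) (*-identityˡ _))) ⟩
      X ^ (3 ℕ.* m ∸ 2) * (∏< m (thirds 0) * ∏< m′ (λ j → ∏< m (thirds (suc j))))
        ≈⟨ *-congˡ (∏-suc m′ λ j → ∏< m (thirds j)) ⟨
      X ^ (3 ℕ.* m ∸ 2) * ∏< m (λ j → ∏< m (thirds j)) ∎
      where
      exponent : X ^ m * (X ^ 2) ^ m′ ≈ X ^ (3 ℕ.* m ∸ 2)
      exponent = trans (*-congˡ (Exp.^-assocʳ semiring X 2 m′)) (trans (sym (Exp.^-homo-* semiring X m (2 ℕ.* m′)))
        (reflexive (≡.cong (X ^_) (≡.sym (≡.cong (_∸ 2) (ℕ.*-suc 3 m′))))))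

  ∏-triples : (h : ℕ → ℕ → ℕ → Carrier) {P : Fin m × Fin m × Fin m → Set} (P? : Decidable P) →
    (∀ j l k → P (j , l , k) → AdmissibleSum (toℕ j) (toℕ l) (toℕ k)) →
    (∀ j l k → AdmissibleSum (toℕ j) (toℕ l) (toℕ k) → P (j , l , k)) →
    ⨀ (filter P? (cartesianProduct (allFin m) (cartesianProduct (allFin m) (allFin m))))
      (λ (j , l , k) → h (toℕ j) (toℕ l) (toℕ k)) ≈
    ∏< m (λ j → ∏< m (λ l → ∏< m (λ k → choose (admissibleSum? j l k) (h j l k) 1#)))
  ∏-triples h P? P⇒ ⇒P = begin
    ⨀ (filter P? triples) (λ (j , l , k) → h (toℕ j) (toℕ l) (toℕ k))
      ≈⟨ ⨀-filter P? triples _ ⟩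
    ⨀ triples (λ t → choose (P? t) (h (toℕ (proj₁ t)) (toℕ (proj₁ (proj₂ t))) (toℕ (proj₂ (proj₂ t)))) 1#)
      ≈⟨ ⨀-cong triples (λ (j , l , k) → same j l k) ⟩
    ⨀ triples (λ (j , l , k) → value (toℕ j) (toℕ l) (toℕ k))
      ≈⟨ ⨀-cartesianProduct (allFin m) pairs (λ (j , l , k) → value (toℕ j) (toℕ l) (toℕ k)) ⟩
    ⨀ (allFin m) (λ j → ⨀ pairs (λ (l , k) → value (toℕ j) (toℕ l) (toℕ k)))
      ≈⟨ ⨀-cong (allFin m) (λ j →
           trans (⨀-cartesianProduct (allFin m) (allFin m) (λ (l , k) → value (toℕ j) (toℕ l) (toℕ k)))
           (trans (⨀-cong (allFin m) (λ l → ⨀-allFin m (value (toℕ j) (toℕ l))))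
                  (⨀-allFin m (λ l → ∏< m (value (toℕ j) l))))) ⟩
    ⨀ (allFin m) (λ j → ∏< m (λ l → ∏< m (value (toℕ j) l)))
      ≈⟨ ⨀-allFin m (λ j → ∏< m (λ l → ∏< m (value j l))) ⟩
    ∏< m (λ j → ∏< m (λ l → ∏< m (value j l))) ∎
    where
    pairs : List (Fin m × Fin m)
    pairs = cartesianProduct (allFin m) (allFin m)

    triples : List (Fin m × Fin m × Fin m)
    triples = cartesianProduct (allFin m) pairs

    value : ℕ → ℕ → ℕ → Carrier
    value j l k = choose (admissibleSum? j l k) (h j l k) 1#

    same : ∀ j l k → choose (P? (j , l , k)) (h (toℕ j) (toℕ l) (toℕ k)) 1# ≈ value (toℕ j) (toℕ l) (toℕ k)
    same j l k with P? (j , l , k)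
    ... | yes p = reflexive (≡.sym (choose-yes (admissibleSum? (toℕ j) (toℕ l) (toℕ k)) (P⇒ j l k p)))
    ... | no ¬p = reflexive (≡.sym (choose-no (admissibleSum? (toℕ j) (toℕ l) (toℕ k)) (¬p ∘ ⇒P j l k)))

-- The roots of D

𝟙-∣ : ∀ {m} → 3 ∣ m → 𝟙[3∣ m ] ≡ 1
𝟙-∣ {m} 3∣m = ≡.cong (λ b → if b then 1 else 0) (dec-true (3 ∣? m) 3∣m)

𝟙-∤ : ∀ {m} → ¬ 3 ∣ m → 𝟙[3∣ m ] ≡ 0
𝟙-∤ {m} 3∤m = ≡.cong (λ b → if b then 1 else 0) (dec-false (3 ∣? m) 3∤m)

module Powers (R : CommutativeRing c ℓ) where
  open CommutativeRing R hiding (_-_; zero)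
  open RingNotation rawRing
  open FiniteSums R
  open SetoidReasoning setoid
  open Exp semiring using (^-congˡ; ^-assocʳ)
  open CommutativeExp commutativeSemiring using (^-distrib-*)

  1^ : ∀ k → 1# ^ k ≈ 1#
  1^ zero    = refl
  1^ (suc k) = trans (*-identityˡ _) (1^ k)

  fromℕ-^ : ∀ a k → fromℕ (a ℕ.^ k) ≈ fromℕ a ^ k
  fromℕ-^ a zero    = +-identityʳ 1#
  fromℕ-^ a (suc k) = trans (SemiringMultProperties.×1-homo-* semiring a (a ℕ.^ k)) (*-congˡ (fromℕ-^ a k))

  ∏-^ : ∀ m k f → ∏< m f ^ k ≈ ∏< m (λ j → f j ^ k)
  ∏-^ m k f = begin
    ∏< m f ^ k ≈⟨ ∏-const k _ ⟨
    ∏< k (λ _ → ∏< m f) ≈⟨ ∏-swap k m (λ _ → f) ⟩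
    ∏< m (λ j → ∏< k (λ _ → f j)) ≈⟨ ∏-cong m (λ j _ → ∏-const k (f j)) ⟩
    ∏< m (λ j → f j ^ k) ∎

  -- Over all pairs each a k occurs with exponent 2m, so the roots of unity drop out and only the m²
  -- factors 2 remain. This is the constant in the definition of D.
  ∏-pairs-of-roots : ∀ m (a : ℕ → Carrier) → (∀ k → a k ^ m ≈ 1#) →
    ∏< m (λ j → ∏< m (λ l → fromℕ 2 * (a j * a l))) ≈ fromℕ (2 ℕ.^ (m ℕ.^ 2))
  ∏-pairs-of-roots m a a^m≈1 = begin
    ∏< m (λ j → ∏< m (λ l → fromℕ 2 * (a j * a l)))
      ≈⟨ ∏-cong m (λ j _ → trans (∏-* m _ _) (*-cong (∏-const m (fromℕ 2))
           (trans (∏-* m _ a) (trans (*-congʳ (trans (∏-const m (a j)) (a^m≈1 j))) (*-identityˡ _))))) ⟩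
    ∏< m (λ _ → fromℕ 2 ^ m * ∏< m a)
      ≈⟨ trans (∏-const m _) (^-distrib-* (fromℕ 2 ^ m) (∏< m a) m) ⟩
    (fromℕ 2 ^ m) ^ m * ∏< m a ^ m
      ≈⟨ *-cong (^-assocʳ (fromℕ 2) m m) (trans (∏-^ m m a) (∏-1 m λ k _ → a^m≈1 k)) ⟩
    fromℕ 2 ^ (m ℕ.* m) * 1#
      ≈⟨ trans (*-identityʳ _) (sym (fromℕ-^ 2 (m ℕ.* m))) ⟩
    fromℕ (2 ℕ.^ (m ℕ.* m))
      ≡⟨ ≡.cong (λ k → fromℕ (2 ℕ.^ (m ℕ.* k))) (ℕ.*-identityʳ m) ⟨
    fromℕ (2 ℕ.^ (m ℕ.^ 2)) ∎

module Bracket (R : CommutativeRing c ℓ) where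
  open CommutativeRing R hiding (_-_; zero)
  open RingNotation rawRing
  open WForm R using (bracket)
  open Solver R
  open SetoidReasoning setoid

  -- With p = e^{ix} and q = e^{iy} this is sin 2x + sin 2y - sin (2x + 2y) = 4 sin x sin y sin (x +
  -- y), multiplied by -2i.
  bracket-factors : ∀ {p p⁻ q q⁻} → p * p⁻ ≈ 1# → q * q⁻ ≈ 1# →
    bracket (p * p) (p⁻ * p⁻) (q * q) (q⁻ * q⁻) ≈ (p - p⁻) * (q - q⁻) * (p * q - p⁻ * q⁻)
  bracket-factors {p} {p⁻} {q} {q⁻} pp⁻≈1 qq⁻≈1 = sym (begin
    (p - p⁻) * (q - q⁻) * (p * q - p⁻ * q⁻)
      ≈⟨ solve 4 (λ p p′ q q′ → (p :- p′) :* (q :- q′) :* (p :* q :- p′ :* q′) :=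
           p :* p :* (q :* q) :- p :* p :* (q :* q′) :- p :* p′ :* (q :* q) :+ p′ :* p′ :* (q :* q′)
           :+ p :* p′ :* (q′ :* q′) :- p′ :* p′ :* (q′ :* q′)) refl p p⁻ q q⁻ ⟩
    p * p * (q * q) - p * p * (q * q⁻) - p * p⁻ * (q * q) + p⁻ * p⁻ * (q * q⁻) + p * p⁻ * (q⁻ * q⁻) - p⁻ * p⁻ * (q⁻ * q⁻)
      ≈⟨ +-congʳ (+-cong (+-cong (+-cong (+-congˡ (-‿cong (trans (*-congˡ qq⁻≈1) (*-identityʳ _))))
           (-‿cong (trans (*-congʳ pp⁻≈1) (*-identityˡ _)))) (trans (*-congˡ qq⁻≈1) (*-identityʳ _)))
           (trans (*-congʳ pp⁻≈1) (*-identityˡ _))) ⟩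
    bracket (p * p) (p⁻ * p⁻) (q * q) (q⁻ * q⁻) ∎)

  bracket-1ˡ : ∀ q q⁻ → bracket 1# 1# q q⁻ ≈ 0#
  bracket-1ˡ = solve 2 (λ q q′ → :1 :* q :- :1 :- q :+ :1 :+ q′ :- :1 :* q′ := :0) refl

  bracket-1ʳ : ∀ p p⁻ → bracket p p⁻ 1# 1# ≈ 0#
  bracket-1ʳ = solve 2 (λ p p′ → p :* :1 :- p :- :1 :+ p′ :+ :1 :- p′ :* :1 := :0) refl

  bracket-inverse : ∀ {p p⁻ q q⁻} → p * p⁻ ≈ 1# → q * q⁻ ≈ 1# → p * q ≈ 1# → bracket p p⁻ q q⁻ ≈ 0#
  bracket-inverse {p} {p⁻} {q} {q⁻} pp⁻≈1 qq⁻≈1 pq≈1 = begin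
    p * q - p - q + p⁻ + q⁻ - p⁻ * q⁻
      ≈⟨ +-cong (+-cong (+-congˡ p⁻≈q) q⁻≈p) (-‿cong (trans (*-cong p⁻≈q q⁻≈p) (*-comm q p))) ⟩
    p * q - p - q + q + p - p * q
      ≈⟨ solve 2 (λ p q → p :* q :- p :- q :+ q :+ p :- p :* q := :0) refl p q ⟩
    0# ∎
    where
    p⁻≈q : p⁻ ≈ q
    p⁻≈q = begin
      p⁻ ≈⟨ *-identityʳ p⁻ ⟨
      p⁻ * 1# ≈⟨ *-congˡ pq≈1 ⟨
      p⁻ * (p * q) ≈⟨ solve 3 (λ a p q → a :* (p :* q) := (p :* a) :* q) refl p⁻ p q ⟩
      (p * p⁻) * q ≈⟨ trans (*-congʳ pp⁻≈1) (*-identityˡ q) ⟩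
      q ∎

    q⁻≈p : q⁻ ≈ p
    q⁻≈p = begin
      q⁻ ≈⟨ *-identityˡ q⁻ ⟨
      1# * q⁻ ≈⟨ *-congʳ pq≈1 ⟨
      p * q * q⁻ ≈⟨ *-assoc _ _ _ ⟩
      p * (q * q⁻) ≈⟨ trans (*-congˡ qq⁻≈1) (*-identityʳ p) ⟩
      p ∎

module VerlindeRoots (ℝ : Reals) (sin : Reals.Carrier ℝ → Reals.Carrier ℝ) (π : Reals.Carrier ℝ) (n : ℕ)
                     (η : Reals.Carrier ℝ × Reals.Carrier ℝ) where
  private
    module R where
      open Reals ℝ public hiding (_-_; zero)
      open RingNotation rawRing public
      open RealField ℝ public
      open Solver commutativeRing public
  open ComplexField ℝ
  open CommutativeRing complexRing hiding (_-_; zero)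
  open RingNotation rawRing
  open FiniteSums complexRing
  open Polynomials complexRing using
    ( C; X; X-C; C-cong; C-*; C-+; C-^; C-sub; C-neg; C-fromℕ; C-0; 𝟙≋C; X-C-cong; X-C-cancel
    ; eval; eval-cong )
  open RootMultiplicity ℝ
  open RingProperties ring using () renaming (x∙y⁻¹≈ε⇒x≈y to x-y≈0⇒x≈y)
  open WForm complexRing using (bracket)
  open Bracket complexRing
  open ResultantOfForm complexRing using (formResᵤ; resᵤ-product)
  open Verlinde ℝ sin π using (Admissible; admissible?; triples; s; V)
  open Exp semiring using (^-congˡ; ^-assocʳ; ^-homo-*)
  open CommutativeExp commutativeSemiring using (^-distrib-*)
  open Powers complexRing
  open Solver complexRing
  open SetoidReasoning setoid

  private
    ℂ[w] : CommutativeRing 0ℓ 0ℓ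
    ℂ[w] = Polynomials.polyRing complexRing

    module A where
      open CommutativeRing ℂ[w] public hiding (_-_; zero)
      open RingNotation (CommutativeRing.rawRing ℂ[w]) public
      open FiniteSums ℂ[w] public
      open WForm ℂ[w] public
      open Powers ℂ[w] public
      open ListProduct (CommutativeRing.*-commutativeMonoid ℂ[w]) public

    m : ℕ
    m = suc (suc n)

  module _ (η-unit : η * conj η ≈ 1#) (im-η^m : im (η ^ m) R.≈ R.0#)
           (im-η^j≉0 : ∀ j → 0 ℕ.< j → j ℕ.< m → im (η ^ j) R.≉ R.0#) where
    private
      η̄ ζ ζ̄ : Carrier
      η̄ = conj η
      ζ = η * η
      ζ̄ = η̄ * η̄

      η^-unit : ∀ a → η ^ a * η̄ ^ a ≈ 1#
      η^-unit a = trans (sym (^-distrib-* η η̄ a)) (trans (^-congˡ a η-unit) (1^ a))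

      ζ^ : ∀ a → ζ ^ a ≈ η ^ a * η ^ a
      ζ^ a = ^-distrib-* η η a

      ζ̄^ : ∀ a → ζ̄ ^ a ≈ η̄ ^ a * η̄ ^ a
      ζ̄^ a = ^-distrib-* η̄ η̄ a

      ζ^-unit : ∀ a → ζ ^ a * ζ̄ ^ a ≈ 1#
      ζ^-unit a = begin
        ζ ^ a * ζ̄ ^ a ≈⟨ *-cong (ζ^ a) (ζ̄^ a) ⟩
        η ^ a * η ^ a * (η̄ ^ a * η̄ ^ a)
          ≈⟨ solve 2 (λ x y → x :* x :* (y :* y) := x :* y :* (x :* y)) refl (η ^ a) (η̄ ^ a) ⟩
        η ^ a * η̄ ^ a * (η ^ a * η̄ ^ a) ≈⟨ *-cong (η^-unit a) (η^-unit a) ⟩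
        1# * 1# ≈⟨ *-identityˡ 1# ⟩
        1# ∎

      -- η^(qm) = ±1
      sign-real : ∀ q → η̄ ^ (m ℕ.* q) ≈ η ^ (m ℕ.* q)
      sign-real q = begin
        η̄ ^ (m ℕ.* q) ≈⟨ ^-assocʳ η̄ m q ⟨
        (η̄ ^ m) ^ q ≈⟨ ^-congˡ q (trans (sym (conj-^ η m)) (conj-real (η ^ m) im-η^m)) ⟩
        (η ^ m) ^ q ≈⟨ ^-assocʳ η m q ⟩
        η ^ (m ℕ.* q) ∎

      sign² : ∀ q → η ^ (m ℕ.* q) * η ^ (m ℕ.* q) ≈ 1#
      sign² q = trans (*-congˡ (sym (sign-real q))) (η^-unit (m ℕ.* q))

      ζ^m≈1 : ζ ^ m ≈ 1#
      ζ^m≈1 = trans (ζ^ m) (≡.subst (λ k → η ^ k * η ^ k ≈ 1#) (ℕ.*-identityʳ m) (sign² 1))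

      -- If ζᵈ = η²ᵈ were 1, then ηᵈ would equal its inverse, which is its conjugate, and so would
      -- be real, against the choice of π as the least positive zero.
      ζ^d≉1 : ∀ d → 0 ℕ.< d → d ℕ.< m → ζ ^ d ≉ 1#
      ζ^d≉1 d 0<d d<m ζ^d≈1 = im-η^j≉0 d 0<d d<m (R.*-cancelˡ (R.fromℕ≉0 1) (R.trans
          (R.solve 1 (λ x → R.:fromℕ 2 R.:* x R.:= x R.:+ x) R.refl (im (η ^ d)))
          (R.trans (R.+-congˡ (im-cong self-conjugate)) (R.trans (R.-‿inverseʳ _) (R.sym (R.zeroʳ _))))))
        where
        self-conjugate : η ^ d ≈ conj (η ^ d)
        self-conjugate = begin
          η ^ d ≈⟨ *-identityʳ _ ⟨
          η ^ d * 1# ≈⟨ *-congˡ (η^-unit d) ⟨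
          η ^ d * (η ^ d * η̄ ^ d) ≈⟨ *-assoc _ _ _ ⟨
          η ^ d * η ^ d * η̄ ^ d ≈⟨ *-congʳ (trans (sym (ζ^ d)) ζ^d≈1) ⟩
          1# * η̄ ^ d ≈⟨ *-identityˡ _ ⟩
          η̄ ^ d ≈⟨ conj-^ η d ⟨
          conj (η ^ d) ∎

      ζ^a≉0 : ∀ a → ζ ^ a ≉ 0#
      ζ^a≉0 a ζ^a≈0 = 1≉0 (trans (sym (ζ^-unit a)) (trans (*-congʳ ζ^a≈0) (zeroˡ _)))

      𝕚≉0 : 𝕚 ≉ 0#
      𝕚≉0 𝕚≈0 = 1≉0 (begin
        1# ≈⟨ solve 0 (:1 := :- :- :1) refl ⟩
        - - 1# ≈⟨ -‿cong 𝕚²≈-1 ⟨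
        - (𝕚 * 𝕚) ≈⟨ -‿cong (trans (*-congʳ 𝕚≈0) (zeroˡ 𝕚)) ⟩
        - 0# ≈⟨ solve 0 (:- :0 := :0) refl ⟩
        0# ∎)

      β : ℕ → Carrier
      β k = 𝕚 * ζ ^ k

      β-root : ∀ k → β k ^ m ≈ 𝕚 ^ m
      β-root k = begin
        (𝕚 * ζ ^ k) ^ m ≈⟨ ^-distrib-* 𝕚 (ζ ^ k) m ⟩
        𝕚 ^ m * (ζ ^ k) ^ m ≈⟨ *-congˡ (ζ^k^m≈1 k) ⟩
        𝕚 ^ m * 1# ≈⟨ *-identityʳ _ ⟩
        𝕚 ^ m ∎
        where
        ζ^k^m≈1 : ∀ k → (ζ ^ k) ^ m ≈ 1#
        ζ^k^m≈1 k = trans (^-assocʳ ζ k m) (trans (reflexive (≡.cong (ζ ^_) (ℕ.*-comm k m)))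
          (trans (sym (^-assocʳ ζ m k)) (trans (^-congˡ k ζ^m≈1) (1^ k))))

      -- Two equal nodes would give ζᵏ⁻ʲ = 1, contradicting that ζ is a primitive mth root of unity.
      β-unit : ∀ j k → j ℕ.< k → k ℕ.< m → ∃ λ y → (β k - β j) * y ≈ 1#
      β-unit j k j<k k<m = (β k - β j) ⁻¹ᶜ , ⁻¹ᶜ-inverseʳ λ diff≈0 → distinct (x-y≈0⇒x≈y _ _ diff≈0)
        where
        distinct : β k ≉ β j
        distinct βk≈βj with ℕ.m≤n⇒∃[o]m+o≡n j<k
        ... | o , ≡.refl = ζ^d≉1 (suc o) (s≤s z≤n)
          (ℕ.≤-<-trans (≡.subst (suc o ℕ.≤_) (ℕ.+-suc j o) (ℕ.m≤n+m (suc o) j)) k<m)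
          (*-cancelˡ (ζ^a≉0 j) (begin
            ζ ^ j * ζ ^ suc o ≈⟨ ^-homo-* ζ j (suc o) ⟨
            ζ ^ (j ℕ.+ suc o) ≡⟨ ≡.cong (ζ ^_) (ℕ.+-suc j o) ⟩
            ζ ^ (suc j ℕ.+ o) ≈⟨ *-cancelˡ 𝕚≉0 βk≈βj ⟩
            ζ ^ j ≈⟨ *-identityʳ _ ⟨
            ζ ^ j * 1# ∎))

      ½ : Carrier
      ½ = fromℕ 2 ⁻¹ᶜ

      g : ℕ → ℕ → Carrier
      g j l = bracket (ζ ^ j) (ζ̄ ^ j) (ζ ^ l) (ζ̄ ^ l)

    -- The root r_{j,l} of D.
    r : ℕ → ℕ → Carrier
    r j l = ½ * - (𝕚 * g j l)

    private
      2r : ∀ j l → r j l + r j l ≈ - (𝕚 * g j l)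
      2r j l = begin
        ½ * x + ½ * x ≈⟨ solve 2 (λ h x → h :* x :+ h :* x := (:fromℕ 2 :* h) :* x) refl ½ x ⟩
        (fromℕ 2 * ½) * x ≈⟨ *-congʳ (⁻¹ᶜ-inverseʳ (fromℕ≉0 1)) ⟩
        1# * x ≈⟨ *-identityˡ x ⟩
        x ∎
        where
        x : Carrier
        x = - (𝕚 * g j l)

      r≈0 : ∀ {j l} → g j l ≈ 0# → r j l ≈ 0#
      r≈0 g≈0 = trans (*-congˡ (-‿cong (trans (*-congˡ g≈0) (zeroʳ 𝕚))))
        (solve 1 (λ h → h :* (:- :0) := :0) refl ½)

      X-C-0 : ∀ {a} → a ≈ 0# → X-C a A.≈ X
      X-C-0 a≈0 = A.trans (X-C-cong a≈0) (A.trans (A.+-congˡ (A.-‿cong C-0)) (AS.solve 1 (λ x → x AS.:- AS.:0 AS.:= x) A.refl X))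
        where module AS = Solver ℂ[w]

      C-bracket : ∀ p p⁻ q q⁻ → C (bracket p p⁻ q q⁻) A.≈ A.bracket (C p) (C p⁻) (C q) (C q⁻)
      C-bracket p p⁻ q q⁻ = A.trans (C-sub _ _) (A.+-cong (A.trans (C-+ _ _) (A.+-cong (A.trans (C-+ _ _) (A.+-cong
        (A.trans (C-sub _ _) (A.+-cong (A.trans (C-sub _ _) (A.+-congʳ (C-* p q))) A.refl)) A.refl)) A.refl))
        (A.-‿cong (C-* p⁻ q⁻)))

      form-root : ∀ j l → A.form (C 𝕚) X (C (β j)) (C (β l)) A.≈
                  A.fromℕ 2 A.* (C (ζ ^ j) A.* C (ζ ^ l)) A.* X-C (r j l)
      form-root j l = A.trans (A.form-cong A.refl A.refl (C-* 𝕚 (ζ ^ j)) (C-* 𝕚 (ζ ^ l)))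
        (A.form-factors
          (A.trans (A.sym (C-* 𝕚 𝕚)) (A.trans (C-cong 𝕚²≈-1) (A.trans (C-neg 1#) (A.-‿cong (A.sym 𝟙≋C)))))
          (unit j) (unit l)
          (A.trans (A.sym (C-+ (r j l) (r j l))) (A.trans (C-cong (2r j l)) (A.trans (C-neg _)
            (A.-‿cong (A.trans (C-* 𝕚 (g j l)) (A.*-congˡ (C-bracket _ _ _ _))))))))
        where
        unit : ∀ a → C (ζ ^ a) A.* C (ζ̄ ^ a) A.≈ A.1#
        unit a = A.trans (A.sym (C-* _ _)) (A.trans (C-cong (ζ^-unit a)) (A.sym 𝟙≋C))

    root : Fin m × Fin m × Fin m → Carrier
    root (j , l , k) = r (toℕ j) (toℕ l)

    resᵤ-roots : formResᵤ 𝕚 m A.≈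
      A.fromℕ (2 ℕ.^ (m ℕ.^ 2)) A.* X A.^ (3 ℕ.* m ∸ 2) A.* linearProduct (map root (triples m))
    resᵤ-roots = A.trans (resᵤ-product 𝕚 𝕚²≈-1 (suc n) β (*-identityʳ 𝕚) β-root β-unit)
      (A.trans (A.∏-cong m λ j _ → A.∏-cong m λ l _ → form-root j l)
      (A.trans (A.∏-cong m λ j _ → A.∏-* m _ _)
      (A.trans (A.∏-* m _ _)
      (A.trans (A.*-cong (A.∏-pairs-of-roots m (λ k → C (ζ ^ k)) C-root)
        (A.trans (TripleProducts.∏-pairs ℂ[w] (suc n) X (λ j l → X-C (r j l))
            (λ l → X-C-0 (r≈0 {0} {l} (bracket-1ˡ (ζ ^ l) (ζ̄ ^ l))))
            (λ j → X-C-0 (r≈0 {j} {0} (bracket-1ʳ (ζ ^ j) (ζ̄ ^ j))))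
            (λ j l j+l≡m → X-C-0 (r≈0 {j} {l} (bracket-inverse (ζ^-unit j) (ζ^-unit l)
              (trans (sym (^-homo-* ζ j l)) (trans (reflexive (≡.cong (ζ ^_) j+l≡m)) ζ^m≈1))))))
          (A.*-congˡ (A.sym (A.trans (A.reflexive (A.⨀-map root (triples m) X-C))
            (TripleProducts.∏-triples ℂ[w] (suc n) (λ j l k → X-C (r j l)) (admissible? m)
              (λ _ _ _ adm → adm) (λ _ _ _ adm → adm)))))))
      (A.sym (A.*-assoc _ _ _))))))
      where
      C-root : ∀ k → C (ζ ^ k) A.^ m A.≈ A.1#
      C-root k = A.trans (A.sym (C-^ (ζ ^ k) m)) (A.trans (C-cong
        (trans (^-assocʳ ζ k m) (trans (reflexive (≡.cong (ζ ^_) (ℕ.*-comm k m)))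
          (trans (sym (^-assocʳ ζ m k)) (trans (^-congˡ k ζ^m≈1) (1^ k))))))
        (A.sym 𝟙≋C))

    D-roots : ∀ D → A.fromℕ (2 ℕ.^ (m ℕ.^ 2)) A.* X A.^ (3 ℕ.* m ∸ 2) A.* D A.≈ formResᵤ 𝕚 m →
              D A.≈ linearProduct (map root (triples m))
    D-roots D isD = X^-cancel (3 ℕ.* m ∸ 2) (constant-cancel (A.trans (A.sym (A.*-assoc _ _ _))
      (A.trans isD (A.trans resᵤ-roots (A.*-assoc _ _ _)))))
      where
      -- Each factor w is cancelled as the monic polynomial w - 0.
      X^-cancel : ∀ k {p q} → X A.^ k A.* p A.≈ X A.^ k A.* q → p A.≈ q
      X^-cancel zero    eq = A.trans (A.sym (A.*-identityˡ _)) (A.trans eq (A.*-identityˡ _))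
      X^-cancel (suc k) eq = X^-cancel k (X-C-cancel 0# (A.trans (A.*-congʳ (X-C-0 refl))
        (A.trans (A.trans (A.sym (A.*-assoc _ _ _)) (A.trans eq (A.*-assoc _ _ _))) (A.*-congʳ (A.sym (X-C-0 refl))))))

      N : ℕ
      N = 2 ℕ.^ (m ℕ.^ 2)

      N≉0 : fromℕ N ≉ 0#
      N≉0 N≈0 = ^-≉0 (m ℕ.^ 2) (fromℕ≉0 1) (trans (sym (fromℕ-^ 2 (m ℕ.^ 2))) N≈0)

      inverse : C (fromℕ N ⁻¹ᶜ) A.* A.fromℕ N A.≈ A.1#
      inverse = A.trans (A.*-congˡ (A.sym (C-fromℕ N))) (A.trans (A.sym (C-* _ _))
        (A.trans (C-cong (trans (*-comm _ _) (⁻¹ᶜ-inverseʳ N≉0))) (A.sym 𝟙≋C)))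

      constant-cancel : ∀ {p q} → A.fromℕ N A.* p A.≈ A.fromℕ N A.* q → p A.≈ q
      constant-cancel {p} {q} eq = A.trans (A.sym (unit p)) (A.trans (A.*-congˡ eq) (unit q))
        where
        unit : ∀ p → C (fromℕ N ⁻¹ᶜ) A.* (A.fromℕ N A.* p) A.≈ p
        unit p = A.trans (A.sym (A.*-assoc _ _ _)) (A.trans (A.*-congʳ inverse) (A.*-identityˡ p))

    private
      -- `S a` is sin (aπ/m), and `d a` is 2i sin (aπ/m).
      S d : ℕ → Carrier
      S a = fromℝ (im (η ^ a))
      d a = η ^ a - η̄ ^ a

      d≈ : ∀ a → d a ≈ fromℕ 2 * 𝕚 * S a
      d≈ a = trans (+-congˡ (-‿cong (sym (conj-^ η a)))) (z-conj (η ^ a))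

      g≈ : ∀ j l → g j l ≈ d j * d l * d (j ℕ.+ l)
      g≈ j l = begin
        bracket (ζ ^ j) (ζ̄ ^ j) (ζ ^ l) (ζ̄ ^ l)
          ≈⟨ bracket-cong (ζ^ j) (ζ̄^ j) (ζ^ l) (ζ̄^ l) ⟩
        bracket (η ^ j * η ^ j) (η̄ ^ j * η̄ ^ j) (η ^ l * η ^ l) (η̄ ^ l * η̄ ^ l)
          ≈⟨ bracket-factors (η^-unit j) (η^-unit l) ⟩
        d j * d l * (η ^ j * η ^ l - η̄ ^ j * η̄ ^ l)
          ≈⟨ *-congˡ (+-cong (sym (^-homo-* η j l)) (-‿cong (sym (^-homo-* η̄ j l)))) ⟩
        d j * d l * d (j ℕ.+ l) ∎
        where
        bracket-cong : ∀ {p p′ p⁻ p⁻′ q q′ q⁻ q⁻′} → p ≈ p′ → p⁻ ≈ p⁻′ → q ≈ q′ → q⁻ ≈ q⁻′ →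
                       bracket p p⁻ q q⁻ ≈ bracket p′ p⁻′ q′ q⁻′
        bracket-cong p≈ p⁻≈ q≈ q⁻≈ = +-cong (+-cong (+-cong (+-cong (+-cong
          (*-cong p≈ q≈) (-‿cong p≈)) (-‿cong q≈)) p⁻≈) q⁻≈) (-‿cong (*-cong p⁻≈ q⁻≈))

      -- If s + k is a multiple of m then sin (kπ/m) = ± sin (sπ/m).
      d²-complement : ∀ s k → m ∣ s ℕ.+ k → d s * d s ≈ d k * d k
      d²-complement s k (divides q eq) = sym (begin
        d k * d k
          ≈⟨ *-cong d-k d-k ⟩
        ε * (η̄ ^ s - η ^ s) * (ε * (η̄ ^ s - η ^ s))
          ≈⟨ solve 3 (λ e x y → e :* (y :- x) :* (e :* (y :- x)) := e :* e :* ((x :- y) :* (x :- y))) refl ε _ _ ⟩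
        ε * ε * (d s * d s)
          ≈⟨ trans (*-congʳ (sign² q)) (*-identityˡ _) ⟩
        d s * d s ∎)
        where
        ε : Carrier
        ε = η ^ (m ℕ.* q)

        s+k≡mq : s ℕ.+ k ≡ m ℕ.* q
        s+k≡mq = ≡.trans eq (ℕ.*-comm q m)

        η^k : η ^ k ≈ ε * η̄ ^ s
        η^k = begin
          η ^ k ≈⟨ trans (sym (*-identityˡ _)) (*-congʳ (sym (η^-unit s))) ⟩
          η ^ s * η̄ ^ s * η ^ k
            ≈⟨ solve 3 (λ x y z → x :* y :* z := x :* z :* y) refl _ _ _ ⟩
          η ^ s * η ^ k * η̄ ^ s ≈⟨ *-congʳ (trans (sym (^-homo-* η s k)) (reflexive (≡.cong (η ^_) s+k≡mq))) ⟩
          ε * η̄ ^ s ∎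

        η̄^k : η̄ ^ k ≈ ε * η ^ s
        η̄^k = begin
          η̄ ^ k ≈⟨ trans (sym (*-identityˡ _)) (*-congʳ (sym (η^-unit s))) ⟩
          η ^ s * η̄ ^ s * η̄ ^ k
            ≈⟨ solve 3 (λ x y z → x :* y :* z := y :* z :* x) refl _ _ _ ⟩
          η̄ ^ s * η̄ ^ k * η ^ s
            ≈⟨ *-congʳ (trans (sym (^-homo-* η̄ s k)) (trans (reflexive (≡.cong (η̄ ^_) s+k≡mq)) (sign-real q))) ⟩
          ε * η ^ s ∎

        d-k : d k ≈ ε * (η̄ ^ s - η ^ s)
        d-k = trans (+-cong η^k (-‿cong η̄^k))
          (solve 3 (λ e x y → e :* y :- e :* x := e :* (y :- x)) refl ε (η ^ s) (η̄ ^ s))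

      -- Squaring removes the sign in sin ((j + l)π/m) = ± sin (kπ/m), so the asymmetric r j l leads
      -- to an expression symmetric in the triple.
      4r² : ∀ j l k → m ∣ j ℕ.+ l ℕ.+ k →
            fromℕ 4 * r j l ^ 2 ≈ (fromℕ 8 * S j * S l * S k) * (fromℕ 8 * S j * S l * S k)
      4r² j l k m∣j+l+k = begin
        fromℕ 4 * r j l ^ 2
          ≈⟨ solve 1 (λ x → :fromℕ 4 :* (x :* (x :* :1)) := (x :+ x) :* (x :+ x)) refl (r j l) ⟩
        (r j l + r j l) * (r j l + r j l)
          ≈⟨ *-cong step step ⟩
        - (𝕚 * (d j * d l * d (j ℕ.+ l))) * - (𝕚 * (d j * d l * d (j ℕ.+ l)))
          ≈⟨ solve 4 (λ i x y z → :- (i :* (x :* y :* z)) :* :- (i :* (x :* y :* z)) :=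
               (i :* i) :* ((x :* y) :* (x :* y)) :* (z :* z)) refl 𝕚 (d j) (d l) (d (j ℕ.+ l)) ⟩
        (𝕚 * 𝕚) * ((d j * d l) * (d j * d l)) * (d (j ℕ.+ l) * d (j ℕ.+ l))
          ≈⟨ *-cong (*-congˡ (*-cong (*-cong (d≈ j) (d≈ l)) (*-cong (d≈ j) (d≈ l))))
               (trans (d²-complement (j ℕ.+ l) k m∣j+l+k) (*-cong (d≈ k) (d≈ k))) ⟩
        (𝕚 * 𝕚) * ((2𝕚 * S j * (2𝕚 * S l)) * (2𝕚 * S j * (2𝕚 * S l))) * (2𝕚 * S k * (2𝕚 * S k))
          -- The i² in front and the six factors 2i make i⁸ · 2⁶, and 2⁶ = 8².
          ≈⟨ solve 4 regroup refl 𝕚 (S j) (S l) (S k) ⟩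
        ((𝕚 * 𝕚) * (𝕚 * 𝕚)) * ((𝕚 * 𝕚) * (𝕚 * 𝕚)) * ((fromℕ 8 * S j * S l * S k) * (fromℕ 8 * S j * S l * S k))
          ≈⟨ *-congʳ (*-cong 𝕚⁴ 𝕚⁴) ⟩
        1# * 1# * ((fromℕ 8 * S j * S l * S k) * (fromℕ 8 * S j * S l * S k))
          ≈⟨ trans (*-congʳ (*-identityˡ 1#)) (*-identityˡ _) ⟩
        (fromℕ 8 * S j * S l * S k) * (fromℕ 8 * S j * S l * S k) ∎
        where
        2𝕚 : Carrier
        2𝕚 = fromℕ 2 * 𝕚

        regroup : ∀ {n} → Polynomial n → Polynomial n → Polynomial n → Polynomial n → Polynomial n × Polynomial n
        regroup i x y z =
          (i :* i) :* ((2i :* x :* (2i :* y)) :* (2i :* x :* (2i :* y))) :* (2i :* z :* (2i :* z)) :=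
          ((i :* i) :* (i :* i)) :* ((i :* i) :* (i :* i)) :*
            ((:fromℕ 8 :* x :* y :* z) :* (:fromℕ 8 :* x :* y :* z))
          where
          2i = :fromℕ 2 :* i

        𝕚⁴ : (𝕚 * 𝕚) * (𝕚 * 𝕚) ≈ 1#
        𝕚⁴ = trans (*-cong 𝕚²≈-1 𝕚²≈-1) (solve 0 (:- :1 :* :- :1 := :1) refl)

        step : r j l + r j l ≈ - (𝕚 * (d j * d l * d (j ℕ.+ l)))
        step = trans (2r j l) (-‿cong (*-congˡ (g≈ j l)))

    summand : ℕ → Carrier → Carrier
    summand N a = (fromℕ 3 * fromℕ m ^ 2 * (fromℕ 4 * a ^ 2) ⁻¹ᶜ) ^ N

    summand-cong : ∀ N {a b} → a ≈ b → summand N a ≈ summand N b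
    summand-cong N a≈b = ^-congˡ N (*-congˡ (⁻¹ᶜ-cong (*-congˡ (^-congˡ 2 a≈b))))

    module _ (sin-η : ∀ j → sin (π R.* R.fromℕ j R.* R.fromℕ m R.⁻¹) R.≈ im (η ^ j)) where
      private
        sines : Fin m × Fin m × Fin m → R.Carrier
        sines (j , l , k) = R.fromℕ 8 R.* s m j R.* s m l R.* s m k

        -- The inverse at 0 is unspecified, so every denominator of the Verlinde sum must be
        -- nonzero. It is, because the three indices lie strictly between 0 and m.
        sines≉0 : ∀ t → Admissible m t → sines t R.≉ R.0#
        sines≉0 (j , l , k) (j≢0 , l≢0 , k≢0 , _) =
          R.*-≉0 (R.*-≉0 (R.*-≉0 (R.fromℕ≉0 7) (s≉0 j j≢0)) (s≉0 l l≢0)) (s≉0 k k≢0)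
          where
          s≉0 : ∀ a → toℕ a ≢ 0 → s m a R.≉ R.0#
          s≉0 a a≢0 s≈0 = im-η^j≉0 (toℕ a) (ℕ.n≢0⇒n>0 a≢0) (Fin.toℕ<n a) (R.trans (R.sym (sin-η (toℕ a))) s≈0)

        fromℝ-sines : ∀ j l k → fromℝ (sines (j , l , k)) ≈ fromℕ 8 * S (toℕ j) * S (toℕ l) * S (toℕ k)
        fromℝ-sines j l k = trans (fromℝ-* _ _) (*-cong (trans (fromℝ-* _ _) (*-cong (trans (fromℝ-* _ _)
          (*-cong (fromℝ-fromℕ 8) (fromℝ-cong (sin-η (toℕ j))))) (fromℝ-cong (sin-η (toℕ l)))))
          (fromℝ-cong (sin-η (toℕ k))))

        4root²⁻¹ : ∀ t → Admissible m t → (fromℕ 4 * root t ^ 2) ⁻¹ᶜ ≈ fromℝ (sines t R.⁻¹ R.* sines t R.⁻¹)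
        4root²⁻¹ t@(j , l , k) adm@(_ , _ , _ , m∣j+l+k) = begin
          (fromℕ 4 * root t ^ 2) ⁻¹ᶜ
            ≈⟨ ⁻¹ᶜ-cong (trans (4r² (toℕ j) (toℕ l) (toℕ k) m∣j+l+k)
                 (trans (sym (*-cong (fromℝ-sines j l k) (fromℝ-sines j l k))) (sym (fromℝ-* x x)))) ⟩
          fromℝ (x R.* x) ⁻¹ᶜ
            ≈⟨ fromℝ-⁻¹ (R.*-≉0 x≉0 x≉0) ⟩
          fromℝ ((x R.* x) R.⁻¹)
            ≈⟨ fromℝ-cong (R.sym (R.⁻¹-unique (R.trans
                 (R.solve 2 (λ x y → (x R.:* x) R.:* (y R.:* y) R.:= (x R.:* y) R.:* (x R.:* y)) R.refl x (x R.⁻¹))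
                 (R.trans (R.*-cong (R.⁻¹-inverseʳ x≉0) (R.⁻¹-inverseʳ x≉0)) (R.*-identityˡ R.1#))))) ⟩
          fromℝ (x R.⁻¹ R.* x R.⁻¹) ∎
          where
          x : R.Carrier
          x = sines t

          x≉0 : x R.≉ R.0#
          x≉0 = sines≉0 t adm

        module R^ where
          open Exp R.semiring public using (^-assocʳ)
          open CommutativeExp R.commutativeSemiring public using (^-distrib-*)

        summand-root : ∀ N t → Admissible m t →
          fromℝ (R.fromℕ 3 R.^ N R.* R.fromℕ m R.^ (2 ℕ.* N) R.* sines t R.⁻¹ R.^ (2 ℕ.* N)) ≈ summand N (root t)
        summand-root N t adm = begin
          fromℝ (R.fromℕ 3 R.^ N R.* R.fromℕ m R.^ (2 ℕ.* N) R.* y R.^ (2 ℕ.* N))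
            ≈⟨ fromℝ-cong (R.*-cong (R.*-congˡ (R.sym (R^.^-assocʳ (R.fromℕ m) 2 N))) (R.sym (R^.^-assocʳ y 2 N))) ⟩
          fromℝ (R.fromℕ 3 R.^ N R.* (R.fromℕ m R.^ 2) R.^ N R.* (y R.^ 2) R.^ N)
            ≈⟨ fromℝ-cong (R.trans (R.*-congʳ (R.sym (R^.^-distrib-* _ _ N))) (R.sym (R^.^-distrib-* _ _ N))) ⟩
          fromℝ ((R.fromℕ 3 R.* R.fromℕ m R.^ 2 R.* y R.^ 2) R.^ N)
            ≈⟨ fromℝ-^ _ N ⟩
          fromℝ (R.fromℕ 3 R.* R.fromℕ m R.^ 2 R.* y R.^ 2) ^ N
            ≈⟨ ^-congˡ N (trans (fromℝ-* _ _) (*-cong (trans (fromℝ-* _ _) (*-cong (fromℝ-fromℕ 3)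
                 (trans (fromℝ-^ (R.fromℕ m) 2) (^-congˡ 2 (fromℝ-fromℕ m)))))
                 (trans (fromℝ-cong (R.*-congˡ (R.*-identityʳ y))) (sym (4root²⁻¹ t adm))))) ⟩
          summand N (root t) ∎
          where
          y : R.Carrier
          y = sines t R.⁻¹

        fromℝ-∑-map : ∀ x h G L → All (λ t → fromℝ (x R.* h t) ≈ G (root t)) L →
                      fromℝ (x R.* R.∑ L h) ≈ ∑ (map root L) G
        fromℝ-∑-map x h G []      []         = trans (fromℝ-cong (R.zeroʳ x)) fromℝ-0
        fromℝ-∑-map x h G (t ∷ L) (eq ∷ eqs) = trans (fromℝ-cong (R.distribˡ _ _ _))
          (trans (fromℝ-+ _ _) (+-cong eq (fromℝ-∑-map x h G L eqs)))

      V-sum : ∀ N → fromℝ (V N m) ≈ ∑ (map root (triples m)) (summand N)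
      V-sum N = fromℝ-∑-map _ (λ t → sines t R.⁻¹ R.^ (2 ℕ.* N)) (summand N) (triples m)
        (All.map (λ {t} → summand-root N t) (All.all-filter (admissible? m)
          (cartesianProduct (allFin m) (cartesianProduct (allFin m) (allFin m)))))

    module _ (κ : Carrier) (4κ≈27 : fromℕ 4 * κ ≈ fromℕ 27) (3∣m : 3 ∣ m) where
      private
        open _∣_ 3∣m using () renaming (quotient to q; equality to m≡q*3)

        0<q : 0 ℕ.< q
        0<q = ℕ.n≢0⇒n>0 λ q≡0 → ℕ.1+n≢0 (≡.trans m≡q*3 (≡.cong (ℕ._* 3) q≡0))

        q<m : q ℕ.< m
        q<m = ≡.subst (q ℕ.<_) (≡.sym m≡q*3) (ℕ.m<m*n q 3 ⦃ ℕ.>-nonZero 0<q ⦄ (s≤s (s≤s z≤n)))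

        -- A primitive cube root of unity, since q = m/3 and ζ is a primitive mth root of unity.
        ω : Carrier
        ω = ζ ^ q

        ω³≈1 : ω * ω * ω ≈ 1#
        ω³≈1 = begin
          ω * ω * ω ≈⟨ solve 1 (λ x → x :* x :* x := x :* (x :* (x :* :1))) refl ω ⟩
          ω ^ 3 ≈⟨ ^-assocʳ ζ q 3 ⟩
          ζ ^ (q ℕ.* 3) ≡⟨ ≡.cong (ζ ^_) m≡q*3 ⟨
          ζ ^ m ≈⟨ ζ^m≈1 ⟩
          1# ∎

        ω²+ω+1≈0 : ω * ω + ω + 1# ≈ 0#
        ω²+ω+1≈0 = *-cancelˡ {ω - 1#} (λ ω-1≈0 → ζ^d≉1 q 0<q q<m (x-y≈0⇒x≈y _ _ ω-1≈0)) (begin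
          (ω - 1#) * (ω * ω + ω + 1#)
            ≈⟨ solve 1 (λ x → (x :- :1) :* (x :* x :+ x :+ :1) := x :* x :* x :- :1) refl ω ⟩
          ω * ω * ω - 1# ≈⟨ +-congʳ ω³≈1 ⟩
          1# - 1# ≈⟨ -‿inverseʳ 1# ⟩
          0# ≈⟨ zeroʳ _ ⟨
          (ω - 1#) * 0# ∎)

      -- (i (ω - ω²))² = 3 for the primitive cube root of unity ω.
      ρ : Carrier
      ρ = fromℕ 3 * ½ * (𝕚 * (ω - ω * ω))

      4ρ²≈27 : fromℕ 4 * ρ ^ 2 ≈ fromℕ 27
      4ρ²≈27 = begin
        fromℕ 4 * ρ ^ 2
          ≈⟨ solve 3 (λ h i w → let ρ = :fromℕ 3 :* h :* (i :* (w :- w :* w)) in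
               :fromℕ 4 :* (ρ :* (ρ :* :1)) :=
               :fromℕ 9 :* ((:fromℕ 2 :* h) :* (:fromℕ 2 :* h)) :* (i :* i) :*
                 (w :* w :* w :* w :- :fromℕ 2 :* (w :* w :* w) :+ w :* w)) refl ½ 𝕚 ω ⟩
        fromℕ 9 * ((fromℕ 2 * ½) * (fromℕ 2 * ½)) * (𝕚 * 𝕚) * (ω * ω * ω * ω - fromℕ 2 * (ω * ω * ω) + ω * ω)
          ≈⟨ *-cong (*-cong (*-congˡ (*-cong 2½≈1 2½≈1)) 𝕚²≈-1)
                    (+-congʳ (+-cong (*-congʳ ω³≈1) (-‿cong (*-congˡ ω³≈1)))) ⟩
        fromℕ 9 * (1# * 1#) * - 1# * (1# * ω - fromℕ 2 * 1# + ω * ω)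
          ≈⟨ solve 1 (λ w → :fromℕ 9 :* (:1 :* :1) :* :- :1 :* (:1 :* w :- :fromℕ 2 :* :1 :+ w :* w) :=
               :fromℕ 27 :- :fromℕ 9 :* (w :* w :+ w :+ :1)) refl ω ⟩
        fromℕ 27 - fromℕ 9 * (ω * ω + ω + 1#)
          ≈⟨ +-congˡ (-‿cong (trans (*-congˡ ω²+ω+1≈0) (zeroʳ _))) ⟩
        fromℕ 27 - 0#
          ≈⟨ solve 0 (:fromℕ 27 :- :0 := :fromℕ 27) refl ⟩
        fromℕ 27 ∎
        where
        2½≈1 : fromℕ 2 * ½ ≈ 1#
        2½≈1 = ⁻¹ᶜ-inverseʳ (fromℕ≉0 1)

      private
        ρ²≈κ : ρ * ρ ≈ κ
        ρ²≈κ = *-cancelˡ (fromℕ≉0 3) (trans (*-congˡ (*-congˡ (sym (*-identityʳ ρ)))) (trans 4ρ²≈27 (sym 4κ≈27)))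

      X²-κ-factors : X A.^ 2 A.- C κ A.≈ X-C ρ A.* X-C (- ρ)
      X²-κ-factors = A.trans (A.+-congˡ (A.-‿cong (A.trans (C-cong (sym ρ²≈κ)) (C-* ρ ρ))))
        (A.trans (AS.solve 2 (λ x r → x AS.:* (x AS.:* AS.:1) AS.:- r AS.:* r AS.:= (x AS.:- r) AS.:* (x AS.:- (AS.:- r)))
                   A.refl X (C ρ))
                 (A.*-congˡ (A.+-congˡ (A.-‿cong (A.sym (C-neg ρ))))))
        where module AS = Solver ℂ[w]

      -- Here 3m²/4a² is 3m²/27 = (m/3)², the source of the separate term for 3 ∣ m.
      summand-ρ : ∀ N {a} → fromℕ 4 * a ^ 2 ≈ fromℕ 27 → summand N a ≈ (fromℕ m * fromℕ 3 ⁻¹ᶜ) ^ (2 ℕ.* N)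
      summand-ρ N {a} 4a²≈27 = trans (^-congˡ N (begin
        fromℕ 3 * fromℕ m ^ 2 * (fromℕ 4 * a ^ 2) ⁻¹ᶜ
          ≈⟨ *-congˡ (trans (⁻¹ᶜ-cong 4a²≈27) (*-cancelˡ (fromℕ≉0 26) (trans (⁻¹ᶜ-inverseʳ (fromℕ≉0 26)) (sym 27t³)))) ⟩
        fromℕ 3 * fromℕ m ^ 2 * (t * t * t)
          ≈⟨ solve 3 (λ m t h → h :* (m :* (m :* :1)) :* (t :* t :* t) := (h :* t) :* ((m :* t) :* (m :* t :* :1)))
               refl (fromℕ m) t (fromℕ 3) ⟩
        (fromℕ 3 * t) * (fromℕ m * t) ^ 2
          ≈⟨ trans (*-congʳ 3t) (*-identityˡ _) ⟩
        (fromℕ m * t) ^ 2 ∎)) (^-assocʳ (fromℕ m * t) 2 N)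
        where
        t : Carrier
        t = fromℕ 3 ⁻¹ᶜ

        3t : fromℕ 3 * t ≈ 1#
        3t = ⁻¹ᶜ-inverseʳ (fromℕ≉0 2)

        27t³ : fromℕ 27 * (t * t * t) ≈ 1#
        27t³ = trans (solve 1 (λ t → :fromℕ 27 :* (t :* t :* t) :=
            (:fromℕ 3 :* t) :* ((:fromℕ 3 :* t) :* (:fromℕ 3 :* t))) refl t)
          (trans (*-cong 3t (*-cong 3t 3t)) (trans (*-identityˡ _) (*-identityˡ 1#)))

      4[-ρ]²≈27 : fromℕ 4 * (- ρ) ^ 2 ≈ fromℕ 27
      4[-ρ]²≈27 = trans (*-congˡ (solve 1 (λ x → (:- x) :* ((:- x) :* :1) := x :* (x :* :1)) refl ρ)) 4ρ²≈27

    MultiplicityAt : List Carrier → (Carrier → ℕ) → Carrier → Set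
    MultiplicityAt E μ a = Σ (List Carrier) (λ q → q A.* X-C a A.^ μ a A.≈ E) ×
                           ¬ Σ (List Carrier) (λ q → q A.* X-C a A.^ suc (μ a) A.≈ E)

    -- If 3 ∣ m, both ρ and -ρ occur in the list of roots, because w² - κ divides the product.
    -- Taking them out one after the other leaves a list whose product is E³, as in the other case.
    ∑-roots-of-D : ∀ N D E κ → fromℕ 4 * κ ≈ fromℕ 27 → D A.≈ linearProduct (map root (triples m)) →
      (¬ 3 ∣ m → D A.≈ E A.^ 3) → (3 ∣ m → D A.≈ (X A.^ 2 A.- C κ) A.* E A.^ 3) →
      ∀ roots (μ : Carrier → ℕ) → AllPairs _≉_ roots → (∀ a → eval E a ≈ 0# → Any (a ≈_) roots) →
      All (MultiplicityAt E μ) roots →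
      ∑ (map root (triples m)) (summand N) ≈
      fromℕ 𝟙[3∣ m ] * (fromℕ 2 * (fromℕ m * fromℕ 3 ⁻¹ᶜ) ^ (2 ℕ.* N)) +
      fromℕ 3 * ∑ roots (λ a → fromℕ (μ a) * summand N a)
    ∑-roots-of-D N D E κ 4κ≈27 D≋ cube cube′ roots μ distinct complete mult with 3 ∣? m
    ... | no 3∤m = trans
      (∑-roots-of-cube (summand N) (summand-cong N) E (map root (triples m)) roots μ (A.trans (A.sym D≋) (cube 3∤m)) distinct complete mult)
      (sym (trans (+-congʳ (trans (*-congʳ (reflexive (≡.cong fromℕ (𝟙-∤ 3∤m)))) (zeroˡ _))) (+-identityˡ _)))
    ... | yes 3∣m = begin
      ∑ L f
        ≈⟨ proj₂ (proj₂ remove₁) ⟩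
      f p + ∑ L₁ f
        ≈⟨ +-congˡ (proj₂ (proj₂ remove₂)) ⟩
      f p + (f (- p) + ∑ L₂ f)
        ≈⟨ +-cong (summand-ρ κ 4κ≈27 3∣m N (4ρ²≈27 κ 4κ≈27 3∣m))
             (+-cong (summand-ρ κ 4κ≈27 3∣m N (4[-ρ]²≈27 κ 4κ≈27 3∣m))
               (∑-roots-of-cube f (summand-cong N) E L₂ roots μ L₂≋ distinct complete mult)) ⟩
      w + (w + rest)
        ≈⟨ solve 2 (λ w x → w :+ (w :+ x) := :fromℕ 1 :* (:fromℕ 2 :* w) :+ x) refl w rest ⟩
      fromℕ 1 * (fromℕ 2 * w) + rest
        ≡⟨ ≡.cong (λ k → fromℕ k * (fromℕ 2 * w) + rest) (𝟙-∣ 3∣m) ⟨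
      fromℕ 𝟙[3∣ m ] * (fromℕ 2 * w) + rest ∎
      where
      f : Carrier → Carrier
      f = summand N

      p w rest : Carrier
      p    = ρ κ 4κ≈27 3∣m
      w    = (fromℕ m * fromℕ 3 ⁻¹ᶜ) ^ (2 ℕ.* N)
      rest = fromℕ 3 * ∑ roots (λ a → fromℕ (μ a) * f a)

      L : List Carrier
      L = map root (triples m)

      L≋ : linearProduct L A.≈ X-C p A.* (X-C (- p) A.* E A.^ 3)
      L≋ = A.trans (A.sym D≋) (A.trans (cube′ 3∣m)
        (A.trans (A.*-congʳ (X²-κ-factors κ 4κ≈27 3∣m)) (A.*-assoc _ _ _)))

      remove₁ : Σ (List Carrier) λ L₁ → linearProduct L A.≈ X-C p A.* linearProduct L₁ × ∑ L f ≈ f p + ∑ L₁ f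
      remove₁ = remove-root f (summand-cong N) p L (trans (eval-cong p L≋) (eval-X-C⊛-root p _))

      L₁ : List Carrier
      L₁ = proj₁ remove₁

      L₁≋ : linearProduct L₁ A.≈ X-C (- p) A.* E A.^ 3
      L₁≋ = X-C-cancel p (A.trans (A.sym (proj₁ (proj₂ remove₁))) L≋)

      remove₂ : Σ (List Carrier) λ L₂ → linearProduct L₁ A.≈ X-C (- p) A.* linearProduct L₂ × ∑ L₁ f ≈ f (- p) + ∑ L₂ f
      remove₂ = remove-root f (summand-cong N) (- p) L₁ (trans (eval-cong (- p) L₁≋) (eval-X-C⊛-root (- p) _))

      L₂ : List Carrier
      L₂ = proj₁ remove₂

      L₂≋ : linearProduct L₂ A.≈ E A.^ 3
      L₂≋ = X-C-cancel (- p) (A.trans (A.sym (proj₁ (proj₂ remove₂))) L₁≋)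

-- The Verlinde formula

open import Algebra.Definitions.RawMagma using (_,_)
open import Data.Integer.Base using (+_)
open import Data.Nat.Base using (_≤_)

module VerlindeFormula (ℝ : Reals) where
  private
    module R where
      open Reals ℝ public hiding (_-_; zero)
      open RingNotation rawRing public
      open RealField ℝ public
      open Solver commutativeRing public
  open ComplexField ℝ
  open CommutativeRing complexRing hiding (_-_; zero)
  open RingNotation rawRing
  open Polynomials complexRing using (C; X; X-C; eval)
  open ResultantOfForm complexRing using (formResᵤ)
  open Sine ℝ
  private
    module A where
      open CommutativeRing (Polynomials.polyRing complexRing) public hiding (_-_; zero)
      open RingNotation (CommutativeRing.rawRing (Polynomials.polyRing complexRing)) public

  27/4 : Carrier
  27/4 = Complex.fromℚ ℝ (+ 27 ℚ./ 4)

  4[27/4]≈27 : fromℕ 4 * 27/4 ≈ fromℕ 27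
  4[27/4]≈27 = trans (*-congʳ (sym (fromℝ-fromℕ 4))) (trans (sym (fromℝ-* (R.fromℕ 4) _)) (trans
    (fromℝ-cong (R.trans (R.solve 3 (λ a b c → a R.:* (b R.:* c) R.:= b R.:* (a R.:* c)) R.refl _ (R.fromℕ 27) _)
      (R.trans (R.*-congˡ (R.⁻¹-inverseʳ (R.fromℕ≉0 3))) (R.*-identityʳ _)))) (fromℝ-fromℕ 27)))

  verlinde-formula : ∀ sin → IsSine sin → ∀ π → IsPi sin π → ∀ m → 3 ≤ m → ∀ D E →
    A.fromℕ (2 ℕ.^ (m ℕ.^ 2)) A.* X A.^ (3 ℕ.* m ∸ 2) A.* D A.≈ formResᵤ 𝕚 m →
    (¬ 3 ∣ m → D A.≈ E A.^ 3) → (3 ∣ m → D A.≈ (X A.^ 2 A.- C 27/4) A.* E A.^ 3) →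
    ∀ roots (μ : Carrier → ℕ) → AllPairs _≉_ roots → (∀ a → eval E a ≈ 0# → Any (a ≈_) roots) →
    All (λ a → Σ (List Carrier) (λ q → q A.* X-C a A.^ μ a A.≈ E) ×
               ¬ Σ (List Carrier) (λ q → q A.* X-C a A.^ suc (μ a) A.≈ E)) roots →
    ∀ n → fromℝ (Verlinde.V ℝ sin π n m) ≈
      fromℕ 𝟙[3∣ m ] * (fromℕ 2 * (fromℕ m * fromℕ 3 ⁻¹ᶜ) ^ (2 ℕ.* n)) +
      fromℕ 3 * ∑ roots (λ a → fromℕ (μ a) * (fromℕ 3 * fromℕ m ^ 2 * (fromℕ 4 * a ^ 2) ⁻¹ᶜ) ^ n)
  -- Here m is k + 3. The modules on η and on the roots take m - 2 as their parameter, hence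
  -- `suc k`.
  verlinde-formula sin isSine π isPi _ (s≤s (s≤s (s≤s {n = k} z≤n))) D E isD cube cube′ roots μ distinct complete mult n =
    trans (VR.V-sum T.η-unit T.im-η^m T.im-η^j≉0 T.sin-jπ/m n)
      (VR.∑-roots-of-D T.η-unit T.im-η^m T.im-η^j≉0 n D E 27/4 4[27/4]≈27
        (VR.D-roots T.η-unit T.im-η^m T.im-η^j≉0 D isD)
        cube cube′ roots μ distinct complete mult)
    where
    module T where
      η        = Trigonometry.η ℝ isSine isPi (suc k)
      η-unit   = Trigonometry.η-unit ℝ isSine isPi (suc k)
      sin-jπ/m = Trigonometry.sin-jπ/m ℝ isSine isPi (suc k)
      im-η^m   = Trigonometry.im-η^m ℝ isSine isPi (suc k)
      im-η^j≉0 = Trigonometry.im-η^j≉0 ℝ isSine isPi (suc k)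
    module VR = VerlindeRoots ℝ sin π (suc k) T.η

-- Unfolding identifies polyRing with Poly and complexRing with ℂ.
opaque
  unfolding ComplexField._≈ᶜ_ Polynomials._≋_ WForm.form ResultantProduct.resultant

  theorem1p4 : (ℝ : Reals) →
      let open Sine ℝ
          open Complex ℝ
          open DPolynomial ℝ
          open RootSum ℝ
      in
      (sin : Reals.Carrier ℝ → Reals.Carrier ℝ) → IsSine sin →
      (π : Reals.Carrier ℝ) → IsPi sin π →
      (m : ℕ) → 3 ≤ m →
      (D : RawRing.Carrier ℂ[w]) → IsD m D →
      (E : RawRing.Carrier ℚ[w]) → IsE m D E →
      (𝓔 : DistinctRoots (toℂ[w] E)) →
      (n : ℕ) → 1 ≤ n →
      RawRing._≈_ ℂ (fromℝ (Verlinde.V ℝ sin π n m)) (rootSum n m 𝓔)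
  theorem1p4 ℝ sin isSine π isPi m 3≤m D isD E (cube , cube′) 𝓔 n _ =
    VerlindeFormula.verlinde-formula ℝ sin isSine π isPi m 3≤m D (DPolynomial.toℂ[w] ℝ E) isD cube cube′
      roots μ distinct (λ a → Equivalence.from (complete a))
      -- Divisibility by a power of w - a is the existence of a cofactor q; only its packaging
      -- changes.
      (All.map (λ ((q , eq) , maximal) → (q , eq) , λ (q , eq) → maximal (q , eq)) multiplicity) n
    where open DPolynomial.DistinctRoots 𝓔
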